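{- The recursive procedure findCompatibleOrder (described in full in the context) computes a compatible order of a Robinson space $(X,d)$ with $|X|=n$ in $O(n^2)$ time.
   Context: Let $X$ be a finite set of $n$ points. A dissimilarity on $X$ is a symmetric function $d:X\times X\to[0,\infty)$ with $d(x,x)=0$. "Order" means total order. An order $<$ on $X$ is compatible with $d$ if $x<y<z$ implies $d(x,z)\ge\max\{d(x,y),d(y,z)\}$. $(X,d)$ is a Robinson space if it admits a compatible order. Lists: $[\,]$ is the empty list, $x\cdot L$ is $L$ with $x$ put in front (cost $O(1)$), $L\mathbin{+\!\!+}L'$ is concatenation (cost linear in the length of $L$), concatenate$(L_1,\dots,L_k)=L_1\mathbin{+\!\!+}\cdots\mathbin{+\!\!+}L_k$ (cost $\sum_{i<k}|L_i|$), and reverse has linear cost. Reading or comparing distances costs $O(1)$. All procedures have $d$ as an implicit input. refine$(q,S)$: using a balanced binary search tree whose keys are the values $d(q,x)$, each key storing a list, insert every $x\in S$ at the front of the list of key $d(q,x)$ (creating the key with an empty list if it is absent). Return the lists by increasing key. The result is the ordered partition $[S_1,\dots,S_m]$ of $S$ into classes of equal distance to $q$, by increasing distance from $q$. recursiveRefine$(p,In,S,Out)$: (1) If $In\cup Out=\varnothing$, return $[S]$. (2) Let $q$ be the first element of $In$ or $Out$, and let $[S_1,\dots,S_m]=$ refine$(q,S)$. (3) If $q\in Out$, let $\alpha=\min(\{j\in\{1,\dots,m\}:d(S_j,q)>d(p,q)\}\cup\{m+1\})$, where $d(S_j,q)$ is the common distance from $q$ to the points of $S_j$, and let $[S_1',\dots,S_m']=[S_{\alpha-1},S_{\alpha-2},\dots,S_1,S_\alpha,S_{\alpha+1},\dots,S_m]$.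 Otherwise let $[S_1',\dots,S_m']=[S_1,\dots,S_m]$. (4) For $i=1,\dots,m$, let $In_i=$ concatenate$(S_1',\dots,S_{i-1}',In\setminus\{q\})$, $Out_i=$ concatenate$(S_{i+1}',\dots,S_m',Out\setminus\{q\})$, $T_i=$ recursiveRefine$(p,In_i,S_i',Out_i)$. (5) Return concatenate$(T_1,\dots,T_m)$. separateIfSeparable$(p,X')$, where $X'$ is a list sorted along an order $<'$: (1) Let $x_*,x^*$ be the minimum and maximum of $(X',<')$, $\Delta=d(x_*,x^*)$, $\delta=d(p,x_*)$. (2) If $\Delta\le\delta$, return $[(x_*,X')]$. (3) For $y\in X'\setminus\{x^*\}$ in increasing order $<'$: let $z$ be the element following $y$ in $<'$; if $d(x_*,y)\le\delta$, $d(z,x^*)\le\delta$ and $d(y,z)\ge\delta$, return $[(x_*,\{u\in X':u\le'y\}),(x^*,\{u\in X':z\le'u\})]$ (each part keeping the order $<'$). sortByBipartition$(p,Y)$, where $Y$ is a list of points other than $p$: (1) Let $L=[\,]$, $R=[\,]$, $Undecided=$ reverse$(Y)$. (2) For each $q$ of $Y$, from the last to the first: (2a) if $q\in Undecided$, choose arbitrarily either $R\gets q\cdot R$ or $L\gets q\cdot L$, and remove $q$ from $Undecided$; (2b) let $Skipped=[\,]$; (2c) for each $x\in Undecided$ from first to last: if $d(x,q)=d(p,q)$, then $Skipped\gets x\cdot Skipped$; otherwise, if ($d(x,q)<d(p,q)$ and $q\in L$) or ($d(x,q)>d(p,q)$ and $q\in R$), then $L\gets x\cdot L$ and $R\gets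 Skipped\mathbin{+\!\!+}R$, else $R\gets x\cdot R$ and $L\gets Skipped\mathbin{+\!\!+}L$; in both of these last two cases then $Skipped\gets[\,]$; (2d) $Undecided\gets$ reverse$(Skipped)$. (3) Return reverse$(L)\mathbin{+\!\!+}[p]\mathbin{+\!\!+}R$. findCompatibleOrder$(X)$: (1) If $X$ is empty, return $[\,]$. (2) Let $p\in X$, $X'=X\setminus\{p\}$, $[C_1,\dots,C_k]=$ recursiveRefine$(p,[p],X',[\,])$, $representedCopoints=[\,]$. (3) For $i\in\{1,\dots,k\}$ in decreasing order: let $C_i'=$ findCompatibleOrder$(C_i)$ and set $representedCopoints\gets$ separateIfSeparable$(p,C_i')\mathbin{+\!\!+}representedCopoints$. (4) Write $representedCopoints=[(x_1,T_1),\dots,(x_{k'},T_{k'})]$ and let $[x_{\sigma(1)},\dots,p,\dots,x_{\sigma(k')}]=$ sortByBipartition$(p,[x_1,\dots,x_{k'}])$. (5) Return concatenate$(T_{\sigma(1)},\dots,[p],\dots,T_{\sigma(k')})$. The output is $X$ as a list, read as a total order on $X$.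
   Formalization: In step (2a) the choice is arbitrary except that an undecided x^* from a separated copoint must go to R: with L the procedure can return an incompatible order (points 0,1,2,3 with d(0,2)=0, d(0,3)=2, all other distances 1, p=1). -}

module Defs where

open import Data.Bool.Base using (Bool; true; false; if_then_else_; _∧_; _∨_)
open import Data.Fin.Base using (Fin)
open import Data.Fin.Properties using (_≟_)
open import Data.List.Base
  using (List; []; _∷_; _++_; _∷ʳ_; length; map; reverse; span; filter; lookup; removeAt)
open import Data.List.Membership.Propositional using (_∈_)
open import Data.List.Relation.Binary.Sublist.Propositional using (_⊆_)
open import Data.Maybe.Base as Maybe using (Maybe; just; nothing; fromMaybe)
open import Data.Nat.Base using (ℕ; zero; suc; _+_)
open import Data.Product.Base using (Σ; ∃; _×_; _,_; proj₁; proj₂; map₂)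
open import Data.Unit.Base using (⊤; tt)
open import Level using (Level; 0ℓ) renaming (_⊔_ to _⊔ˡ_; suc to sucˡ)
open import Relation.Binary.Bundles using (DecTotalOrder; StrictTotalOrder)
open import Relation.Binary.Core using (Rel)
open import Relation.Binary.Definitions using (Minimum)
open import Relation.Binary.PropositionalEquality.Core using (_≡_)
open import Relation.Binary.Structures using (IsStrictTotalOrder)
open import Relation.Nullary.Decidable.Core using (does; ¬?)

import Algebra.Construct.NaturalChoice.Max as NaturalMax
import Data.List.Membership.DecPropositional as DecMembership
import Data.Tree.AVL as AVL
import Data.Tree.AVL.Map as AVLMap
import Relation.Binary.Properties.DecTotalOrder as DecTotalOrderProperties

private
  variable
    a b ℓ ℓ₁ ℓ₂ : Level
    A : Set a
    B : Set b
    n : ℕ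

-- The values of a dissimilarity.  Distances are only ever compared, so [0,∞)
-- enters through its order alone: a total order with least element 0#, whose
-- comparisons are decidable because the algorithm branches on them.

record DistanceScale a ℓ₁ ℓ₂ : Set (sucˡ (a ⊔ˡ ℓ₁ ⊔ˡ ℓ₂)) where
  field
    decTotalOrder : DecTotalOrder a ℓ₁ ℓ₂
  open DecTotalOrder decTotalOrder public hiding (_≟_)
  open DecTotalOrder decTotalOrder public using () renaming (_≟_ to _≈?_)
  open DecTotalOrderProperties decTotalOrder public
    using (_<_; <-strictTotalOrder)
  open StrictTotalOrder <-strictTotalOrder public using (_<?_)
  open NaturalMax totalOrder public using (_⊔_)
  field
    0#         : Carrier
    0#-minimum : Minimum _≤_ 0#

record Dissimilarity (V : DistanceScale a ℓ₁ ℓ₂) (n : ℕ) : Set (a ⊔ˡ ℓ₁) where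
  open DistanceScale V
  field
    d          : Fin n → Fin n → Carrier
    d-sym      : ∀ x y → d x y ≈ d y x
    d-diagonal : ∀ x → d x x ≈ 0#

module _ {V : DistanceScale a ℓ₁ ℓ₂} (X : Dissimilarity V n) where
  open DistanceScale V using (_≤_; _⊔_)
  open Dissimilarity X

  record CompatibleOrder (_≺_ : Rel (Fin n) ℓ) : Set (ℓ ⊔ˡ ℓ₂) where
    field
      isStrictTotalOrder : IsStrictTotalOrder _≡_ _≺_
      compatible         : ∀ {x y z} → x ≺ y → y ≺ z → (d x y ⊔ d y z) ≤ d x z

  Robinson : Set (sucˡ 0ℓ ⊔ˡ ℓ₂)
  Robinson = Σ (Rel (Fin n) 0ℓ) CompatibleOrder

-- Order of occurrence in a list.

Before : List A → Rel A _
Before L x y = (x ∷ y ∷ []) ⊆ L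

-- A run ends with a result and the number of elementary steps taken, or is
-- stuck: `nothing` marks a case in which the pseudocode prescribes no result,
-- or exhaustion of the bound on the recursion depth.

Timed : Set a → Set a
Timed A = Maybe (A × ℕ)

infixl 1 _>>=_ _>>_

return : A → Timed A
return x = just (x , 0)

_>>=_ : Timed A → (A → Timed B) → Timed B
nothing      >>= f = nothing
just (x , s) >>= f = Maybe.map (map₂ (s +_)) (f x)

tick : ℕ → Timed ⊤
tick s = just (tt , s)

_>>_ : Timed A → Timed B → Timed B
m >> k = m >>= λ _ → k

infixr 5 _++ᵗ_

_++ᵗ_ : List A → List A → Timed (List A)
L ++ᵗ M = do
  tick (suc (length L))
  return (L ++ M)

reverseᵗ : List A → Timed (List A)
reverseᵗ L = do
  tick (suc (length L))
  return (reverse L)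

concatenate : List (List A) → Timed (List A)
concatenate []                = do
  tick 1
  return []
concatenate (L ∷ [])          = do
  tick 1
  return L
concatenate (L ∷ Ls@(_ ∷ _)) = do
  M ← concatenate Ls
  L ++ᵗ M

lastOf : A → List A → A
lastOf x []       = x
lastOf x (y ∷ ys) = lastOf y ys

data Side : Set where
  left right : Side

-- A copoint representative together with the sorted list it stands for.

Block : ℕ → Set
Block n = Fin n × List (Fin n)

-- The choices left open by the pseudocode.  Each is a function of the data
-- identifying the moment at which it is made; no such data occur twice with
-- a genuine choice in one run, so quantifying over Choices covers every way
-- of choosing.
--   pivot     the position of p in the nonempty list x ∷ xs
--   preferIn  at (p , In , S , Out), with In and Out both nonempty, whether q
--             is the first element of In rather than that of Out
--   side      where sortByBipartition around p puts a still undecided q; the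
--             second argument is the list of results of separateIfSeparable,
--             whose concatenation is representedCopoints

record Choices (n : ℕ) : Set where
  field
    pivot    : Fin n → (xs : List (Fin n)) → Fin (suc (length xs))
    preferIn : Fin n → List (Fin n) → List (Fin n) → List (Fin n) → Bool
    side     : Fin n → List (List (Block n)) → Fin n → Side

-- When a copoint is separated into (x_* , T) and (x^* , U), the sorted lists
-- T and U are later copied without reversal, so T has to end up before p and U
-- after it.  Hence an undecided x^* must go to the right.  If it goes left the
-- output may be incompatible: with four points, d(0,2) = 0, d(0,3) = 2 and all
-- other distances 1, the pivot 1 and the sorted copoint [0,2,3], sending 3 to
-- the left yields 3, 1, 0, 2, whereas 0, 2, 1, 3 is compatible.  All other
-- choices remain arbitrary.

OrientsSeparated : Choices n → Set
OrientsSeparated {n} choices =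
  ∀ (p : Fin n) (parts : List (List (Block n))) {x T y U} →
  ((x , T) ∷ (y , U) ∷ []) ∈ parts → Choices.side choices p parts y ≡ right

module Algorithm {V : DistanceScale a ℓ₁ ℓ₂} (X : Dissimilarity V n)
                 (choices : Choices n) where
  open DistanceScale V using (Carrier; _≈?_; _≤?_; _<?_; <-strictTotalOrder)
  open Dissimilarity X using (d)
  open Choices choices
  open DecMembership (_≟_ {n}) using (_∈?_)
  open AVLMap <-strictTotalOrder using (Map; empty; insertWith; toList)

  Point : Set
  Point = Fin n

  Points : Set
  Points = List Point

  height : ∀ {W : Set b} → Map W → ℕ
  height (AVL.tree {h = h} _) = h

  -- An insertion is charged for a search path of maximal length.

  insertAll : Point → Points → Map Points → Timed (Map Points)
  insertAll q []      t = return t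
  insertAll q (x ∷ S) t = do
    tick (2 + height t)
    insertAll q S (insertWith (d q x) (λ old → x ∷ fromMaybe [] old) t)

  -- Every class is returned with its key, the common distance to q.

  refine : Point → Points → Timed (List (Carrier × Points))
  refine q S = do
    t ← insertAll q S empty
    tick (suc (length (toList t)))
    return (toList t)

  -- Turns [S₁,…,Sₘ] into [S_{α-1},…,S₁,S_α,…,Sₘ], where S_α is the first class
  -- with key greater than δ.

  reorder : Carrier → List (Carrier × Points) → Timed (List (Carrier × Points))
  reorder δ classes = do
    tick (suc (length classes))
    let near , far = span (λ c → proj₁ c ≤? δ) classes
    return (reverse near ++ far)

  data Next : Set where
    finished : Next
    fromIn   : (q : Point) (In∖q : Points) → Next
    fromOut  : (q : Point) (Out∖q : Points) → Next

  next : Point → Points → Points → Points → Next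
  next p []          S []            = finished
  next p (q ∷ In)    S []            = fromIn q In
  next p []          S (q ∷ Out)     = fromOut q Out
  next p I@(q ∷ In)  S O@(r ∷ Out)   =
    if preferIn p I S O then fromIn q In else fromOut r Out

  -- The natural number bounds the recursion depth.

  mutual
    recursiveRefineWithin : ℕ → Point → Points → Points → Points → Timed (List Points)
    recursiveRefineWithin fuel p In S Out =
      refineStep fuel p In S Out (next p In S Out)

    refineStep : ℕ → Point → Points → Points → Points → Next → Timed (List Points)
    refineStep _          p In S Out finished         = do
      tick 1
      return (S ∷ [])
    refineStep zero       p In S Out _                = nothing
    refineStep (suc fuel) p In S Out (fromIn q In∖q)  = do
      tick 1
      classes ← refine q S
      Ts ← refineClasses fuel p In∖q Out [] (map proj₂ classes)
      concatenate Ts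
    refineStep (suc fuel) p In S Out (fromOut q Out∖q) = do
      tick 1
      classes ← refine q S
      classes′ ← reorder (d p q) classes
      Ts ← refineClasses fuel p In Out∖q [] (map proj₂ classes′)
      concatenate Ts

    refineClasses : ℕ → Point → Points → Points → List Points → List Points →
                    Timed (List (List Points))
    refineClasses fuel p In Out before []          = return []
    refineClasses fuel p In Out before (S ∷ after) = do
      Inᵢ  ← concatenate (before ∷ʳ In)
      Outᵢ ← concatenate (after ∷ʳ Out)
      T    ← recursiveRefineWithin fuel p Inᵢ S Outᵢ
      Ts   ← refineClasses fuel p In Out (before ∷ʳ S) after
      return (T ∷ Ts)

  -- Each recursive call receives the same points except q.

  recursiveRefine : Point → Points → Points → Points → Timed (List Points)
  recursiveRefine p In S Out =
    recursiveRefineWithin (length In + length S + length Out) p In S Out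

  -- The loop over consecutive y, z; `before` holds the elements preceding y,
  -- in reverse.

  separateAt : (p x⁎ x* : Point) → Points → Point → Points → Timed (List (Block n))
  separateAt p x⁎ x* before y []         = nothing
  separateAt p x⁎ x* before y (z ∷ rest) = do
    tick 1
    if does (d x⁎ y ≤? d p x⁎) ∧ does (d z x* ≤? d p x⁎) ∧ does (d p x⁎ ≤? d y z)
      then (do lower ← reverseᵗ (y ∷ before)
               return ((x⁎ , lower) ∷ (x* , z ∷ rest) ∷ []))
      else separateAt p x⁎ x* (y ∷ before) z rest

  separateIfSeparable : Point → Points → Timed (List (Block n))
  separateIfSeparable p []       = nothing
  separateIfSeparable p (x ∷ xs) = do
    tick (suc (length xs))
    let x* = lastOf x xs
    if does (d x x* ≤? d p x)
      then return ((x , x ∷ xs) ∷ [])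
      else separateAt p x x* [] x xs

  -- The pass of q over Undecided.  q∈L and q∈R are determined once per pass:
  -- the pass moves only points other than q.

  distribute : (p q : Point) (q∈L q∈R : Bool) (L R Skipped Undecided : Points) →
               Timed (Points × Points × Points)
  distribute p q q∈L q∈R L R Skipped []              = return (L , R , Skipped)
  distribute p q q∈L q∈R L R Skipped (x ∷ Undecided) = do
    tick 1
    if does (d x q ≈? d p q)
      then distribute p q q∈L q∈R L R (x ∷ Skipped) Undecided
      else if (does (d x q <? d p q) ∧ q∈L) ∨ (does (d p q <? d x q) ∧ q∈R)
      then (do R′ ← Skipped ++ᵗ R
               distribute p q q∈L q∈R (x ∷ L) R′ [] Undecided)
      else (do L′ ← Skipped ++ᵗ L
               distribute p q q∈L q∈R L′ (x ∷ R) [] Undecided)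

  decide : Side → Point → (L R Undecided : Points) → Points × Points × Points
  decide s q L R Undecided with does (q ∈? Undecided) | s
  ... | false | _     = L , R , Undecided
  ... | true  | left  = q ∷ L , R , filter (λ x → ¬? (x ≟ q)) Undecided
  ... | true  | right = L , q ∷ R , filter (λ x → ¬? (x ≟ q)) Undecided

  bipartition : Point → (Point → Side) → (L R Undecided : Points) → Points →
                Timed (Points × Points)
  bipartition p sideOf L R Undecided []       = return (L , R)
  bipartition p sideOf L R Undecided (q ∷ qs) = do
    tick (suc (length Undecided))
    let L₁ , R₁ , Undecided₁ = decide (sideOf q) q L R Undecided
    tick (length L₁ + length R₁)
    L₂ , R₂ , Skipped ←
      distribute p q (does (q ∈? L₁)) (does (q ∈? R₁)) L₁ R₁ [] Undecided₁
    Undecided₂ ← reverseᵗ Skipped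
    bipartition p sideOf L₂ R₂ Undecided₂ qs

  sortByBipartition : Point → (Point → Side) → Points → Timed Points
  sortByBipartition p sideOf Y = do
    Y′ ← reverseᵗ Y
    L , R ← bipartition p sideOf [] [] Y′ Y′
    L′ ← reverseᵗ L
    concatenate (L′ ∷ (p ∷ []) ∷ R ∷ [])

  blockOf : List (Block n) → Point → Timed Points
  blockOf []            y = nothing
  blockOf ((x , T) ∷ bs) y = do
    tick 1
    if does (x ≟ y) then return T else blockOf bs y

  blocksOf : List (Block n) → Points → Timed (List Points)
  blocksOf bs []       = return []
  blocksOf bs (y ∷ ys) = do
    T  ← blockOf bs y
    Ts ← blocksOf bs ys
    return (T ∷ Ts)

  -- The natural number bounds the recursion depth.

  mutual
    findWithin : ℕ → Points → Timed Points
    findWithin _          []       = do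
      tick 1
      return []
    findWithin zero       (x ∷ xs) = nothing
    findWithin (suc fuel) (x ∷ xs) = do
      tick (suc (length (x ∷ xs)))
      let p  = lookup (x ∷ xs) (pivot x xs)
          X′ = removeAt (x ∷ xs) (pivot x xs)
      Cs    ← recursiveRefine p (p ∷ []) X′ []
      parts ← representCopoints fuel p Cs
      representedCopoints ← concatenate parts
      order ← sortByBipartition p (side p parts) (map proj₁ representedCopoints)
      Ts    ← blocksOf ((p , p ∷ []) ∷ representedCopoints) order
      concatenate Ts

    representCopoints : ℕ → Point → List Points → Timed (List (List (Block n)))
    representCopoints fuel p []       = return []
    representCopoints fuel p (C ∷ Cs) = do
      parts ← representCopoints fuel p Cs
      C′    ← findWithin fuel C
      part  ← separateIfSeparable p C′
      return (part ∷ parts)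

  findCompatibleOrder : Points → Timed Points
  findCompatibleOrder L = findWithin (length L) L

module Submission where

-- Fix one compatible order ≺ and a pivot p.  recursiveRefine lists the
-- copoints in such an order that, on either side of p in ≺, a later copoint is
-- never strictly inside an earlier one.  A copoint is separable exactly when
-- its two ends lie on different sides of p in ≺, and then any cut found by
-- separateIfSeparable leaves both halves of diameter at most the distance δ
-- from p and all distances across at least δ.
--
-- sortByBipartition settles the sides from far to near.  Its arbitrary choices
-- split the representatives into consecutive components, in each of which the
-- sides agree with ≺ or are all mirrored, while a representative u is at the
-- distance d u p from every point of a later, nearer component.  A triple from
-- different copoints is therefore compatible: within one component by ≺, and
-- otherwise after replacing the points of nearer components by p.  A triple
-- meeting a copoint twice needs only the diameter bounds, and a triple inside
-- a copoint is handled by recursion.  No compatible order other than ≺ is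
-- ever constructed.
--
-- For the time, refining S by q into classes of sizes s₁, …, sₘ costs
-- O(|S| m), which is absorbed by |S| plus the Σ sᵢ sⱼ (i ≠ j) pairs separated
-- for good.  So a call on n points costs O(n) plus the number of pairs lying in
-- different copoints, and these sum to O(n²) over the recursion.

open import Data.Bool.Base using (Bool; true; false; if_then_else_; _∧_; _∨_)
open import Data.Empty using (⊥)
open import Data.Fin.Base as Fin using (Fin)
open import Data.Fin.Properties using (_≟_)
open import Data.List.Base
  using (List; []; _∷_; _++_; _∷ʳ_; length; map; concat; reverse; span; filter; lookup;
    removeAt; allFin)
open import Data.List.Membership.Propositional using (_∈_; _∉_)
open import Data.List.Membership.Propositional.Properties
  using (∈-++⁺ˡ; ∈-++⁺ʳ; ∈-++⁻; ∈-concat⁻′; ∈-concat⁺′; ∈-map⁺; ∈-map⁻; ∈-allFin)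
open import Data.List.Properties
  using (map-∘; length-tabulate; filter-all; filter-reject; ++-assoc; ++-identityʳ; length-++;
    length-reverse; length-map; map-++; reverse-++; unfold-reverse; reverse-involutive;
    concat-++; ∷ʳ-++)
open import Data.List.Relation.Binary.Permutation.Propositional
  using (_↭_; prep; ↭-refl; ↭-sym; ↭-trans; ↭-reflexive; ↭⇒↭ₛ; module PermutationReasoning)
open import Data.List.Relation.Binary.Pointwise using (Pointwise; []; _∷_)
open import Data.List.Relation.Binary.Sublist.Propositional using (_⊆_)
open import Data.List.Relation.Unary.All as All using (All; []; _∷_)
open import Data.List.Relation.Unary.AllPairs as AllPairs using (AllPairs; []; _∷_)
open import Data.List.Relation.Unary.Any using (here; there)
open import Data.List.Relation.Unary.Linked as Linked using (Linked; []; [-]; _∷_)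
open import Data.List.Relation.Unary.Unique.Propositional using (Unique)
open import Data.List.Relation.Unary.Unique.Propositional.Properties using (allFin⁺)
open import Data.Maybe.Base as Maybe using (Maybe; just; nothing; fromMaybe)
open import Data.Nat.Base hiding (compare; _⊔_)
open import Data.Nat.Properties hiding (_≟_; _≤?_; _<?_; <-strictTotalOrder)
open import Data.Nat.Tactic.RingSolver using (solve-∀)
open import Data.Product.Base using (∃; ∃-syntax; _×_; _,_; proj₁; proj₂)
open import Data.Sum.Base using (_⊎_; inj₁; inj₂; [_,_]′)
open import Function.Base using (_∘_; id; _on_)
open import Level using (Level; 0ℓ) renaming (_⊔_ to _⊔ˡ_)
open import Relation.Binary.Bundles using (StrictTotalOrder)
open import Relation.Binary.Core using (Rel)
open import Relation.Binary.Definitions using (Tri; tri<; tri≈; tri>)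
open import Relation.Binary.PropositionalEquality
  using (_≡_; _≢_; refl; sym; trans; cong; cong₂; subst; subst₂; setoid; isEquivalence; resp₂;
    module ≡-Reasoning)
open import Relation.Binary.Structures using (IsStrictTotalOrder)
open import Relation.Nullary using (¬_; Dec; yes; no; does)
open import Relation.Nullary.Decidable using (¬?; dec-true; dec-false)
open import Relation.Nullary.Negation using (contradiction)

import Algebra.Construct.NaturalChoice.Max as NaturalMax
import Data.List.Membership.DecPropositional as DecMembership
import Data.List.Relation.Binary.Permutation.Propositional.Properties as Perm
import Data.List.Relation.Binary.Permutation.Setoid.Properties as SetoidPerm
import Data.List.Relation.Binary.Sublist.Propositional as Sub
import Data.List.Relation.Binary.Sublist.Propositional.Properties as Subₚ
import Data.List.Relation.Unary.All.Properties as Allₚ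
import Data.List.Relation.Unary.AllPairs.Properties as AllPairsₚ
import Data.Tree.AVL as AVL
import Data.Tree.AVL.Indexed as IndexedAVL
import Data.Tree.AVL.Map as AVLMap
import Relation.Binary.Properties.DecTotalOrder as DecTotalOrderProperties

open import Defs

-- The obstacle is that the two halves of a separated copoint are copied without reversal, while a
-- run may mirror whole components relative to ≺: x^* must end on the right whatever its side in ≺.
-- This works because no pass ever decides x^*. A farther representative q is at distance d p q from
-- every point of a copoint with points on both sides of p, so q only skips x^*. Nor is x^* carried
-- along with other skipped points: those moved together lie on one side of p in ≺, whereas x^* is
-- directly followed by x_* from the other side. The side of x^* is therefore always an arbitrary
-- choice, which `OrientsSeparated` directs; its pass then sends x_* to the other side, because
-- d(x_*, x^*) > δ.
--
-- The time bounds use a sum of squares as potential: 17 per square in the refinement, 41 in the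
-- whole recursion. The difference 24 pays, through the separated pairs, for the quadratic work on
-- the at most 2k representatives of k copoints.

private
  variable
    a b ℓ ℓ′ ℓ₁ ℓ₂ v w : Level
    A : Set a
    B : Set b

-- Total-correctness triples for timed runs

Yields : Timed A → (A → ℕ → Set ℓ) → Set _
Yields m P = ∃[ x ] ∃[ t ] (m ≡ just (x , t) × P x t)

yields-return : ∀ {x : A} {P : A → ℕ → Set ℓ} → P x 0 → Yields (return x) P
yields-return Px = _ , _ , refl , Px

yields-bind : ∀ {P : A → ℕ → Set ℓ} {Q : B → ℕ → Set ℓ′} {m : Timed A} {f : A → Timed B} →
              Yields m P →
              (∀ {x s} → P x s → Yields (f x) (λ y t → Q y (s + t))) →
              Yields (m >>= f) Q
yields-bind {f = f} (x , s , refl , Px) k with f x | k Px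
... | _ | y , t , refl , Qy = y , s + t , refl , Qy

yields-tick : ∀ {P : A → ℕ → Set ℓ} {s} {m : Timed A} →
              Yields m (λ x t → P x (s + t)) → Yields (tick s >> m) P
yields-tick {m = m} ym with m | ym
... | _ | x , t , refl , Px = x , _ , refl , Px

yields-bind-≡ : ∀ {P : ℕ → Set ℓ} {Q : B → ℕ → Set ℓ′} {m : Timed A} {f : A → Timed B} {x} →
                Yields m (λ y t → y ≡ x × P t) →
                (∀ {s} → P s → Yields (f x) (λ y t → Q y (s + t))) →
                Yields (m >>= f) Q
yields-bind-≡ {f = f} (x , s , refl , refl , Ps) k with f x | k Ps
... | _ | y , t , refl , Qy = y , s + t , refl , Qy

yields-weaken : ∀ {P : A → ℕ → Set ℓ} {Q : A → ℕ → Set ℓ′} {m : Timed A} →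
                (∀ {x t} → P x t → Q x t) → Yields m P → Yields m Q
yields-weaken f (x , t , eq , Px) = x , t , eq , f Px

yields-if : ∀ {P : A → ℕ → Set ℓ} {m m′ : Timed A} c →
            (c ≡ true → Yields m P) → (c ≡ false → Yields m′ P) → Yields (if c then m else m′) P
yields-if true  yes-case no-case = yes-case refl
yields-if false yes-case no-case = no-case refl

yields-if-dec : ∀ {P : A → ℕ → Set ℓ} {m m′ : Timed A} {Q : Set ℓ′} (Q? : Dec Q) →
                (Q → Yields m P) → (¬ Q → Yields m′ P) → Yields (if does Q? then m else m′) P
yields-if-dec (yes Qx)  yes-case no-case = yes-case Qx
yields-if-dec (no ¬Qx)  yes-case no-case = no-case ¬Qx

yields-weaken-≡ : ∀ {P : ℕ → Set ℓ} {Q : A → ℕ → Set ℓ′} {m : Timed A} {x} →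
                  (∀ {t} → P t → Q x t) → Yields m (λ y t → y ≡ x × P t) → Yields m Q
yields-weaken-≡ f (x , t , eq , refl , Pt) = x , t , eq , f Pt

yields-++ : (L M : List A) → Yields (L ++ᵗ M) (λ N t → N ≡ L ++ M × t ≡ suc (length L))
yields-++ L M = _ , _ , refl , refl , cong suc (+-identityʳ _)

yields-reverse : (L : List A) → Yields (reverseᵗ L) (λ N t → N ≡ reverse L × t ≡ suc (length L))
yields-reverse L = _ , _ , refl , refl , cong suc (+-identityʳ _)

-- The last list is not copied.

concatenate-∷ʳ : (Ls : List (List A)) (M : List A) →
  Yields (concatenate (Ls ∷ʳ M))
         (λ N t → N ≡ concat Ls ++ M × t ≡ length (concat Ls) + length Ls + 1)
concatenate-∷ʳ []                 M = _ , _ , refl , refl , refl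
concatenate-∷ʳ (L ∷ [])           M = _ , _ , refl
  , cong (_++ M) (sym (++-identityʳ L))
  , trans (cost (length L)) (cong (λ l → l + 1 + 1) (cong length (sym (++-identityʳ L))))
  where
  cost : ∀ l → 1 + (suc l + 0) ≡ l + 1 + 1
  cost = solve-∀
concatenate-∷ʳ (L ∷ Ls@(L′ ∷ Ls′)) M =
  yields-bind {m = concatenate (Ls ∷ʳ M)} (concatenate-∷ʳ Ls M) λ where
    (refl , refl) → yields-weaken (λ where
        (refl , refl) → sym (++-assoc L (concat Ls) M)
                      , trans (cost (length (concat Ls)) (length Ls) (length L))
                              (cong (λ l → l + suc (length Ls) + 1) (sym (length-++ L))))
      (yields-++ L _)
  where
  cost : ∀ c k l → c + k + 1 + suc l ≡ l + c + suc k + 1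
  cost = solve-∀

yields-concatenate : (Ls : List (List A)) →
  Yields (concatenate Ls) (λ N t → N ≡ concat Ls × t ≤ length (concat Ls) + length Ls + 1)
yields-concatenate []       = _ , _ , refl , refl , ≤-refl
yields-concatenate (L ∷ []) =
  _ , _ , refl , sym (++-identityʳ L) , m≤n+m 1 _
yields-concatenate (L ∷ Ls@(_ ∷ _)) =
  yields-bind-≡ {m = concatenate Ls} (yields-concatenate Ls) λ {s} s≤ →
    yields-weaken-≡ (λ where
        refl → refl , (begin
          s + suc (length L)
            ≤⟨ +-monoˡ-≤ _ s≤ ⟩
          length (concat Ls) + length Ls + 1 + suc (length L)
            ≡⟨ cost (length (concat Ls)) (length Ls) (length L) ⟩
          length L + length (concat Ls) + suc (length Ls) + 1
            ≡⟨ cong (λ l → l + suc (length Ls) + 1) (length-++ L) ⟨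
          length (concat (L ∷ Ls)) + length (L ∷ Ls) + 1 ∎))
      (yields-++ L _)
  where
  open ≤-Reasoning
  cost : ∀ c k l → c + k + 1 + suc l ≡ l + c + suc k + 1
  cost = solve-∀

-- Counting the pairs separated by a partition

NonEmpty : List A → Set
NonEmpty L = 1 ≤ length L

sumSquares : List (List A) → ℕ
sumSquares []       = 0
sumSquares (L ∷ Ls) = length L * length L + sumSquares Ls

sumSquares-++ : (Ls Ms : List (List A)) → sumSquares (Ls ++ Ms) ≡ sumSquares Ls + sumSquares Ms
sumSquares-++ []       Ms = refl
sumSquares-++ (L ∷ Ls) Ms =
  trans (cong (length L * length L +_) (sumSquares-++ Ls Ms)) (sym (+-assoc (length L * length L) _ _))

length≤length-concat : {Ls : List (List A)} → All NonEmpty Ls → length Ls ≤ length (concat Ls)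
length≤length-concat []                  = z≤n
length≤length-concat {Ls = L ∷ Ls} (l ∷ ls) =
  subst (_ ≤_) (sym (length-++ L)) (+-mono-≤ l (length≤length-concat ls))

-- A list of M nonempty classes on N points separates at least N (M - 1)
-- ordered pairs of points, N² minus the sum of squares being their number.

separated-pairs : {Ls : List (List A)} → All NonEmpty Ls →
  length (concat Ls) * length Ls + sumSquares Ls
    ≤ length (concat Ls) * length (concat Ls) + length (concat Ls)
separated-pairs []                     = z≤n
separated-pairs {Ls = L ∷ Ls} (l ∷ ls) rewrite length-++ L {concat Ls} =
  step (length (concat Ls)) (length Ls) (sumSquares Ls) (length L)
       (separated-pairs ls) (length≤length-concat ls) l
  where
  open ≤-Reasoning
  step : ∀ N M σ s → N * M + σ ≤ N * N + N → M ≤ N → 1 ≤ s →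
         (s + N) * suc M + (s * s + σ) ≤ (s + N) * (s + N) + (s + N)
  step N M σ s ih M≤N (s≤s {n = r} _) = begin
    (suc r + N) * suc M + (suc r * suc r + σ)
      ≡⟨ e₁ N M σ r ⟩
    (N * M + σ) + (suc r * M + (N + suc r + suc r * suc r))
      ≤⟨ +-mono-≤ ih (+-monoˡ-≤ _ (*-monoʳ-≤ (suc r) M≤N)) ⟩
    (N * N + N) + (suc r * N + (N + suc r + suc r * suc r))
      -- Of the 2·s·N ordered pairs between `L` and the rest, s·N have paid for the summand s·M and
      -- N for the additional class; r·N remain.
      ≤⟨ m≤m+n _ (r * N) ⟩
    (N * N + N) + (suc r * N + (N + suc r + suc r * suc r)) + r * N
      ≡⟨ e₂ N r ⟩
    (suc r + N) * (suc r + N) + (suc r + N) ∎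
    where
    e₁ : ∀ N M σ r → (suc r + N) * suc M + (suc r * suc r + σ) ≡
                     (N * M + σ) + (suc r * M + (N + suc r + suc r * suc r))
    e₁ = solve-∀
    e₂ : ∀ N r → (N * N + N) + (suc r * N + (N + suc r + suc r * suc r)) + r * N ≡
                 (suc r + N) * (suc r + N) + (suc r + N)
    e₂ = solve-∀

-- AVL trees seen through their sorted lists of entries

module AVLFacts (O : StrictTotalOrder a ℓ₁ ℓ₂) {v} {W : Set v} where
  open StrictTotalOrder O using (compare) renaming (Carrier to Key; _<_ to _<ᵏ_; _≈_ to _≈ᵏ_)
  open IndexedAVL O hiding (foldr; map; lookup; size)
  open import Relation.Binary.Construct.Add.Extrema.Strict _<ᵏ_ using ([<]-injective)

  private
    V = const W

  -- Insertion as an edit of the list of entries at one place. The place itself is not recorded,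
  -- since every tree is sorted by its own bounds. `_▸_` is abstract because entries are dependent
  -- records inside the indexed tree and plain pairs outside it.
  data Inserted {E : Set w} (_▸_ : Key → W → E) (k : Key) (f : Maybe W → W) :
                List E → List E → Set (a ⊔ˡ ℓ₁ ⊔ˡ v ⊔ˡ w) where
    created : ∀ kvs kvs′ → Inserted _▸_ k f (kvs ++ kvs′) (kvs ++ (k ▸ f nothing) ∷ kvs′)
    updated : ∀ kvs {k′ w} kvs′ → k ≈ᵏ k′ →
              Inserted _▸_ k f (kvs ++ (k′ ▸ w) ∷ kvs′) (kvs ++ (k′ ▸ f (just w)) ∷ kvs′)

  private
    entry : Key → W → K& V
    entry k w = k , w

    Inserted-++ : ∀ {k f L M} P → Inserted entry k f L M → Inserted entry k f (P ++ L) (P ++ M)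
    Inserted-++ {k} {f} P (created kvs kvs′) =
      subst₂ (Inserted entry k f) (++-assoc P kvs _) (++-assoc P kvs _) (created (P ++ kvs) kvs′)
    Inserted-++ {k} {f} P (updated kvs kvs′ k≈k′) =
      subst₂ (Inserted entry k f) (++-assoc P kvs _) (++-assoc P kvs _) (updated (P ++ kvs) kvs′ k≈k′)

    toDiffList-++ : ∀ {l u h} (t : Tree V l u h) L → toDiffList t L ≡ toList t ++ L
    toDiffList-++ (leaf _)       L = refl
    toDiffList-++ (node k l r _) L = begin
      toDiffList l (k ∷ toDiffList r L)     ≡⟨ toDiffList-++ l _ ⟩
      toList l ++ k ∷ toDiffList r L        ≡⟨ cong (λ M → toList l ++ k ∷ M) (toDiffList-++ r L) ⟩
      toList l ++ k ∷ toList r ++ L         ≡⟨ ++-assoc (toList l) (k ∷ toList r) L ⟨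
      (toList l ++ k ∷ toList r) ++ L       ≡⟨ cong (_++ L) (toDiffList-++ l _) ⟨
      toDiffList l (k ∷ toList r) ++ L      ∎
      where open ≡-Reasoning

    -- Rotations preserve the in-order traversal. With the tail `L` threaded through as a difference
    -- list nothing has to be reassociated, and every case of the rebalancing holds by computation.
    joinˡ⁺-toDiffList : ∀ {l u hˡ hʳ h} (k : K& V) (t₁ : ∃ λ i → Tree V l [ k .key ] (i ⊕ hˡ))
      (t₂ : Tree V [ k .key ] u hʳ) (bal : hˡ ∼ hʳ ⊔ h) L →
      toDiffList (proj₂ (joinˡ⁺ k t₁ t₂ bal)) L ≡ toDiffList (proj₂ t₁) (k ∷ toDiffList t₂ L)
    joinˡ⁺-toDiffList k (0# , t₁)                         t₂ bal L = refl
    joinˡ⁺-toDiffList k (1# , t₁)                         t₂ ∼0  L = refl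
    joinˡ⁺-toDiffList k (1# , t₁)                         t₂ ∼+  L = refl
    joinˡ⁺-toDiffList k (1# , node _ _ _ ∼-)              t₂ ∼-  L = refl
    joinˡ⁺-toDiffList k (1# , node _ _ _ ∼0)              t₂ ∼-  L = refl
    joinˡ⁺-toDiffList k (1# , node _ _ (node _ _ _ _) ∼+) t₂ ∼-  L = refl

    joinʳ⁺-toDiffList : ∀ {l u hˡ hʳ h} (k : K& V) (t₁ : Tree V l [ k .key ] hˡ)
      (t₂ : ∃ λ i → Tree V [ k .key ] u (i ⊕ hʳ)) (bal : hˡ ∼ hʳ ⊔ h) L →
      toDiffList (proj₂ (joinʳ⁺ k t₁ t₂ bal)) L ≡ toDiffList t₁ (k ∷ toDiffList (proj₂ t₂) L)
    joinʳ⁺-toDiffList k t₁ (0# , t₂)                         bal L = refl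
    joinʳ⁺-toDiffList k t₁ (1# , t₂)                         ∼0  L = refl
    joinʳ⁺-toDiffList k t₁ (1# , t₂)                         ∼-  L = refl
    joinʳ⁺-toDiffList k t₁ (1# , node _ _ _ ∼+)              ∼+  L = refl
    joinʳ⁺-toDiffList k t₁ (1# , node _ _ _ ∼0)              ∼+  L = refl
    joinʳ⁺-toDiffList k t₁ (1# , node _ (node _ _ _ _) _ ∼-) ∼+  L = refl

    insertWith-toDiffList : ∀ {l u h} k f (t : Tree V l u h) (l<k<u : l < k < u) L →
      Inserted entry k f (toDiffList t L) (toDiffList (proj₂ (insertWith k f t l<k<u)) L)
    insertWith-toDiffList k f (leaf _) l<k<u L = created [] L
    insertWith-toDiffList k f (node (k′ , w) lp pu bal) (l<k , k<u) L with compare k k′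
    ... | tri< k<k′ _ _ =
      subst (Inserted entry k f _) (sym (joinˡ⁺-toDiffList (k′ , w) (insertWith k f lp _) pu bal L))
        (insertWith-toDiffList k f lp (l<k , [ k<k′ ]ᴿ) _)
    ... | tri≈ _ k≈k′ _ =
      subst₂ (Inserted entry k f) (sym (toDiffList-++ lp _)) (sym (toDiffList-++ lp _))
        (updated (toList lp) (toDiffList pu L) k≈k′)
    ... | tri> _ _ k′<k =
      subst₂ (Inserted entry k f) (sym (toDiffList-++ lp _))
        (sym (≡.trans (joinʳ⁺-toDiffList (k′ , w) lp (insertWith k f pu _) bal L) (toDiffList-++ lp _)))
        (Inserted-++ (toList lp) (Inserted-++ ((k′ , w) ∷ [])
          (insertWith-toDiffList k f pu ([ k′<k ]ᴿ , k<u) L)))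
      where import Relation.Binary.PropositionalEquality as ≡

    toList-node : ∀ {l u hˡ hʳ h} k (lk : Tree V l [ k .key ] hˡ) (ku : Tree V [ k .key ] u hʳ)
      (bal : hˡ ∼ hʳ ⊔ h) → toList (node k lk ku bal) ≡ toList lk ++ k ∷ toList ku
    toList-node k lk ku bal = toDiffList-++ lk _

    toList-bounds : ∀ {l u h} (t : Tree V l u h) → All (λ kv → l < kv .key < u) (toList t)
    toList-bounds (leaf _) = []
    toList-bounds {l} {u} (node k lk ku bal) = subst (All _) (sym (toList-node k lk ku bal))
      (Allₚ.++⁺ (All.map (λ (l<j , j<k) → l<j , trans⁺ _ j<k (ordered ku)) (toList-bounds lk))
        ((ordered lk , ordered ku)
          ∷ All.map (λ (k<j , j<u) → trans⁺ l (ordered lk) k<j , j<u) (toList-bounds ku)))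

    toList-sorted : ∀ {l u h} (t : Tree V l u h) → AllPairs (_<ᵏ_ on key) (toList t)
    toList-sorted (leaf _) = []
    toList-sorted (node k lk ku bal) = subst (AllPairs _) (sym (toList-node k lk ku bal))
      (AllPairsₚ.++⁺ (toList-sorted lk)
        (All.map (λ (k<j , _) → [<]-injective k<j) (toList-bounds ku) ∷ toList-sorted ku)
        (All.map (λ (_ , j<k) → [<]-injective j<k
             ∷ All.map (λ (k<j , _) → [<]-injective (trans⁺ _ j<k k<j)) (toList-bounds ku))
          (toList-bounds lk)))

    height≤length-toList : ∀ {l u h} (t : Tree V l u h) → h ≤ length (toList t)
    height≤length-toList (leaf _) = z≤n
    height≤length-toList (node {hˡ} {hʳ} k lk ku bal)
      rewrite toList-node k lk ku bal | length-++ (toList lk) {k ∷ toList ku}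
            | +-suc (length (toList lk)) (length (toList ku)) =
      s≤s (≤-trans (max≤sum bal) (+-mono-≤ (height≤length-toList lk) (height≤length-toList ku)))
      where
      max≤sum : ∀ {i j h} → i ∼ j ⊔ h → h ≤ i + j
      max≤sum {i}      ∼+ = m≤n+m _ i
      max≤sum          ∼0 = m≤m+n _ _
      max≤sum          ∼- = m≤m+n _ _

  open AVLMap O using (Map) renaming (toList to entries; insertWith to insertMap)

  insertMap-entries : ∀ k f (t : Map W) → Inserted _,_ k f (entries t) (entries (insertMap k f t))
  insertMap-entries k f (AVL.tree t) = convert (insertWith-toDiffList k f t ⊥⁺<[ k ]<⊤⁺ [])
    where
    convert : ∀ {L M} → Inserted entry k f L M → Inserted _,_ k f (map toPair L) (map toPair M)
    convert (created kvs kvs′) =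
      subst₂ (Inserted _,_ k f) (sym (map-++ toPair kvs _)) (sym (map-++ toPair kvs _))
        (created (map toPair kvs) (map toPair kvs′))
    convert (updated kvs kvs′ k≈k′) =
      subst₂ (Inserted _,_ k f) (sym (map-++ toPair kvs _)) (sym (map-++ toPair kvs _))
        (updated (map toPair kvs) (map toPair kvs′) k≈k′)

  entries-sorted : (t : Map W) → AllPairs (_<ᵏ_ on proj₁) (entries t)
  entries-sorted (AVL.tree t) = AllPairsₚ.map⁺ (toList-sorted t)

  height≤length-entries : ∀ {h} (t : Tree V ⊥⁺ ⊤⁺ h) → h ≤ length (entries (AVL.tree t))
  height≤length-entries t =
    subst (_ ≤_) (sym (length-map toPair (toList t))) (height≤length-toList t)

-- Sides, distances and the geometry of a compatible order around the pivot

_≟ˢ_ : (s t : Side) → Dec (s ≡ t)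
left  ≟ˢ left  = yes refl
left  ≟ˢ right = no λ ()
right ≟ˢ left  = no λ ()
right ≟ˢ right = yes refl

module Distances (V : DistanceScale a ℓ₁ ℓ₂) where
  open DistanceScale V public
    using (Carrier; 0#; 0#-minimum; poset; totalOrder; decTotalOrder; <-strictTotalOrder; _≤?_; _<?_; _≈?_)
    renaming ( _≤_ to _≤ᵈ_; _<_ to _<ᵈ_; _≈_ to _≈ᵈ_; refl to ≤ᵈ-refl; reflexive to ≤ᵈ-reflexive
             ; trans to ≤ᵈ-trans; antisym to ≤ᵈ-antisym; module Eq to ≈ᵈ)
  open DecTotalOrderProperties decTotalOrder public using ()
    renaming (≰⇒> to ≰⇒>ᵈ; ≮⇒≥ to ≮⇒≥ᵈ; <-respˡ-≈ to <ᵈ-respˡ-≈ᵈ; <-respʳ-≈ to <ᵈ-respʳ-≈ᵈ)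

module Geometry {V : DistanceScale a ℓ₁ ℓ₂} {n : ℕ} (X : Dissimilarity V n)
                {_≺_ : Rel (Fin n) 0ℓ} (≺-compatible : CompatibleOrder X _≺_) where
  open Distances V
  open Dissimilarity X
  open CompatibleOrder ≺-compatible
  open IsStrictTotalOrder isStrictTotalOrder using () renaming (compare to ≺-compare; trans to ≺-trans; irrefl to ≺-irrefl)
  open NaturalMax totalOrder using (x⊔y≤z⇒x≤z; x⊔y≤z⇒y≤z)
  open import Relation.Binary.Reasoning.PartialOrder poset

  private
    Point = Fin n

  -- Compatibility of a single triple, stated by distances alone, so that it can be asserted of
  -- triples that ≺ itself orders differently.
  Mid : Point → Point → Point → Set ℓ₂
  Mid x y z = d x y ≤ᵈ d x z × d y z ≤ᵈ d x z

  Mid-sym : ∀ {x y z} → Mid x y z → Mid z y x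
  Mid-sym {x} {y} {z} (xy≤xz , yz≤xz) =
    (begin d z y ≈⟨ d-sym z y ⟩ d y z ≤⟨ yz≤xz ⟩ d x z ≈⟨ d-sym x z ⟩ d z x ∎) ,
    (begin d y x ≈⟨ d-sym y x ⟩ d x y ≤⟨ xy≤xz ⟩ d x z ≈⟨ d-sym x z ⟩ d z x ∎)

  ≺⇒Mid : ∀ {x y z} → x ≺ y → y ≺ z → Mid x y z
  ≺⇒Mid x≺y y≺z = x⊔y≤z⇒x≤z _ _ (compatible x≺y y≺z)
                , x⊔y≤z⇒y≤z _ _ (compatible x≺y y≺z)

  d-diagonal-≤ : ∀ {x y z} → x ≡ y → d x y ≤ᵈ z
  d-diagonal-≤ {x} {z = z} refl = begin d x x ≈⟨ d-diagonal x ⟩ 0# ≤⟨ 0#-minimum z ⟩ z ∎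

  private
    sideFrom : ∀ {ℓ₁ ℓ₂ ℓ₃} {A : Set ℓ₁} {B : Set ℓ₂} {C : Set ℓ₃} → Tri A B C → Side
    sideFrom (tri< _ _ _) = left
    -- A default for the point `p` itself, which lies on neither side.
    sideFrom (tri≈ _ _ _) = right
    sideFrom (tri> _ _ _) = right

  sideOf : Point → Point → Side
  sideOf p x = sideFrom (≺-compare x p)

  data Sided (p x : Point) : Side → Set where
    onLeft  : x ≺ p → Sided p x left
    onRight : p ≺ x → Sided p x right

  sided : ∀ {p x} → x ≢ p → Sided p x (sideOf p x)
  sided {p} {x} x≢p with ≺-compare x p
  ... | tri< x≺p _ _ = onLeft x≺p
  ... | tri≈ _ x≡p _ = contradiction x≡p x≢p
  ... | tri> _ _ p≺x = onRight p≺x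

  -- v does not lie beyond u as seen from p.

  Far : Point → Point → Point → Set
  Far p u v = ¬ (p ≺ u × u ≺ v) × ¬ (v ≺ u × u ≺ p)

  Far-pivot : ∀ {p u} → Far p u p
  Far-pivot = (λ (p≺u , u≺p) → ≺-irrefl refl (≺-trans p≺u u≺p))
            , (λ (p≺u , u≺p) → ≺-irrefl refl (≺-trans p≺u u≺p))

  module _ {p : Point} where

    private
      module Beyond {_⊏_ : Rel Point 0ℓ} (⊏-connex : ∀ x y → x ⊏ y ⊎ x ≡ y ⊎ y ⊏ x)
                    (⊏-trans : ∀ {x y z} → x ⊏ y → y ⊏ z → x ⊏ z)
                    (⊏⇒Mid : ∀ {x y z} → x ⊏ y → y ⊏ z → Mid x y z) where

        -- Both exclusions concern one side of p and are instantiated at ≺ and at its converse. Here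
        -- q is at or before y, and x would come after y, so compatibility would put y no farther
        -- from q than x.
        ¬beyond-in : ∀ {q x y} → ¬ (p ⊏ y × y ⊏ q) → d q x <ᵈ d q y → ¬ (p ⊏ y × y ⊏ x)
        ¬beyond-in {q} {x} {y} yq (x≤y , x≉y) (p⊏y , y⊏x) with ⊏-connex q y
        ... | inj₁ q⊏y         = x≉y (≤ᵈ-antisym x≤y (proj₁ (⊏⇒Mid q⊏y y⊏x)))
        ... | inj₂ (inj₁ q≡y)  = x≉y (≤ᵈ-antisym x≤y (d-diagonal-≤ q≡y))
        ... | inj₂ (inj₂ y⊏q)  = yq (p⊏y , y⊏q)

        -- The reason for reversing the near classes. Seen from q, the points between p and q are
        -- within d p q and get closer the farther they are from p; the points on the other side of
        -- p are at least d p q away and recede outwards. In both groups the reordered classes thus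
        -- run from the inside to the outside.
        ¬beyond-out : ∀ {q x y} → ¬ (p ⊏ q × q ⊏ x) →
                      (d q y <ᵈ d q x × d q x ≤ᵈ d p q) ⊎ (d q x <ᵈ d q y × d p q <ᵈ d q y) →
                      ¬ (p ⊏ y × y ⊏ x)
        ¬beyond-out {q} {x} {y} qx near⊎far (p⊏y , y⊏x) with ⊏-connex q p | ⊏-connex q x | near⊎far
        ... | inj₁ q⊏p | _ | inj₁ ((y≤x , y≉x) , x≤δ) = y≉x (≤ᵈ-antisym y≤x (begin
          d q x ≤⟨ x≤δ ⟩ d p q ≈⟨ d-sym p q ⟩ d q p ≤⟨ proj₁ (⊏⇒Mid q⊏p p⊏y) ⟩ d q y ∎))
        ... | inj₁ q⊏p | _ | inj₂ ((x≤y , x≉y) , _) =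
          x≉y (≤ᵈ-antisym x≤y (proj₁ (⊏⇒Mid (⊏-trans q⊏p p⊏y) y⊏x)))
        ... | inj₂ (inj₁ refl) | _ | inj₁ ((y≤x , y≉x) , x≤δ) =
          y≉x (≤ᵈ-antisym y≤x (≤ᵈ-trans x≤δ (d-diagonal-≤ refl)))
        ... | inj₂ (inj₁ refl) | _ | inj₂ ((x≤y , x≉y) , _) =
          x≉y (≤ᵈ-antisym x≤y (proj₁ (⊏⇒Mid p⊏y y⊏x)))
        ... | inj₂ (inj₂ p⊏q) | inj₁ q⊏x | _ = qx (p⊏q , q⊏x)
        ... | inj₂ (inj₂ p⊏q) | inj₂ (inj₁ refl) | inj₁ ((y≤x , y≉x) , _) =
          y≉x (≤ᵈ-antisym y≤x (d-diagonal-≤ refl))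
        ... | inj₂ (inj₂ p⊏q) | inj₂ (inj₂ x⊏q) | inj₁ ((y≤x , y≉x) , _) =
          y≉x (≤ᵈ-antisym y≤x (proj₁ (Mid-sym (⊏⇒Mid y⊏x x⊏q))))
        ... | inj₂ (inj₂ p⊏q) | inj₂ x≡q⊎x⊏q | inj₂ (_ , (δ≤y , δ≉y)) = δ≉y (≤ᵈ-antisym δ≤y (begin
          d q y ≤⟨ proj₁ (Mid-sym (⊏⇒Mid p⊏y y⊏q)) ⟩ d q p ≈⟨ d-sym q p ⟩ d p q ∎))
          where
          y⊏q : y ⊏ q
          y⊏q = [ (λ where refl → y⊏x) , ⊏-trans y⊏x ]′ x≡q⊎x⊏q

      ≺-connex : ∀ x y → x ≺ y ⊎ x ≡ y ⊎ y ≺ x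
      ≺-connex x y with ≺-compare x y
      ... | tri< x≺y _ _ = inj₁ x≺y
      ... | tri≈ _ x≡y _ = inj₂ (inj₁ x≡y)
      ... | tri> _ _ y≺x = inj₂ (inj₂ y≺x)

      module Right = Beyond ≺-connex ≺-trans ≺⇒Mid
      module Left = Beyond {λ x y → y ≺ x} (λ x y → [ inj₂ ∘ inj₂ , [ inj₂ ∘ inj₁ , inj₁ ]′ ]′ (≺-connex x y))
        (λ x y → ≺-trans y x) (λ x y → Mid-sym (≺⇒Mid y x))

    -- The two ways in which an earlier class, of x, and a later one, of y,
    -- arise from a point q.

    Far-in : ∀ {q x y} → Far p y q → d q x <ᵈ d q y → Far p y x
    Far-in (¬p≺y≺q , ¬q≺y≺p) x<y =
      Right.¬beyond-in ¬p≺y≺q x<y ,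
      λ (x≺y , y≺p) → Left.¬beyond-in (λ (y≺p , q≺y) → ¬q≺y≺p (q≺y , y≺p)) x<y (y≺p , x≺y)

    Far-out : ∀ {q x y} → Far p q x →
              (d q y <ᵈ d q x × d q x ≤ᵈ d p q) ⊎ (d q x <ᵈ d q y × d p q <ᵈ d q y) → Far p y x
    Far-out (¬p≺q≺x , ¬x≺q≺p) near⊎far =
      Right.¬beyond-out ¬p≺q≺x near⊎far ,
      λ (x≺y , y≺p) → Left.¬beyond-out (λ (q≺p , x≺q) → ¬x≺q≺p (x≺q , q≺p)) near⊎far (y≺p , x≺y)

    insideˡ : ∀ {u v} → Far p u v → u ≢ v → u ≺ p → u ≺ v
    insideˡ {u} {v} (_ , ¬v≺u≺p) u≢v u≺p with ≺-compare u v
    ... | tri< u≺v _ _ = u≺v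
    ... | tri≈ _ u≡v _ = contradiction u≡v u≢v
    ... | tri> _ _ v≺u = contradiction (v≺u , u≺p) ¬v≺u≺p

    insideʳ : ∀ {u v} → Far p u v → u ≢ v → p ≺ u → v ≺ u
    insideʳ {u} {v} (¬p≺u≺v , _) u≢v p≺u with ≺-compare u v
    ... | tri< u≺v _ _ = contradiction (p≺u , u≺v) ¬p≺u≺v
    ... | tri≈ _ u≡v _ = contradiction u≡v u≢v
    ... | tri> _ _ v≺u = v≺u

    Opposite : Point → Point → Set
    Opposite u v = sideOf p u ≢ sideOf p v

    opposite⇒Far : ∀ {u v} → u ≢ p → v ≢ p → Opposite u v → Far p u v
    opposite⇒Far {u} {v} u≢p v≢p opp with sideOf p u | sided u≢p | sideOf p v | sided v≢p
    ... | _ | onLeft _   | _ | onLeft _    = contradiction refl opp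
    ... | _ | onRight _  | _ | onRight _   = contradiction refl opp
    ... | _ | onLeft u≺p | _ | onRight p≺v =
      (λ (p≺u , _) → ≺-irrefl refl (≺-trans p≺u u≺p)) ,
      (λ (v≺u , _) → ≺-irrefl refl (≺-trans (≺-trans v≺u u≺p) p≺v))
    ... | _ | onRight p≺u | _ | onLeft v≺p =
      (λ (_ , u≺v) → ≺-irrefl refl (≺-trans (≺-trans u≺v v≺p) p≺u)) ,
      (λ (_ , u≺p) → ≺-irrefl refl (≺-trans p≺u u≺p))

    same-side-stable : ∀ {u v} → ¬ Opposite u v → sideOf p u ≡ sideOf p v
    same-side-stable {u} {v} ¬opp with sideOf p u | sideOf p v
    ... | left  | left  = refl
    ... | right | right = refl
    ... | left  | right = contradiction (λ ()) ¬opp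
    ... | right | left  = contradiction (λ ()) ¬opp

    opposite-opposite : ∀ {u v w} → Opposite u v → Opposite w v → sideOf p u ≡ sideOf p w
    opposite-opposite {u} {v} {w} uv wv = same-side-stable λ uw → three-sides uv wv uw
      where
      three-sides : ∀ {r s t : Side} → r ≢ s → t ≢ s → r ≢ t → ⊥
      three-sides {left}  {left}          rs ts rt = rs refl
      three-sides {left}  {right} {left}  rs ts rt = rt refl
      three-sides {left}  {right} {right} rs ts rt = ts refl
      three-sides {right} {right}         rs ts rt = rs refl
      three-sides {right} {left}  {left}  rs ts rt = ts refl
      three-sides {right} {left}  {right} rs ts rt = rt refl

    private
      Far-connex-≺ : ∀ {u v} → u ≢ p → u ≺ v → Far p u v ⊎ Far p v u
      Far-connex-≺ {u} {v} u≢p u≺v with sideOf p u | sided u≢p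
      ... | _ | onLeft u≺p  = inj₁ ( (λ (p≺u , _) → ≺-irrefl refl (≺-trans p≺u u≺p))
                                   , (λ (v≺u , _) → ≺-irrefl refl (≺-trans v≺u u≺v)))
      ... | _ | onRight p≺u = inj₂ ( (λ (_ , v≺u) → ≺-irrefl refl (≺-trans v≺u u≺v))
                                   , (λ (_ , v≺p) → ≺-irrefl refl (≺-trans p≺u (≺-trans u≺v v≺p))))

    Far-connex : ∀ {u v} → u ≢ p → v ≢ p → u ≢ v → Far p u v ⊎ Far p v u
    Far-connex {u} {v} u≢p v≢p u≢v with ≺-compare u v
    ... | tri< u≺v _ _ = Far-connex-≺ u≢p u≺v
    ... | tri≈ _ u≡v _ = contradiction u≡v u≢v
    ... | tri> _ _ v≺u = [ inj₂ , inj₁ ]′ (Far-connex-≺ v≢p v≺u)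

    -- A nest u, v, w from the outside in has only two arrangements in ≺: u and v on one side, or u
    -- and v around w. The sides of u and v decide which, so the same alternative can later be read
    -- off from the sides that the algorithm assigns.
    nest-same : ∀ {u v w} → u ≢ p → v ≢ p → u ≢ v → v ≢ w →
                Far p u v → Far p v w → sideOf p u ≡ sideOf p v → Mid u v w
    nest-same {u} {v} u≢p v≢p u≢v v≢w uv vw same with sideOf p u | sided u≢p | sideOf p v | sided v≢p
    ... | _ | onLeft u≺p  | _ | onLeft v≺p  = ≺⇒Mid (insideˡ uv u≢v u≺p) (insideˡ vw v≢w v≺p)
    ... | _ | onRight p≺u | _ | onRight p≺v = Mid-sym (≺⇒Mid (insideʳ vw v≢w p≺v) (insideʳ uv u≢v p≺u))
    ... | _ | onLeft _    | _ | onRight _   = contradiction same λ ()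
    ... | _ | onRight _   | _ | onLeft _    = contradiction same λ ()

    nest-opposite : ∀ {u v w} → u ≢ p → v ≢ p → u ≢ w → v ≢ w →
                    Far p u w → Far p v w → Opposite u v → Mid u w v
    nest-opposite {u} {v} u≢p v≢p u≢w v≢w uw vw opp with sideOf p u | sided u≢p | sideOf p v | sided v≢p
    ... | _ | onLeft u≺p  | _ | onRight p≺v = ≺⇒Mid (insideˡ uw u≢w u≺p) (insideʳ vw v≢w p≺v)
    ... | _ | onRight p≺u | _ | onLeft v≺p  = Mid-sym (≺⇒Mid (insideˡ vw v≢w v≺p) (insideʳ uw u≢w p≺u))
    ... | _ | onLeft _    | _ | onLeft _    = contradiction refl opp
    ... | _ | onRight _   | _ | onRight _   = contradiction refl opp

    toward-pivot : ∀ {u v} → u ≢ p → v ≢ p → u ≢ v → Far p u v → sideOf p u ≡ sideOf p v → d u v ≤ᵈ d p u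
    toward-pivot {u} {v} u≢p v≢p u≢v uv same = begin
      d u v ≤⟨ proj₁ (nest-same u≢p v≢p u≢v v≢p uv Far-pivot same) ⟩ d u p ≈⟨ d-sym u p ⟩ d p u ∎

    opposite-side-bound : ∀ {u v} → u ≢ p → v ≢ p → Opposite u v → d p u ≤ᵈ d u v
    opposite-side-bound {u} {v} u≢p v≢p opp = begin
      d p u ≈⟨ d-sym p u ⟩ d u p ≤⟨ proj₁ (nest-opposite u≢p v≢p u≢p v≢p Far-pivot Far-pivot opp) ⟩ d u v ∎

    -- Whichever of the two is farther out has the other between itself and p.
    same-side-bound : ∀ {u v} → u ≢ p → v ≢ p → sideOf p u ≡ sideOf p v → d p u ≈ᵈ d p v → d u v ≤ᵈ d p u
    same-side-bound {u} {v} u≢p v≢p same pu≈pv with u ≟ v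
    ... | yes u≡v = d-diagonal-≤ u≡v
    ... | no  u≢v with Far-connex u≢p v≢p u≢v
    ...   | inj₁ uv = toward-pivot u≢p v≢p u≢v uv same
    ...   | inj₂ vu = begin
      d u v ≈⟨ d-sym u v ⟩ d v u ≤⟨ toward-pivot v≢p u≢p (u≢v ∘ sym) vu (sym same) ⟩ d p v ≈⟨ pu≈pv ⟨ d p u ∎

    -- Seen from z, one of x and y lies between z and the other, and the common distance from z
    -- bounds the rest.
    farther-bound : ∀ {x y z} → z ≢ p → z ≢ x → z ≢ y → Far p z x → Far p z y →
                    d z x ≈ᵈ d z y → d x y ≤ᵈ d z x
    farther-bound {x} {y} {z} z≢p z≢x z≢y zx zy zx≈zy with sideOf p z | sided z≢p | ≺-compare x y
    ... | _ | _ | tri≈ _ x≡y _ = d-diagonal-≤ x≡y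
    ... | _ | onLeft z≺p | tri< x≺y _ _ =
      begin d x y ≤⟨ proj₂ (≺⇒Mid (insideˡ zx z≢x z≺p) x≺y) ⟩ d z y ≈⟨ zx≈zy ⟨ d z x ∎
    ... | _ | onLeft z≺p | tri> _ _ y≺x =
      begin d x y ≈⟨ d-sym x y ⟩ d y x ≤⟨ proj₂ (≺⇒Mid (insideˡ zy z≢y z≺p) y≺x) ⟩ d z x ∎
    ... | _ | onRight p≺z | tri< x≺y _ _ =
      begin d x y ≤⟨ proj₁ (≺⇒Mid x≺y (insideʳ zy z≢y p≺z)) ⟩ d x z ≈⟨ d-sym x z ⟩ d z x ∎
    ... | _ | onRight p≺z | tri> _ _ y≺x =
      begin d x y ≈⟨ d-sym x y ⟩ d y x ≤⟨ proj₁ (≺⇒Mid y≺x (insideʳ zx z≢x p≺z)) ⟩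
            d y z ≈⟨ d-sym y z ⟩ d z y ≈⟨ zx≈zy ⟨ d z x ∎

    private
      straddling-bound : ∀ {x y z} → x ≢ p → y ≢ p → Opposite x y →
                         d x z ≈ᵈ d y z → d p x ≈ᵈ d p y → d p x ≤ᵈ d x z
      straddling-bound {x} {y} {z} x≢p y≢p opp xz≈yz px≈py with z ≟ p | sideOf p x ≟ˢ sideOf p z
      ... | yes refl | _        = ≤ᵈ-reflexive (d-sym p x)
      ... | no z≢p   | no x≁z   = opposite-side-bound x≢p z≢p x≁z
      ... | no z≢p   | yes x~z  = begin
        d p x ≈⟨ px≈py ⟩ d p y ≤⟨ opposite-side-bound y≢p z≢p (λ y~z → opp (trans x~z (sym y~z))) ⟩
        d y z ≈⟨ xz≈yz ⟨ d x z ∎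

    -- If x and y share a side, one of them lies between the other and z. If not, z is opposite to
    -- one of them (or is p), hence at least d p x away from it and so from both.
    nearer-bound : ∀ {x y z} → x ≢ p → y ≢ p → x ≢ z → y ≢ z → Far p x z → Far p y z →
                   d x z ≈ᵈ d y z → d p x ≈ᵈ d p y → d x y ≤ᵈ d p x → d x y ≤ᵈ d x z
    nearer-bound {x} {y} {z} x≢p y≢p x≢z y≢z xz yz xz≈yz px≈py xy≤px with x ≟ y | sideOf p x ≟ˢ sideOf p y
    ... | yes x≡y | _      = d-diagonal-≤ x≡y
    ... | no x≢y  | no opp = ≤ᵈ-trans xy≤px (straddling-bound x≢p y≢p opp xz≈yz px≈py)
    ... | no x≢y  | yes same with Far-connex x≢p y≢p x≢y
    ...   | inj₁ xy = proj₁ (nest-same x≢p y≢p x≢y y≢z xy yz same)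
    ...   | inj₂ yx = begin
      d x y ≈⟨ d-sym x y ⟩ d y x ≤⟨ proj₁ (nest-same y≢p x≢p (x≢y ∘ sym) x≢z yx xz (sym same)) ⟩
      d y z ≈⟨ xz≈yz ⟨ d x z ∎

    -- z shares its side with u or with v (or is p) and lies between that point and p; equal
    -- distances carry the bound over to the other point.
    between-opposite-bound : ∀ {u v z} → u ≢ p → v ≢ p → u ≢ z → v ≢ z → Opposite u v → Far p u z → Far p v z →
                             d u z ≈ᵈ d v z → d p u ≈ᵈ d p v → d u z ≤ᵈ d p u
    between-opposite-bound {u} {v} {z} u≢p v≢p u≢z v≢z opp uz vz uz≈vz pu≈pv with z ≟ p | sideOf p u ≟ˢ sideOf p z
    ... | yes refl | _       = ≤ᵈ-reflexive (d-sym u p)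
    ... | no z≢p   | yes u~z = toward-pivot u≢p z≢p u≢z uz u~z
    ... | no z≢p   | no u≁z  = begin
      d u z ≈⟨ uz≈vz ⟩ d v z ≤⟨ toward-pivot v≢p z≢p v≢z vz (opposite-opposite (opp ∘ sym) (u≁z ∘ sym)) ⟩
      d p v ≈⟨ pu≈pv ⟨ d p u ∎

    -- q, beyond both u and v, sees p on its way to one of them, and on this
    -- side of p the other.

    opposite⇒equidistant : ∀ {q u v} → q ≢ p → u ≢ p → v ≢ p → q ≢ u → q ≢ v → Opposite u v →
                           Far p q u → Far p q v → d q u ≈ᵈ d q v → d q u ≈ᵈ d p q
    opposite⇒equidistant {q} {u} {v} q≢p u≢p v≢p q≢u q≢v opp qu qv qu≈qv with sideOf p q ≟ˢ sideOf p u
    ... | yes q~u = ≤ᵈ-antisym (toward-pivot q≢p u≢p q≢u qu q~u) (begin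
      d p q ≤⟨ opposite-side-bound q≢p v≢p (λ q~v → opp (trans (sym q~u) q~v)) ⟩ d q v ≈⟨ qu≈qv ⟨ d q u ∎)
    ... | no  q≁u = ≤ᵈ-antisym (begin
      d q u ≈⟨ qu≈qv ⟩ d q v ≤⟨ toward-pivot q≢p v≢p q≢v qv (opposite-opposite q≁u (opp ∘ sym)) ⟩ d p q ∎)
      (opposite-side-bound q≢p u≢p q≁u)

-- Lists: permutations and pairwise relations

concat-↭ : {Ls Ms : List (List A)} → Ls ↭ Ms → concat Ls ↭ concat Ms
concat-↭ _↭_.refl                  = ↭-refl
concat-↭ (prep L Ls↭Ms)            = Perm.++⁺ˡ L (concat-↭ Ls↭Ms)
concat-↭ (_↭_.swap L L′ Ls↭Ms)     = ↭-trans (Perm.shifts L L′) (Perm.++⁺ˡ L′ (Perm.++⁺ˡ L (concat-↭ Ls↭Ms)))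
concat-↭ (_↭_.trans Ls↭Ns Ns↭Ms)   = ↭-trans (concat-↭ Ls↭Ns) (concat-↭ Ns↭Ms)

concat-map-++ : (f : A → List B) (xs ys : List A) →
                concat (map f (xs ++ ys)) ≡ concat (map f xs) ++ concat (map f ys)
concat-map-++ f xs ys = trans (cong concat (map-++ f xs ys)) (sym (concat-++ (map f xs) (map f ys)))

AllPairs-reverse : ∀ {R : Rel A ℓ} {xs} → AllPairs R xs → AllPairs (λ x y → R y x) (reverse xs)
AllPairs-reverse []                     = []
AllPairs-reverse {R = R} {x ∷ xs} (Rx ∷ Rxs) rewrite unfold-reverse x xs =
  AllPairsₚ.++⁺ (AllPairs-reverse Rxs) ([] ∷ [])
    (All.map (_∷ []) (Perm.All-resp-↭ (↭-sym (Perm.↭-reverse xs)) Rx))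

AllPairs-lookup-++ : ∀ {R : Rel A ℓ} xs {ys x y} → AllPairs R (xs ++ ys) → x ∈ xs → y ∈ ys → R x y
AllPairs-lookup-++ (x ∷ xs) (Rx ∷ _)  (here refl) y∈ys = All.lookup Rx (∈-++⁺ʳ xs y∈ys)
AllPairs-lookup-++ (x ∷ xs) (_ ∷ Rxs) (there x∈)  y∈ys = AllPairs-lookup-++ xs Rxs x∈ y∈ys

AllPairs-++⁻ : ∀ {R : Rel A ℓ} xs {ys} → AllPairs R (xs ++ ys) → AllPairs R xs × AllPairs R ys
AllPairs-++⁻ []       Rys        = [] , Rys
AllPairs-++⁻ (x ∷ xs) (Rx ∷ Rxs) = Allₚ.++⁻ˡ xs Rx ∷ proj₁ (AllPairs-++⁻ xs Rxs) , proj₂ (AllPairs-++⁻ xs Rxs)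

AllPairs-with-All : ∀ {p} {P : A → Set p} {R : Rel A ℓ} {xs} → All P xs → AllPairs R xs →
                    AllPairs (λ x y → R x y × P x × P y) xs
AllPairs-with-All []         []         = []
AllPairs-with-All (Px ∷ Pxs) (Rx ∷ Rxs) =
  All.zipWith (λ (Rxy , Py) → Rxy , Px , Py) (Rx , Pxs) ∷ AllPairs-with-All Pxs Rxs

-- The classes of equal distance to one point

module Refinement {V : DistanceScale a ℓ₁ ℓ₂} {n : ℕ} (X : Dissimilarity V n) (choices : Choices n)
                  {_≺_ : Rel (Fin n) 0ℓ} (≺-compatible : CompatibleOrder X _≺_) where
  open Distances V
  open Dissimilarity X
  open Algorithm X choices
  open Geometry X ≺-compatible
  module AVL⁺ = AVLFacts <-strictTotalOrder {W = List (Fin n)}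
  open AVLMap <-strictTotalOrder using (Map; empty; insertWith; toList)

  private
    Keyed : Set _
    Keyed = Carrier × Points

    members : List Keyed → Points
    members kvs = concat (map proj₂ kvs)

  KeyedBy : Point → Keyed → Set ℓ₁
  KeyedBy q (k , C) = NonEmpty C × All (λ x → d q x ≈ᵈ k) C

  push : Point → Maybe Points → Points
  push x old = x ∷ fromMaybe [] old

  push-classes : ∀ {q x kvs kvs′} → AVL⁺.Inserted _,_ (d q x) (push x) kvs kvs′ →
    All (KeyedBy q) kvs →
    All (KeyedBy q) kvs′ × members kvs′ ↭ x ∷ members kvs × length kvs ≤ length kvs′
  push-classes {q} {x} (AVL⁺.created ls ms) ok =
    Allₚ.++⁺ (Allₚ.++⁻ˡ ls ok) ((s≤s z≤n , ≈ᵈ.refl ∷ []) ∷ Allₚ.++⁻ʳ ls ok) ,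
    (begin
      members (ls ++ (d q x , x ∷ []) ∷ ms)   ≡⟨ concat-map-++ proj₂ ls _ ⟩
      members ls ++ x ∷ members ms            ↭⟨ Perm.shift x (members ls) (members ms) ⟩
      x ∷ members ls ++ members ms            ≡⟨ cong (x ∷_) (concat-map-++ proj₂ ls ms) ⟨
      x ∷ members (ls ++ ms)                  ∎) ,
    subst₂ _≤_ (sym (length-++ ls)) (sym (length-++ ls)) (+-monoʳ-≤ (length ls) (n≤1+n _))
    where open PermutationReasoning
  push-classes {q} {x} (AVL⁺.updated ls {k} {C} ms x≈k) ok with Allₚ.++⁻ʳ ls ok
  ... | (_ , C≈k) ∷ okms =
    Allₚ.++⁺ (Allₚ.++⁻ˡ ls ok) ((s≤s z≤n , x≈k ∷ C≈k) ∷ okms) ,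
    (begin
      members (ls ++ (k , x ∷ C) ∷ ms)        ≡⟨ concat-map-++ proj₂ ls _ ⟩
      members ls ++ x ∷ C ++ members ms       ↭⟨ Perm.shift x (members ls) _ ⟩
      x ∷ members ls ++ C ++ members ms       ≡⟨ cong (x ∷_) (concat-map-++ proj₂ ls _) ⟨
      x ∷ members (ls ++ (k , C) ∷ ms)        ∎) ,
    ≤-reflexive (trans (length-++ ls) (sym (length-++ ls)))
    where open PermutationReasoning

  -- The number of keys never decreases, so every insertion can be charged at the size of the final
  -- tree.
  insertAll-spec : ∀ q S t {S₀} → All (KeyedBy q) (toList t) → members (toList t) ↭ S₀ →
    Yields (insertAll q S t) λ t′ s →
      All (KeyedBy q) (toList t′) × members (toList t′) ↭ S ++ S₀ ×
      length (toList t) ≤ length (toList t′) × s ≤ length S * (2 + length (toList t′))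
  insertAll-spec q []      t ok perm = yields-return (ok , perm , ≤-refl , z≤n)
  insertAll-spec q (x ∷ S) t {S₀} ok perm
    with push-classes (AVL⁺.insertMap-entries (d q x) (push x) t) ok
  ... | ok′ , perm′ , grows =
    yields-tick {m = insertAll q S (insertWith (d q x) (push x) t)} (yields-weaken
      (λ (ok″ , perm″ , grows″ , s≤) →
        ok″ , ↭-trans perm″ (Perm.shift x S S₀) , ≤-trans grows grows″ ,
        +-mono-≤ (+-monoʳ-≤ 2 (≤-trans (height≤ t) (≤-trans grows grows″))) s≤)
      (insertAll-spec q S _ ok′ (↭-trans perm′ (prep x perm))))
    where
    height≤ : ∀ t → height t ≤ length (toList t)
    height≤ (AVL.tree t) = AVL⁺.height≤length-entries t

  -- The relation between the keys of an earlier and a later class is a parameter, so that one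
  -- record serves before and after `reorder`.
  record Classes (q : Point) (S : Points) (_≺ᶜ_ : Rel Carrier ℓ) (kvs : List Keyed) :
                 Set (a ⊔ˡ ℓ₁ ⊔ˡ ℓ) where
    constructor classes
    field
      keyed    : All (KeyedBy q) kvs
      permutes : members kvs ↭ S
      sorted   : AllPairs (_≺ᶜ_ on proj₁) kvs

  refine-spec : ∀ q S → Yields (refine q S) λ kvs t →
    Classes q S _<ᵈ_ kvs × t ≤ length S * (2 + length kvs) + suc (length kvs)
  refine-spec q S = yields-bind {m = insertAll q S empty} (insertAll-spec q S empty [] ↭-refl)
    λ {t} (ok , perm , _ , s≤) → yields-tick {m = return (toList t)} (yields-return
      (classes ok (↭-trans perm (↭-reflexive (++-identityʳ S))) (AVL⁺.entries-sorted t) ,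
       +-mono-≤ s≤ (≤-reflexive (+-identityʳ _))))

  -- δ is the distance from p to q.

  Reordered : Carrier → Rel Carrier _
  Reordered δ j k = (k <ᵈ j × j ≤ᵈ δ) ⊎ (j <ᵈ k × δ <ᵈ k)

  private
    ≤-<-transᵈ : ∀ {x y z} → x ≤ᵈ y → y <ᵈ z → x <ᵈ z
    ≤-<-transᵈ x≤y (y≤z , y≉z) =
      ≤ᵈ-trans x≤y y≤z , λ x≈z → y≉z (≤ᵈ-antisym y≤z (≤ᵈ-trans (≤ᵈ-reflexive (≈ᵈ.sym x≈z)) x≤y))

    span-sorted : ∀ δ {kvs : List Keyed} → AllPairs (_<ᵈ_ on proj₁) kvs →
      let near , far = span (λ c → proj₁ c ≤? δ) kvs in
      near ++ far ≡ kvs × All (λ c → proj₁ c ≤ᵈ δ) near × All (λ c → δ <ᵈ proj₁ c) far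
    span-sorted δ [] = refl , [] , []
    span-sorted δ {kvs = (k , _) ∷ _} (k<js ∷ sorted) with k ≤? δ
    ... | no  k≰δ = refl , [] , ≰⇒>ᵈ k≰δ ∷ All.map (≤-<-transᵈ (proj₁ (≰⇒>ᵈ k≰δ))) k<js
    ... | yes k≤δ with span-sorted δ sorted
    ...   | eq , near≤δ , far>δ = cong (_ ∷_) eq , k≤δ ∷ near≤δ , far>δ

  reorder-spec : ∀ {q S} δ kvs → Classes q S _<ᵈ_ kvs → Yields (reorder δ kvs) λ kvs′ t →
    Classes q S (Reordered δ) kvs′ × length kvs′ ≡ length kvs × t ≡ suc (length kvs)
  reorder-spec {q} {S} δ kvs (classes ok perm sorted) with span-sorted δ sorted
  ... | eq , near≤δ , far>δ =
    yields-tick {m = return (reverse near ++ far)} (yields-return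
      (classes (Perm.All-resp-↭ (↭-sym rearranged) ok)
        (↭-trans (concat-↭ (Perm.map⁺ proj₂ rearranged)) perm)
        (AllPairsₚ.++⁺
          (AllPairs.map (λ (k<j , j≤δ , _) → inj₁ (k<j , j≤δ))
            (AllPairs-with-All (Perm.All-resp-↭ (↭-sym (Perm.↭-reverse near)) near≤δ)
              (AllPairs-reverse near-sorted)))
          (AllPairs.map (λ (j<k , (_ , δ<k)) → inj₂ (j<k , δ<k)) (AllPairs-with-All far>δ far-sorted))
          (Perm.All-resp-↭ (↭-sym (Perm.↭-reverse near))
            (All.map (λ j≤δ → All.map (λ δ<k → inj₂ (≤-<-transᵈ j≤δ δ<k , δ<k)) far>δ) near≤δ))) ,
       Perm.↭-length rearranged , +-identityʳ _))
    where
    near far : List Keyed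
    near = proj₁ (span (λ c → proj₁ c ≤? δ) kvs)
    far  = proj₂ (span (λ c → proj₁ c ≤? δ) kvs)
    rearranged : reverse near ++ far ↭ kvs
    rearranged = ↭-trans (Perm.++⁺ʳ far (Perm.↭-reverse near)) (↭-reflexive eq)
    near-sorted : AllPairs (_<ᵈ_ on proj₁) near
    near-sorted = proj₁ (AllPairs-++⁻ near (subst (AllPairs _) (sym eq) sorted))
    far-sorted : AllPairs (_<ᵈ_ on proj₁) far
    far-sorted = proj₂ (AllPairs-++⁻ near (subst (AllPairs _) (sym eq) sorted))

-- The copoints computed by recursiveRefine and the time for it

module Copoints {V : DistanceScale a ℓ₁ ℓ₂} {n : ℕ} (X : Dissimilarity V n) (choices : Choices n)
                {_≺_ : Rel (Fin n) 0ℓ} (≺-compatible : CompatibleOrder X _≺_) where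
  open Distances V
  open Dissimilarity X
  open Algorithm X choices
  open Geometry X ≺-compatible
  open Refinement X choices ≺-compatible

  Constant : Point → Points → Set ℓ₁
  Constant z C = ∀ {x y} → x ∈ C → y ∈ C → d z x ≈ᵈ d z y

  -- The two constancies together make all distances between C and D equal; `far` makes the later
  -- class the outer one.
  record Precedes (p : Point) (C D : Points) : Set ℓ₁ where
    constructor precedes
    field
      far       : ∀ {x y} → x ∈ C → y ∈ D → Far p y x
      constantˡ : ∀ {z} → z ∈ D → Constant z C
      constantʳ : ∀ {z} → z ∈ C → Constant z D

  -- Ext: points outside S to which every class must be constant.

  record Refined (p : Point) (Ext : Point → Set) (S : Points) (Cs : List Points) : Set ℓ₁ where
    constructor refined
    field
      permutes : concat Cs ↭ S
      nonempty : All NonEmpty Cs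
      ordered  : AllPairs (Precedes p) Cs
      constant : All (λ C → ∀ {z} → Ext z → Constant z C) Cs

  Constant-⊆ : ∀ {z C D} → (∀ {x} → x ∈ C → x ∈ D) → Constant z D → Constant z C
  Constant-⊆ C⊆D const x∈C y∈C = const (C⊆D x∈C) (C⊆D y∈C)

  class⊆ : ∀ {p Ext S Cs C x} → Refined p Ext S Cs → C ∈ Cs → x ∈ C → x ∈ S
  class⊆ r C∈Cs x∈C = Perm.∈-resp-↭ (Refined.permutes r) (∈-concat⁺′ x∈C C∈Cs)

  Refined-weaken : ∀ {p Ext Ext′ S Cs} → (∀ {z} → Ext′ z → Ext z ⊎ Constant z S) →
                   Refined p Ext S Cs → Refined p Ext′ S Cs
  Refined-weaken f r@(refined permutes nonempty ordered constant) =
    refined permutes nonempty ordered (All.tabulate λ C∈Cs z∈Ext′ →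
      [ All.lookup constant C∈Cs , Constant-⊆ (class⊆ r C∈Cs) ]′ (f z∈Ext′))

  -- Constancy between classes of different halves comes from the refinements themselves: each half
  -- was exterior to the refinement of the other. Only the nesting around p has to be supplied.
  Refined-++ : ∀ {p Ext Ext′ S M Cs Ds} →
    (∀ {x y} → x ∈ S → y ∈ M → Far p y x) →
    (∀ {z} → z ∈ M → Ext z) → (∀ {z} → z ∈ S → Ext′ z) →
    Refined p Ext S Cs → Refined p Ext′ M Ds →
    Refined p (λ z → Ext z × Ext′ z) (S ++ M) (Cs ++ Ds)
  Refined-++ {Cs = Cs} {Ds} far M⊆ S⊆ r@(refined perm ne ord const) s@(refined perm′ ne′ ord′ const′) =
    refined (↭-trans (↭-reflexive (sym (concat-++ Cs Ds))) (Perm.++⁺ perm perm′))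
            (Allₚ.++⁺ ne ne′)
            (AllPairsₚ.++⁺ ord ord′ (All.tabulate λ C∈ → All.tabulate λ D∈ → precedes
              (λ x∈ y∈ → far (class⊆ r C∈ x∈) (class⊆ s D∈ y∈))
              (λ z∈ → All.lookup const C∈ (M⊆ (class⊆ s D∈ z∈)))
              (λ z∈ → All.lookup const′ D∈ (S⊆ (class⊆ r C∈ z∈)))))
            (Allₚ.++⁺ (All.map (λ c {z} (ext , _) → c ext) const) (All.map (λ c {z} (_ , ext) → c ext) const′))

  ValidNext : Points → Points → Next → Set
  ValidNext In Out finished         = In ≡ [] × Out ≡ []
  ValidNext In Out (fromIn q In∖q)   = In ≡ q ∷ In∖q
  ValidNext In Out (fromOut q Out∖q) = Out ≡ q ∷ Out∖q

  next-valid : ∀ p In S Out → ValidNext In Out (next p In S Out)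
  next-valid p []       S []        = refl , refl
  next-valid p (q ∷ In) S []        = refl
  next-valid p []       S (q ∷ Out) = refl
  next-valid p (q ∷ In) S (r ∷ Out) with Choices.preferIn choices p (q ∷ In) S (r ∷ Out)
  ... | true  = refl
  ... | false = refl

  -- The bound on the time is stated with the sum of squares on the left, which
  -- lets it be summed over the classes without subtraction.

  RefineResult : Point → Points → Points → Points → List Points → ℕ → Set ℓ₁
  RefineResult p In S Out Cs t =
    Refined p (λ z → z ∈ In ⊎ z ∈ Out) S Cs ×
    t + 17 * sumSquares Cs ≤ 14 * (length In + length Out) * length S + 17 * (length S * length S) + 4

  record Positioned (p : Point) (In S Out : Points) : Set where
    constructor positioned
    field
      inside  : ∀ {u x} → u ∈ In → x ∈ S → Far p x u
      outside : ∀ {u x} → u ∈ Out → x ∈ S → Far p u x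

  -- N and M are the number of points and of classes in the whole partition by
  -- the distance to q, of which `rest` is a part.

  ClassesResult : (p q : Point) (N M : ℕ) (In Out before : Points) → List Points → List (List Points) → ℕ → Set ℓ₁
  ClassesResult p q N M In Out before rest Ts t =
    Refined p (λ z → z ≡ q ⊎ z ∈ before ⊎ z ∈ In ⊎ z ∈ Out) (concat rest) (concat Ts) ×
    length Ts ≡ length rest ×
    t + 17 * sumSquares (concat Ts) + length (concat rest)
      ≤ 14 * (N + (length In + length Out)) * length (concat rest) + 3 * sumSquares rest
        + length rest * (5 + N + M)

  private
    -- With e exterior points, e + s = N + io, hence 14·e·s = 14·(N + io)·s - 14·s², and of the
    -- potential 17·s² there remains 3·s². Copying the inside and outside lists costs N + M + 1 - s;
    -- keeping s on the left avoids the subtraction. Together with the constant 4 of the recursive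
    -- call this gives 5 + N + M per class.
    step-cost : ∀ N M s N′ σ k t t′ q q′ a b e io → e + s ≡ N + io → a + b + s ≡ N + M + 1 →
      t + 17 * q ≤ 14 * e * s + 17 * (s * s) + 4 →
      t′ + 17 * q′ + N′ ≤ 14 * (N + io) * N′ + 3 * σ + k * (5 + N + M) →
      a + (b + (t + (t′ + 0))) + 17 * (q + q′) + (s + N′)
        ≤ 14 * (N + io) * (s + N′) + 3 * (s * s + σ) + suc k * (5 + N + M)
    step-cost N M s N′ σ k t t′ q q′ a b e io e+s a+b+s t≤ t′≤ = begin
      a + (b + (t + (t′ + 0))) + 17 * (q + q′) + (s + N′)
        ≡⟨ e₁ a b t t′ q q′ s N′ ⟩
      (a + b + s) + ((t + 17 * q) + (t′ + 17 * q′ + N′))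
        ≤⟨ +-mono-≤ (≤-reflexive a+b+s) (+-mono-≤ t≤ t′≤) ⟩
      (N + M + 1) + ((14 * e * s + 17 * (s * s) + 4) + (14 * (N + io) * N′ + 3 * σ + k * (5 + N + M)))
        ≡⟨ e₂ N M e s σ k N′ (N + io) ⟩
      14 * (e + s) * s + 14 * (N + io) * N′ + 3 * (s * s + σ) + suc k * (5 + N + M)
        ≡⟨ cong (λ z → 14 * z * s + 14 * (N + io) * N′ + 3 * (s * s + σ) + suc k * (5 + N + M)) e+s ⟩
      14 * (N + io) * s + 14 * (N + io) * N′ + 3 * (s * s + σ) + suc k * (5 + N + M)
        ≡⟨ cong (λ z → z + 3 * (s * s + σ) + suc k * (5 + N + M)) (*-distribˡ-+ (14 * (N + io)) s N′) ⟨
      14 * (N + io) * (s + N′) + 3 * (s * s + σ) + suc k * (5 + N + M) ∎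
      where
      open ≤-Reasoning
      e₁ : ∀ a b t t′ q q′ s N′ → a + (b + (t + (t′ + 0))) + 17 * (q + q′) + (s + N′)
             ≡ (a + b + s) + ((t + 17 * q) + (t′ + 17 * q′ + N′))
      e₁ = solve-∀
      e₂ : ∀ N M e s σ k N′ z →
           (N + M + 1) + ((14 * e * s + 17 * (s * s) + 4) + (14 * z * N′ + 3 * σ + k * (5 + N + M)))
             ≡ 14 * (e + s) * s + 14 * z * N′ + 3 * (s * s + σ) + suc k * (5 + N + M)
      e₂ = solve-∀

    -- The origin of 14 and 17. Refining, copying for M classes and M² ≤ N·M make up 3·N·M, which
    -- together with 3·σ is at most 3·N² + 3·N by the count of separated pairs; so 17 = 14 + 3. The
    -- linear overhead is at most 11·N, and 11 + 3 = 14 is what the consumed exterior point q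
    -- contributes per point of S.
    total-cost : ∀ r t t′ N M σ q k io → r ≤ N * (2 + M) + 2 * suc M → k ≤ N + M + 1 → M ≤ N →
      N * M + σ ≤ N * N + N →
      t + 17 * q + N ≤ 14 * (N + io) * N + 3 * σ + M * (5 + N + M) →
      t′ ≡ 1 + r + t + k →
      t′ + 17 * q ≤ 14 * suc io * N + 17 * (N * N) + 4
    total-cost r t t′ N M σ q k io r≤ k≤ M≤N sep t≤ refl = begin
      1 + r + t + k + 17 * q
        ≤⟨ +-monoˡ-≤ (17 * q) (+-mono-≤ (+-monoˡ-≤ t (+-monoʳ-≤ 1 r≤)) k≤) ⟩
      1 + (N * (2 + M) + 2 * suc M) + t + (N + M + 1) + 17 * q
        ≡⟨ e₁ N M t q ⟩
      (t + 17 * q + N) + (4 + 2 * N + 3 * M + N * M)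
        ≤⟨ +-monoˡ-≤ _ t≤ ⟩
      14 * (N + io) * N + 3 * σ + M * (5 + N + M) + (4 + 2 * N + 3 * M + N * M)
        ≡⟨ e₂ N M σ io ⟩
      14 * (N + io) * N + 3 * σ + M * M + (2 * (N * M) + (8 * M + (2 * N + 4)))
        ≤⟨ +-mono-≤ (+-monoʳ-≤ (14 * (N + io) * N + 3 * σ) (*-monoˡ-≤ M M≤N))
                    (+-monoʳ-≤ (2 * (N * M)) (+-mono-≤ (*-monoʳ-≤ 8 M≤N) (+-monoˡ-≤ 4 (m≤n+m (2 * N) N)))) ⟩
      14 * (N + io) * N + 3 * σ + N * M + (2 * (N * M) + (8 * N + (N + 2 * N + 4)))
        ≡⟨ e₃ N M σ io ⟩
      3 * (N * M + σ) + (14 * (N + io) * N + 11 * N + 4)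
        ≤⟨ +-monoˡ-≤ _ (*-monoʳ-≤ 3 sep) ⟩
      3 * (N * N + N) + (14 * (N + io) * N + 11 * N + 4)
        ≡⟨ e₄ N io ⟩
      14 * suc io * N + 17 * (N * N) + 4 ∎
      where
      open ≤-Reasoning
      e₁ : ∀ N M t q → 1 + (N * (2 + M) + 2 * suc M) + t + (N + M + 1) + 17 * q
                         ≡ (t + 17 * q + N) + (4 + 2 * N + 3 * M + N * M)
      e₁ = solve-∀
      e₂ : ∀ N M σ io → 14 * (N + io) * N + 3 * σ + M * (5 + N + M) + (4 + 2 * N + 3 * M + N * M)
                          ≡ 14 * (N + io) * N + 3 * σ + M * M + (2 * (N * M) + (8 * M + (2 * N + 4)))
      e₂ = solve-∀
      e₃ : ∀ N M σ io → 14 * (N + io) * N + 3 * σ + N * M + (2 * (N * M) + (8 * N + (N + 2 * N + 4)))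
                          ≡ 3 * (N * M + σ) + (14 * (N + io) * N + 11 * N + 4)
      e₃ = solve-∀
      e₄ : ∀ N io → 3 * (N * N + N) + (14 * (N + io) * N + 11 * N + 4)
                      ≡ 14 * suc io * N + 17 * (N * N) + 4
      e₄ = solve-∀

  private
    ClassFar : Point → Points → Points → Set
    ClassFar p C D = ∀ {x y} → x ∈ C → y ∈ D → Far p y x

    concat-∷ʳ : (Ls : List Points) (L : Points) → concat (Ls ∷ʳ L) ≡ concat Ls ++ L
    concat-∷ʳ Ls L = trans (sym (concat-++ Ls (L ∷ []))) (cong (concat Ls ++_) (++-identityʳ L))

    finished-result : ∀ {p In S Out} → 1 ≤ length In + length S + length Out → In ≡ [] → Out ≡ [] →
                      RefineResult p In S Out (S ∷ []) 1
    finished-result {S = S} size refl refl =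
      refined (↭-reflexive (++-identityʳ S)) (subst (1 ≤_) (+-identityʳ _) size ∷ [])
              ([] ∷ []) ((λ where (inj₁ ()) ; (inj₂ ())) ∷ []) ,
      ≤-trans (≤-reflexive (e (length S * length S))) (+-monoʳ-≤ (17 * (length S * length S)) (s≤s z≤n))
      where
      e : ∀ s → 1 + 17 * (s + 0) ≡ 17 * s + 1
      e = solve-∀

    -- The common end of both kinds of step. The factor 2 in `2 * suc (length kvs)` leaves room for
    -- `reorder` besides the enumeration of the keys.
    conclude : ∀ {p q S kvs In Out In′ Out′ Ts r t k} {R : Rel Carrier ℓ} → Classes q S R kvs →
      r ≤ length S * (2 + length kvs) + 2 * suc (length kvs) →
      (let rest = map proj₂ kvs) →
      ClassesResult p q (length (concat rest)) (length rest) In′ Out′ [] rest Ts t →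
      k ≤ length (concat Ts) + length Ts + 1 →
      length In + length Out ≡ suc (length In′ + length Out′) →
      (∀ {z} → z ∈ In ⊎ z ∈ Out → z ≡ q ⊎ z ∈ In′ ⊎ z ∈ Out′) →
      RefineResult p In S Out (concat Ts) (1 + r + t + k)
    conclude {S = S} {kvs} {In} {Out} {In′} {Out′} {Ts} {r} {t} {k} (classes ok perm _) r≤
             (refined perm′ ne ord const , len , t≤) k≤ io≡ split =
      Refined-weaken (λ z∈ → inj₁ ([ inj₁ , inj₂ ∘ inj₂ ]′ (split z∈)))
        (refined (↭-trans perm′ perm) ne ord const) ,
      subst₂ (λ s io → 1 + r + t + k + 17 * sumSquares (concat Ts) ≤ 14 * io * s + 17 * (s * s) + 4)
        N≡ (sym io≡)
        (total-cost r t _ N M (sumSquares rest) (sumSquares (concat Ts)) k (length In′ + length Out′)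
          (subst₂ (λ s m → r ≤ s * (2 + m) + 2 * suc m) (sym N≡) (sym (length-map proj₂ kvs)) r≤)
          (≤-trans k≤ (+-monoˡ-≤ 1 (+-mono-≤ (≤-trans (length≤length-concat ne) (≤-reflexive (Perm.↭-length perm′)))
                                              (≤-reflexive len))))
          (length≤length-concat rest-nonempty) (separated-pairs rest-nonempty) t≤ refl)
      where
      rest = map proj₂ kvs
      rest-nonempty : All NonEmpty rest
      rest-nonempty = Allₚ.map⁺ (All.map proj₁ ok)
      N = length (concat rest)
      M = length rest
      N≡ : N ≡ length S
      N≡ = Perm.↭-length perm

    sizes : ∀ (B In S A Out : Points) {N} → length B + length (S ++ A) ≡ N →
            length (B ++ In) + length S + length (A ++ Out) ≡ length In + length Out + N
    sizes B In S A Out refl rewrite length-++ B {In} | length-++ A {Out} | length-++ S {A} =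
      e (length B) (length In) (length S) (length A) (length Out)
      where
      e : ∀ b i s a o → b + i + s + (a + o) ≡ i + o + (b + (s + a))
      e = solve-∀

    classes-far : ∀ {p q S kvs} {R : Rel Carrier ℓ} →
      (∀ {j k x y} → R j k → x ∈ S → y ∈ S → d q x ≈ᵈ j → d q y ≈ᵈ k → Far p y x) →
      Classes q S R kvs → AllPairs (ClassFar p) (map proj₂ kvs)
    classes-far {q = q} {S} {kvs} far (classes ok perm sorted) = AllPairsₚ.map⁺
      (AllPairs.map (λ (jRk , (x∈S , (_ , x≈j)) , (y∈S , (_ , y≈k))) {x} {y} x∈ y∈ →
          far jRk (x∈S x∈) (y∈S y∈) (All.lookup x≈j x∈) (All.lookup y≈k y∈))
        (AllPairs-with-All located sorted))
      where
      located : All (λ kv → (∀ {x} → x ∈ proj₂ kv → x ∈ S) × KeyedBy q kv) kvs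
      located = All.tabulate λ kv∈ →
        (λ x∈ → Perm.∈-resp-↭ perm (∈-concat⁺′ x∈ (∈-map⁺ proj₂ kv∈))) , All.lookup ok kv∈

    classes-constant : ∀ {q S kvs} {R : Rel Carrier ℓ} → Classes q S R kvs → All (Constant q) (map proj₂ kvs)
    classes-constant (classes ok _ _) = Allₚ.map⁺
      (All.map (λ (_ , x≈k) {x} {y} x∈ y∈ → ≈ᵈ.trans (All.lookup x≈k x∈) (≈ᵈ.sym (All.lookup x≈k y∈))) ok)

    classes-nonempty : ∀ {q S kvs} {R : Rel Carrier ℓ} → Classes q S R kvs → All NonEmpty (map proj₂ kvs)
    classes-nonempty (classes ok _ _) = Allₚ.map⁺ (All.map proj₁ ok)

  mutual
    -- Only the total size has to be positive: a one-point space starts with In = [p] and S empty.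
    -- Once In and Out are exhausted, this forces the returned class to be nonempty.
    recursiveRefineWithin-spec : ∀ fuel p In S Out → length In + length S + length Out ≤ fuel →
      1 ≤ length In + length S + length Out → Positioned p In S Out →
      Yields (recursiveRefineWithin fuel p In S Out) (RefineResult p In S Out)
    recursiveRefineWithin-spec fuel p In S Out size≤ size pos =
      refineStep-spec fuel p In S Out (next p In S Out) (next-valid p In S Out) size≤ size pos

    refineStep-spec : ∀ fuel p In S Out nx → ValidNext In Out nx →
      length In + length S + length Out ≤ fuel →
      1 ≤ length In + length S + length Out → Positioned p In S Out →
      Yields (refineStep fuel p In S Out nx) (RefineResult p In S Out)
    refineStep-spec fuel p In S Out finished (eq , eq′) size≤ size pos =
      _ , _ , refl , finished-result size eq eq′
    refineStep-spec zero p In S Out (fromIn q In∖q) refl () size pos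
    refineStep-spec zero p In S Out (fromOut q Out∖q) refl size≤ size pos =
      contradiction (≤-trans (m≤n+m _ (length In + length S)) size≤) λ ()
    refineStep-spec (suc fuel) p In S Out (fromIn q In∖q) refl (s≤s size≤) size (positioned inside outside) =
      yields-tick (yields-bind (refine-spec q S) λ {kvs} {r} (cs@(classes ok perm sorted) , r≤) →
        yields-bind {m = refineClasses fuel p In∖q Out [] (map proj₂ kvs)}
          (refineClasses-spec fuel p q In∖q Out [] (map proj₂ kvs)
            (≤-trans (≤-reflexive (size-eq (Perm.↭-length perm))) size≤) refl refl
            (classes-nonempty cs) (classes-constant cs)
            (positioned (λ u∈ x∈ → inside (there u∈) (Perm.∈-resp-↭ perm x∈))
                        (λ u∈ x∈ → outside u∈ (Perm.∈-resp-↭ perm x∈)))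
            (classes-far (λ j<k x∈ y∈ x≈j y≈k → Far-in (inside (here refl) y∈)
              (<ᵈ-respˡ-≈ᵈ (≈ᵈ.sym x≈j) (<ᵈ-respʳ-≈ᵈ (≈ᵈ.sym y≈k) j<k))) cs))
          λ {Ts} {t} result →
          yields-weaken-≡ (λ {k} k≤ → subst (RefineResult p In S Out (concat Ts)) (e r t k)
                (conclude {Ts = Ts} cs
                  (≤-trans r≤ (+-monoʳ-≤ (length S * (2 + length kvs)) (m≤m+n (suc (length kvs)) _))) result k≤ refl λ where
                  (inj₁ (here z≡q)) → inj₁ z≡q
                  (inj₁ (there z∈)) → inj₂ (inj₁ z∈)
                  (inj₂ z∈)         → inj₂ (inj₂ z∈)))
            (yields-concatenate Ts))
      where
      e : ∀ r t k → 1 + r + t + k ≡ 1 + (r + (t + k))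
      e = solve-∀
      size-eq : ∀ {N s} → N ≡ s → length In∖q + length Out + N ≡ length In∖q + s + length Out
      size-eq {N} refl = e′ (length In∖q) (length Out) N
        where
        e′ : ∀ i o N → i + o + N ≡ i + N + o
        e′ = solve-∀
    refineStep-spec (suc fuel) p In S Out (fromOut q Out∖q) refl size≤ size (positioned inside outside) =
      yields-tick (yields-bind (refine-spec q S) λ {kvs} {r} (cs , r≤) →
        yields-bind {m = reorder (d p q) kvs} (reorder-spec (d p q) kvs cs) λ {kvs′} {r′} (cs′@(classes ok perm sorted) , len , r′≡) →
            yields-bind {m = refineClasses fuel p In Out∖q [] (map proj₂ kvs′)}
              (refineClasses-spec fuel p q In Out∖q [] (map proj₂ kvs′)
                (≤-pred (≤-trans (≤-reflexive (size-eq (Perm.↭-length perm))) size≤)) refl refl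
                (classes-nonempty cs′) (classes-constant cs′)
                (positioned (λ u∈ x∈ → inside u∈ (Perm.∈-resp-↭ perm x∈))
                            (λ u∈ x∈ → outside (there u∈) (Perm.∈-resp-↭ perm x∈)))
                (classes-far (λ jRk x∈ y∈ x≈j y≈k → Far-out (outside (here refl) x∈)
                  ([ (λ (k<j , j≤δ) → inj₁ (<ᵈ-respˡ-≈ᵈ (≈ᵈ.sym y≈k) (<ᵈ-respʳ-≈ᵈ (≈ᵈ.sym x≈j) k<j) ,
                                            ≤ᵈ-trans (≤ᵈ-reflexive x≈j) j≤δ))
                   , (λ (j<k , δ<k) → inj₂ (<ᵈ-respˡ-≈ᵈ (≈ᵈ.sym x≈j) (<ᵈ-respʳ-≈ᵈ (≈ᵈ.sym y≈k) j<k) ,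
                                            <ᵈ-respʳ-≈ᵈ (≈ᵈ.sym y≈k) δ<k)) ]′ jRk)) cs′))
              λ {Ts} {t} result →
              yields-weaken-≡ (λ {k} k≤ → subst (RefineResult p In S Out (concat Ts)) (e r r′ t k)
                    (conclude {Ts = Ts} {r = r + r′} cs′ (cost {s = length S} r≤ len r′≡) result
                      k≤ (+-suc (length In) (length Out∖q)) λ where
                      (inj₁ z∈)          → inj₂ (inj₁ z∈)
                      (inj₂ (here z≡q))  → inj₁ z≡q
                      (inj₂ (there z∈))  → inj₂ (inj₂ z∈)))
                (yields-concatenate Ts))
      where
      e : ∀ r r′ t k → 1 + (r + r′) + t + k ≡ 1 + (r + (r′ + (t + k)))
      e = solve-∀
      size-eq : ∀ {N s} → N ≡ s → suc (length In + length Out∖q + N) ≡ length In + s + suc (length Out∖q)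
      size-eq {N} refl = e′ (length In) (length Out∖q) N
        where
        e′ : ∀ i o N → suc (i + o + N) ≡ i + N + suc o
        e′ = solve-∀
      cost : ∀ {r r′ s m m′} → r ≤ s * (2 + m) + suc m → m′ ≡ m → r′ ≡ suc m →
             r + r′ ≤ s * (2 + m′) + 2 * suc m′
      cost {s = s} {m} r≤ refl refl = ≤-trans (+-monoˡ-≤ (suc m) r≤) (≤-reflexive (e′ s m))
        where
        e′ : ∀ s m → s * (2 + m) + suc m + suc m ≡ s * (2 + m) + 2 * suc m
        e′ = solve-∀

    -- Inside and outside are one relation read from its two ends: for a given class the classes
    -- before it are inside and those after it outside. Pairwise nesting of the classes is thus what
    -- restores `Positioned` in each recursive call.
    refineClasses-spec : ∀ fuel p q In Out before rest {N M} →
      length In + length Out + N ≤ fuel →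
      length (concat before) + length (concat rest) ≡ N → length before + length rest ≡ M →
      All NonEmpty rest → All (Constant q) rest →
      Positioned p In (concat rest) Out → AllPairs (ClassFar p) (before ++ rest) →
      Yields (refineClasses fuel p In Out before rest) (ClassesResult p q N M In Out (concat before) rest)
    refineClasses-spec fuel p q In Out before [] {N} {M} size≤ N≡ M≡ ne qs pos far =
      yields-return (refined ↭-refl [] [] [] , refl , z≤n)
    refineClasses-spec fuel p q In Out before (S ∷ after) {N} {M} size≤ N≡ M≡ (ne ∷ nes) (qS ∷ qs)
                       (positioned inside outside) far =
      yields-bind (concatenate-∷ʳ before In) λ where
        (refl , refl) → yields-bind (concatenate-∷ʳ after Out) λ where
          (refl , refl) →
            yields-bind (recursiveRefineWithin-spec fuel p (concat before ++ In) S (concat after ++ Out)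
                (≤-trans (≤-reflexive (sizes (concat before) In S (concat after) Out N≡)) size≤)
                (≤-trans ne (≤-trans (m≤n+m (length S) _) (m≤m+n _ (length (concat after ++ Out)))))
                (positioned
                  (λ u∈ x∈ → [ (λ u∈before → let L , u∈L , L∈ = ∈-concat⁻′ before u∈before in
                                  AllPairs-lookup-++ before far L∈ (here refl) u∈L x∈)
                             , (λ u∈In → inside u∈In (∈-++⁺ˡ x∈)) ]′ (∈-++⁻ (concat before) u∈))
                  (λ u∈ x∈ → [ (λ u∈after → let L , u∈L , L∈ = ∈-concat⁻′ after u∈after in
                                  All.lookup (AllPairs.head (proj₂ (AllPairs-++⁻ before far))) L∈ x∈ u∈L)
                             , (λ u∈Out → outside u∈Out (∈-++⁺ˡ x∈)) ]′ (∈-++⁻ (concat after) u∈))))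
              λ {T} {t} (ref , t≤) →
              yields-bind (refineClasses-spec fuel p q In Out (before ∷ʳ S) after {N} {M} size≤ N≡′ M≡′ nes qs
                (positioned (λ u∈ x∈ → inside u∈ (∈-++⁺ʳ S x∈)) (λ u∈ x∈ → outside u∈ (∈-++⁺ʳ S x∈)))
                (subst (AllPairs (ClassFar p)) (sym (∷ʳ-++ before S after)) far))
              λ {Ts} {t′} (ref′ , len , t′≤) → yields-return (combine ref ref′ , cong suc len ,
                cost {T} {Ts} {t} {t′} t≤ t′≤)
      where
      N≡′ : length (concat (before ∷ʳ S)) + length (concat after) ≡ N
      N≡′ rewrite concat-∷ʳ before S | length-++ (concat before) {S}
                | +-assoc (length (concat before)) (length S) (length (concat after)) =
        trans (cong (length (concat before) +_) (sym (length-++ S))) N≡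
      M≡′ : length (before ∷ʳ S) + length after ≡ M
      M≡′ rewrite length-++ before {S ∷ []} | +-assoc (length before) 1 (length after) = M≡
      inner-size : length (concat before ++ In) + length (concat after ++ Out) + length S
                     ≡ N + (length In + length Out)
      inner-size = trans (e _ (length (concat after ++ Out)) (length S))
        (trans (sizes (concat before) In S (concat after) Out N≡) (+-comm _ N))
        where
        e : ∀ x y s → x + y + s ≡ x + s + y
        e = solve-∀
      overhead : length (concat before) + length before + 1 + (length (concat after) + length after + 1) + length S
                   ≡ N + M + 1
      overhead = trans (e (length (concat before)) (length before) (length (concat after)) (length after) (length S))
        (cong₂ (λ N M → N + M + 1)
          (trans (cong (length (concat before) +_) (sym (length-++ S))) N≡) M≡)
        where
        e : ∀ b k a l s → b + k + 1 + (a + l + 1) + s ≡ b + (s + a) + (k + suc l) + 1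
        e = solve-∀
      cost : ∀ {T Ts t t′} →
        t + 17 * sumSquares T ≤ 14 * (length (concat before ++ In) + length (concat after ++ Out)) * length S
                                  + 17 * (length S * length S) + 4 →
        t′ + 17 * sumSquares (concat Ts) + length (concat after)
          ≤ 14 * (N + (length In + length Out)) * length (concat after) + 3 * sumSquares after
            + length after * (5 + N + M) →
        length (concat before) + length before + 1 + (length (concat after) + length after + 1 + (t + (t′ + 0)))
          + 17 * sumSquares (T ++ concat Ts) + length (S ++ concat after)
          ≤ 14 * (N + (length In + length Out)) * length (S ++ concat after) + 3 * sumSquares (S ∷ after)
            + suc (length after) * (5 + N + M)
      cost {T} {Ts} {t} {t′} t≤ t′≤ = subst₂ (λ σ l →
          length (concat before) + length before + 1 + (length (concat after) + length after + 1 + (t + (t′ + 0)))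
            + 17 * σ + l
            ≤ 14 * (N + (length In + length Out)) * l + 3 * sumSquares (S ∷ after) + suc (length after) * (5 + N + M))
        (sym (sumSquares-++ T (concat Ts))) (sym (length-++ S))
        (step-cost N M (length S) (length (concat after)) (sumSquares after) (length after)
          t t′ (sumSquares T) (sumSquares (concat Ts)) (length (concat before) + length before + 1)
          (length (concat after) + length after + 1)
          (length (concat before ++ In) + length (concat after ++ Out)) (length In + length Out)
          inner-size overhead t≤ t′≤)
      combine : ∀ {T Cs} →
        Refined p (λ z → z ∈ concat before ++ In ⊎ z ∈ concat after ++ Out) S T →
        Refined p (λ z → z ≡ q ⊎ z ∈ concat (before ∷ʳ S) ⊎ z ∈ In ⊎ z ∈ Out) (concat after) Cs →
        Refined p (λ z → z ≡ q ⊎ z ∈ concat before ⊎ z ∈ In ⊎ z ∈ Out) (S ++ concat after) (T ++ Cs)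
      combine ref ref′ rewrite concat-∷ʳ before S =
        Refined-weaken (λ ext → inj₁ (inj₂ ext , [ inj₁ , [ inj₂ ∘ inj₁ ∘ ∈-++⁺ˡ , inj₂ ∘ inj₂ ]′ ]′ ext))
          (Refined-++ (λ x∈ y∈ → let L , y∈L , L∈ = ∈-concat⁻′ after y∈ in
              All.lookup (AllPairs.head (proj₂ (AllPairs-++⁻ before far))) L∈ x∈ y∈L)
            inj₁ (λ z∈S → inj₂ (inj₁ (∈-++⁺ʳ (concat before) z∈S)))
            (Refined-weaken {Ext′ = λ z → z ∈ concat after ⊎ z ≡ q ⊎ z ∈ concat before ⊎ z ∈ In ⊎ z ∈ Out}
              (λ where
                (inj₁ z∈)                      → inj₁ (inj₂ (∈-++⁺ˡ z∈))
                -- q has been dropped from both lists, but a class is equidistant from q by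
                -- construction.
                (inj₂ (inj₁ refl))             → inj₂ qS
                (inj₂ (inj₂ (inj₁ z∈)))        → inj₁ (inj₁ (∈-++⁺ˡ z∈))
                (inj₂ (inj₂ (inj₂ (inj₁ z∈)))) → inj₁ (inj₁ (∈-++⁺ʳ (concat before) z∈))
                (inj₂ (inj₂ (inj₂ (inj₂ z∈)))) → inj₁ (inj₂ (∈-++⁺ʳ (concat after) z∈)))
              ref)
            ref′)

-- Order of occurrence in a list

Before-∈ˡ : ∀ {L : List A} {x y} → Before L x y → x ∈ L
Before-∈ˡ B = Sub.lookup B (here refl)

Before-∈ʳ : ∀ {L : List A} {x y} → Before L x y → y ∈ L
Before-∈ʳ B = Sub.lookup B (there (here refl))

Before-head : ∀ {L : List A} {x y} → y ∈ L → Before (x ∷ L) x y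
Before-head y∈L = refl Sub.∷ Sub.from∈ y∈L

Before-++ : ∀ (L : List A) {M x y} → x ∈ L → y ∈ M → Before (L ++ M) x y
Before-++ (_ ∷ L) (here refl) y∈M = Before-head (∈-++⁺ʳ L y∈M)
Before-++ (z ∷ L) (there x∈L) y∈M = z Sub.∷ʳ Before-++ L x∈L y∈M

Before-connex : ∀ {L : List A} {x y} → x ∈ L → y ∈ L → x ≡ y ⊎ Before L x y ⊎ Before L y x
Before-connex (here refl) (here refl) = inj₁ refl
Before-connex (here refl) (there y∈L) = inj₂ (inj₁ (Before-head y∈L))
Before-connex (there x∈L) (here refl) = inj₂ (inj₂ (Before-head x∈L))
Before-connex (there x∈L) (there y∈L) =
  [ inj₁ , [ inj₂ ∘ inj₁ ∘ (_ Sub.∷ʳ_) , inj₂ ∘ inj₂ ∘ (_ Sub.∷ʳ_) ]′ ]′ (Before-connex x∈L y∈L)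

AllPairs-Before : ∀ {R : Rel A ℓ} {L} → AllPairs R L → ∀ {x y} → Before L x y → R x y
AllPairs-Before (_ ∷ RL)  (_ Sub.∷ʳ B)    = AllPairs-Before RL B
AllPairs-Before (Rx ∷ _)  (refl Sub.∷ B)  = All.lookup Rx (Sub.to∈ B)

Before-irrefl : ∀ {L : List A} → Unique L → ∀ {x y} → x ≡ y → ¬ Before L x y
Before-irrefl unique x≡y B = AllPairs-Before unique B x≡y

-- Without repetitions the two occurrences of y coincide, so the two pairs merge into one sublist.
Before-triple : ∀ {L : List A} → Unique L → ∀ {x y z} → Before L x y → Before L y z → (x ∷ y ∷ z ∷ []) ⊆ L
Before-triple (_ ∷ u)   (_ Sub.∷ʳ B)   (_ Sub.∷ʳ B′)   = _ Sub.∷ʳ Before-triple u B B′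
Before-triple (_ ∷ _)   (refl Sub.∷ B) (_ Sub.∷ʳ B′)   = refl Sub.∷ B′
Before-triple (y≢ ∷ _)  (_ Sub.∷ʳ B)   (refl Sub.∷ B′) = contradiction refl (All.lookup y≢ (Before-∈ʳ B))
Before-triple (y≢ ∷ _)  (refl Sub.∷ B) (refl Sub.∷ B′) = contradiction refl (All.lookup y≢ (Sub.to∈ B))

Before-trans : ∀ {L : List A} → Unique L → ∀ {x y z} → Before L x y → Before L y z → Before L x z
Before-trans unique xy yz = Sub.⊆-trans (refl Sub.∷ _ Sub.∷ʳ refl Sub.∷ Sub.[]) (Before-triple unique xy yz)

AllPairs-Before-self : (L : List A) → AllPairs (Before L) L
AllPairs-Before-self []      = []
AllPairs-Before-self (x ∷ L) = All.tabulate Before-head ∷ AllPairs.map (x Sub.∷ʳ_) (AllPairs-Before-self L)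

⊆-map⁻ : ∀ {f : A → B} ys {xs} → xs ⊆ map f ys → ∃[ zs ] (zs ⊆ ys × map f zs ≡ xs)
⊆-map⁻ []       Sub.[]         = [] , Sub.[] , refl
⊆-map⁻ (y ∷ ys) (_ Sub.∷ʳ sub) with ⊆-map⁻ ys sub
... | zs , sub′ , eq = zs , y Sub.∷ʳ sub′ , eq
⊆-map⁻ (y ∷ ys) (refl Sub.∷ sub) with ⊆-map⁻ ys sub
... | zs , sub′ , refl = y ∷ zs , refl Sub.∷ sub′ , refl

AllPairs-⊆ : ∀ {R : Rel A ℓ} {xs ys} → xs ⊆ ys → AllPairs R ys → AllPairs R xs
AllPairs-⊆ Sub.[]           []         = []
AllPairs-⊆ (_ Sub.∷ʳ sub)   (_ ∷ Rys)  = AllPairs-⊆ sub Rys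
AllPairs-⊆ (refl Sub.∷ sub) (Ry ∷ Rys) = Allₚ.anti-mono (Sub.lookup sub) Ry ∷ AllPairs-⊆ sub Rys

AtOrBefore : List A → Rel A _
AtOrBefore L x y = x ≡ y ⊎ Before L x y

∈-lastOf : ∀ (x : A) xs → lastOf x xs ∈ x ∷ xs
∈-lastOf x []       = here refl
∈-lastOf x (y ∷ xs) = there (∈-lastOf y xs)

AtOrBefore-lastOf : ∀ {x : A} {xs u} → u ∈ x ∷ xs → AtOrBefore (x ∷ xs) u (lastOf x xs)
AtOrBefore-lastOf {xs = []}    (here refl) = inj₁ refl
AtOrBefore-lastOf {xs = _ ∷ _} (here refl) = inj₂ (Before-head (∈-lastOf _ _))
AtOrBefore-lastOf {xs = _ ∷ _} (there u∈)  = [ inj₁ , inj₂ ∘ (_ Sub.∷ʳ_) ]′ (AtOrBefore-lastOf u∈)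

AtOrBefore-head : ∀ {x : A} {xs u} → u ∈ x ∷ xs → AtOrBefore (x ∷ xs) x u
AtOrBefore-head (here refl) = inj₁ refl
AtOrBefore-head (there u∈)  = inj₂ (Before-head u∈)

AtOrBefore-⊆ : ∀ {L M : List A} {x y} → L ⊆ M → AtOrBefore L x y → AtOrBefore M x y
AtOrBefore-⊆ L⊆M = [ inj₁ , inj₂ ∘ (λ B → Sub.⊆-trans B L⊆M) ]′

-- Separating a copoint at a cut

module Separation {V : DistanceScale a ℓ₁ ℓ₂} {n : ℕ} (X : Dissimilarity V n) (choices : Choices n)
                  {_≺_ : Rel (Fin n) 0ℓ} (≺-compatible : CompatibleOrder X _≺_) where
  open Distances V
  open Dissimilarity X
  open Algorithm X choices
  open Geometry X ≺-compatible
  open Copoints X choices ≺-compatible using (Constant)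

  record Seriated (L : Points) : Set ℓ₂ where
    constructor seriated
    field
      unique : Unique L
      middle : ∀ {x y z} → Before L x y → Before L y z → Mid x y z

    interval-bound : ∀ {w x y z} → AtOrBefore L w x → Before L x y → AtOrBefore L y z → d x y ≤ᵈ d w z
    interval-bound (inj₁ refl) xy (inj₁ refl) = ≤ᵈ-refl
    interval-bound (inj₁ refl) xy (inj₂ yz)   = proj₁ (middle xy yz)
    interval-bound (inj₂ wx)   xy (inj₁ refl) = proj₂ (middle wx xy)
    interval-bound (inj₂ wx)   xy (inj₂ yz)   =
      ≤ᵈ-trans (proj₁ (middle xy yz)) (proj₂ (middle wx (Before-trans unique xy yz)))

    diameter-bound : ∀ {w z M} → (∀ {u} → u ∈ M → u ∈ L × AtOrBefore L w u × AtOrBefore L u z) →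
                     ∀ {u v} → u ∈ M → v ∈ M → d u v ≤ᵈ d w z
    diameter-bound within {u} {v} u∈ v∈ with within u∈ | within v∈
    ... | u∈L , wu , uz | v∈L , wv , vz with Before-connex u∈L v∈L
    ...   | inj₁ u≡v       = d-diagonal-≤ u≡v
    ...   | inj₂ (inj₁ uv) = interval-bound wu uv vz
    ...   | inj₂ (inj₂ vu) = ≤ᵈ-trans (≤ᵈ-reflexive (d-sym u v)) (interval-bound wv vu uz)

  Compact : Point → Points → Set ℓ₂
  Compact p T = ∀ {u v} → u ∈ T → v ∈ T → d u v ≤ᵈ d p u

  -- Nothing ties T and U to the sides in ≺, as a cut elsewhere may pass the three tests first. Only
  -- the ends x and y are known to be opposite; everything else about the cut is a statement on
  -- distances.
  data Separated (p : Point) (L : Points) : List (Block n) → Set (ℓ₁ ⊔ˡ ℓ₂) where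
    whole : ∀ {x} → x ∈ L → Compact p L → Separated p L ((x , L) ∷ [])
    split : ∀ {x T y U} → x ∈ T → y ∈ U → T ++ U ≡ L → Compact p T → Compact p U →
            (∀ {u v} → u ∈ T → v ∈ U → d p u ≤ᵈ d u v) → Opposite {p} x y → ¬ (d x y ≤ᵈ d p x) →
            Separated p L ((x , T) ∷ (y , U) ∷ [])

  module _ {p : Point} {x : Point} {xs : Points} (L-seriated : Seriated (x ∷ xs))
           (p≢ : ∀ {u} → u ∈ x ∷ xs → u ≢ p) (p-constant : Constant p (x ∷ xs)) where
    open Seriated L-seriated

    private
      L = x ∷ xs
      x* = lastOf x xs

      compact : ∀ {w z M} → (∀ {u} → u ∈ M → u ∈ L × AtOrBefore L w u × AtOrBefore L u z) →
                d w z ≤ᵈ d p x → Compact p M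
      compact within wz≤ u∈ v∈ = ≤ᵈ-trans (diameter-bound within u∈ v∈)
        (≤ᵈ-trans wz≤ (≤ᵈ-reflexive (p-constant (here refl) (proj₁ (within u∈)))))

      cost-stop : ∀ r b → 1 + (suc (suc b) + 0 + 0) ≤ 2 * suc r + b + 2
      cost-stop r b = ≤-trans (m≤m+n _ (2 * r + 1)) (≤-reflexive (e r b))
        where
        e : ∀ r b → 1 + (suc (suc b) + 0 + 0) + (2 * r + 1) ≡ 2 * suc r + b + 2
        e = solve-∀

      cost-go : ∀ r b {t} → t ≤ 2 * r + suc b + 2 → 1 + t ≤ 2 * suc r + b + 2
      cost-go r b t≤ = ≤-trans (s≤s t≤) (≤-reflexive (e r b))
        where
        e : ∀ r b → suc (2 * r + suc b + 2) ≡ 2 * suc r + b + 2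
        e = solve-∀

      head-∈ : ∀ {y} T {U} → T ++ U ≡ L → y ∈ T → x ∈ T
      head-∈ (_ ∷ _) refl _ = here refl

      module At {before : Points} {y z : Point} {rest : Points} (eq : reverse before ++ y ∷ z ∷ rest ≡ L) where
        T U : Points
        T = reverse (y ∷ before)
        U = z ∷ rest

        T++U : T ++ U ≡ L
        T++U = trans (cong (_++ U) (unfold-reverse y before)) (trans (∷ʳ-++ (reverse before) y U) eq)

        y∈T : y ∈ T
        y∈T = subst (y ∈_) (sym (unfold-reverse y before)) (∈-++⁺ʳ (reverse before) (here refl))

        T⊆L : ∀ {u} → u ∈ T → u ∈ L
        T⊆L u∈T = subst (_ ∈_) T++U (∈-++⁺ˡ u∈T)

        U⊆L : ∀ {u} → u ∈ U → u ∈ L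
        U⊆L u∈U = subst (_ ∈_) T++U (∈-++⁺ʳ T u∈U)

        T-before-y : ∀ {u} → u ∈ T → AtOrBefore L u y
        T-before-y u∈T with ∈-++⁻ (reverse before) (subst (_ ∈_) (unfold-reverse y before) u∈T)
        ... | inj₁ u∈before    = inj₂ (subst (λ L → Before L _ y) eq (Before-++ (reverse before) u∈before (here refl)))
        ... | inj₂ (here u≡y)  = inj₁ u≡y

        U-sublist : U ⊆ L
        U-sublist = subst (U ⊆_) T++U (Subₚ.++⁺ˡ T Sub.⊆-refl)

        -- All points of the copoint are at the same distance δ from p, so those on one side are
        -- within δ of each other and those on opposite sides at least δ apart: the place where ≺
        -- changes side passes the tests.
        stop : lastOf z rest ≡ x* → sideOf p y ≡ sideOf p x → Opposite {p} x x* → sideOf p z ≢ sideOf p x →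
               d x y ≤ᵈ d p x × d z x* ≤ᵈ d p x × d p x ≤ᵈ d y z
        stop last same opp z≢x =
          same-side-bound (p≢ (here refl)) (p≢ (T⊆L y∈T)) (sym same) (p-constant (here refl) (T⊆L y∈T)) ,
          ≤ᵈ-trans
            (same-side-bound (p≢ z∈L) (p≢ x*∈L) (opposite-opposite z≢x (opp ∘ sym)) (p-constant z∈L x*∈L))
            (≤ᵈ-reflexive (p-constant z∈L (here refl))) ,
          ≤ᵈ-trans (≤ᵈ-reflexive (p-constant (here refl) (T⊆L y∈T)))
            (opposite-side-bound (p≢ (T⊆L y∈T)) (p≢ z∈L) (λ y≡z → z≢x (trans (sym y≡z) same)))
          where
          z∈L : z ∈ L
          z∈L = U⊆L (here refl)
          x*∈L : x* ∈ L
          x*∈L = U⊆L (subst (_∈ U) last (∈-lastOf z rest))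

        separated : lastOf z rest ≡ x* → Opposite {p} x x* → ¬ (d x x* ≤ᵈ d p x) →
          d x y ≤ᵈ d p x → d z x* ≤ᵈ d p x → d p x ≤ᵈ d y z →
          Separated p L ((x , T) ∷ (x* , U) ∷ [])
        separated last opp far xy≤ zx*≤ ≤yz = split
          (head-∈ T T++U y∈T) (subst (_∈ U) last (∈-lastOf z rest)) T++U
          (compact (λ u∈ → T⊆L u∈ , AtOrBefore-head (T⊆L u∈) , T-before-y u∈) xy≤)
          (compact (λ u∈ → U⊆L u∈ , AtOrBefore-⊆ U-sublist (AtOrBefore-head u∈) ,
                           subst (AtOrBefore L _) last (AtOrBefore-⊆ U-sublist (AtOrBefore-lastOf u∈))) zx*≤)
          (λ u∈ v∈ → ≤ᵈ-trans (≤ᵈ-reflexive (p-constant (T⊆L u∈) (here refl))) (≤ᵈ-trans ≤yz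
            (interval-bound′ (T-before-y u∈) y-before-z (AtOrBefore-⊆ U-sublist (AtOrBefore-head v∈)))))
          opp far
          where
          y-before-z : Before L y z
          y-before-z = subst (λ L → Before L y z) T++U (Before-++ T y∈T (here refl))
          interval-bound′ : ∀ {u v} → AtOrBefore L u y → Before L y z → AtOrBefore L z v → d y z ≤ᵈ d u v
          interval-bound′ = interval-bound

    -- The invariant keeps y on the side of x. If z were across p the tests would succeed, so a
    -- failed test puts z on the side of x too; the scan cannot run out, because x* is on the other
    -- side.
    separateAt-spec : ∀ before y ys → reverse before ++ y ∷ ys ≡ L → lastOf y ys ≡ x* →
      sideOf p y ≡ sideOf p x → Opposite {p} x x* → ¬ (d x x* ≤ᵈ d p x) →
      Yields (separateAt p x x* before y ys) λ parts t →
        Separated p L parts × t ≤ 2 * length ys + length before + 2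

    private
      continue : ∀ before y z rest → reverse before ++ y ∷ z ∷ rest ≡ L → lastOf z rest ≡ x* →
        sideOf p y ≡ sideOf p x → Opposite {p} x x* → ¬ (d x x* ≤ᵈ d p x) →
        ¬ (d x y ≤ᵈ d p x × d z x* ≤ᵈ d p x × d p x ≤ᵈ d y z) →
        Yields (separateAt p x x* (y ∷ before) z rest) λ parts t →
          Separated p L parts × 1 + t ≤ 2 * suc (length rest) + length before + 2
      continue before y z rest eq last same opp far ¬stop = yields-weaken
        (λ (sep , t≤) → sep , cost-go (length rest) (length before) t≤)
        (separateAt-spec (y ∷ before) z rest (At.T++U {before} eq) last
          (same-side-stable (¬stop ∘ At.stop {before} eq last same opp)) opp far)

    separateAt-spec before y [] eq refl same opp far = contradiction (sym same) opp
    separateAt-spec before y (z ∷ rest) eq last same opp far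
      with d x y ≤? d p x | d z x* ≤? d p x | d p x ≤? d y z
    ... | yes xy≤ | yes zx*≤ | yes ≤yz = _ , _ , refl ,
      At.separated {before} eq last opp far xy≤ zx*≤ ≤yz , cost-stop (length rest) (length before)
    ... | no ¬xy≤ | _ | _ = yields-tick {m = separateAt p x x* (y ∷ before) z rest}
      (continue before y z rest eq last same opp far (λ (xy≤ , _) → ¬xy≤ xy≤))
    ... | yes _ | no ¬zx*≤ | _ = yields-tick {m = separateAt p x x* (y ∷ before) z rest}
      (continue before y z rest eq last same opp far (λ (_ , zx*≤ , _) → ¬zx*≤ zx*≤))
    ... | yes _ | yes _ | no ¬≤yz = yields-tick {m = separateAt p x x* (y ∷ before) z rest}
      (continue before y z rest eq last same opp far (λ (_ , _ , ≤yz) → ¬≤yz ≤yz))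

    separateIfSeparable-spec : Yields (separateIfSeparable p L) λ parts t →
      Separated p L parts × t ≤ 3 * length L
    separateIfSeparable-spec with d x x* ≤? d p x
    ... | yes xx*≤ = yields-tick {m = return _} (yields-return
      (whole (here refl) (compact (λ u∈ → u∈ , AtOrBefore-head u∈ , AtOrBefore-lastOf u∈) xx*≤) ,
       ≤-trans (≤-reflexive (+-identityʳ _)) (m≤m+n (length L) _)))
    ... | no ¬xx*≤ = yields-tick {m = separateAt p x x* [] x xs} (yields-weaken
      (λ (sep , t≤) → sep , ≤-trans (+-monoʳ-≤ (length L) t≤) (≤-reflexive (e (length xs))))
      (separateAt-spec [] x xs refl refl refl
        -- Ends on the same side would be within δ of each other.
        (λ same → ¬xx*≤ (same-side-bound (p≢ (here refl)) (p≢ x*∈L) same (p-constant (here refl) x*∈L))) ¬xx*≤))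
      where
      x*∈L : x* ∈ L
      x*∈L = ∈-lastOf x xs
      e : ∀ l → suc l + (2 * l + 0 + 2) ≡ 3 * suc l
      e = solve-∀

  Represents : Point → Points → List (Block n) → Set (ℓ₁ ⊔ˡ ℓ₂)
  Represents p C part = ∃[ L ] (L ↭ C × Seriated L × Separated p L part)

-- Bipartition: the pass of one decided representative

Linked-++⁻ʳ : ∀ {R : Rel A ℓ} xs {ys} → Linked R (xs ++ ys) → Linked R ys
Linked-++⁻ʳ []       Rys = Rys
Linked-++⁻ʳ (x ∷ xs) Rxs = Linked-++⁻ʳ xs (Linked.tail Rxs)

flipSide : Side → Side
flipSide left  = right
flipSide right = left

orient : Bool → Side → Side
orient false s = s
orient true  s = flipSide s

orient-flipSide : ∀ f s → orient f (flipSide s) ≡ flipSide (orient f s)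
orient-flipSide false s     = refl
orient-flipSide true  left  = refl
orient-flipSide true  right = refl

opposite⇒flipSide : ∀ {s t} → s ≢ t → s ≡ flipSide t
opposite⇒flipSide {left}  {left}  s≢t = contradiction refl s≢t
opposite⇒flipSide {left}  {right} s≢t = refl
opposite⇒flipSide {right} {left}  s≢t = refl
opposite⇒flipSide {right} {right} s≢t = contradiction refl s≢t

flipSide-≢ : ∀ s → flipSide s ≢ s
flipSide-≢ left  ()
flipSide-≢ right ()

same : Side → Side → Bool
same left  left  = true
same right right = true
same _     _     = false

cons : (s t : Side) → A → List A → List A
cons s t x L = if same s t then x ∷ L else L

module Bipartition {V : DistanceScale a ℓ₁ ℓ₂} {n : ℕ} (X : Dissimilarity V n) (choices : Choices n)
                   {_≺_ : Rel (Fin n) 0ℓ} (≺-compatible : CompatibleOrder X _≺_) (p : Fin n)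
                   {I : Set} (pt : I → Fin n) (Upper : I → Set) where
  open Distances V
  open Dissimilarity X
  open Algorithm X choices
  open Geometry X ≺-compatible

  -- A representative with the component of the constraint graph it belongs to
  -- and whether the algorithm mirrors that component.

  record Entry : Set where
    constructor entry
    field
      item : I
      comp : ℕ
      flip : Bool

    point : Point
    point = pt item

    side : Side
    side = orient flip (sideOf p point)

  open Entry public

  SameTag : Entry → Entry → Set
  SameTag e f = comp e ≡ comp f × flip e ≡ flip f

  -- The lists L and R are recovered by replaying the decisions in order, so that the invariants can
  -- speak of one sequence of entries instead of two lists.
  pushed : Side → List Entry → Points → Points
  pushed s []      L = L
  pushed s (e ∷ E) L = pushed s E (cons s (side e) (point e) L)

  pushed-++ : ∀ s E {F L} → pushed s (E ++ F) L ≡ pushed s F (pushed s E L)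
  pushed-++ s []      = refl
  pushed-++ s (e ∷ E) = pushed-++ s E

  -- What the pass of q uses about a point x not farther from p.

  record Sees (q : Point) (x : I) : Set ℓ₁ where
    constructor sees
    field
      far   : Far p q (pt x)
      q≢    : q ≢ pt x
      ≢p    : pt x ≢ p
      upper : Upper x → d (pt x) q ≈ᵈ d p q

  -- Required of neighbours in the queue: an upper half u is directly followed by the lower half w
  -- of its copoint, which the farther point q cannot tell from p either.
  Split : Point → I → I → Set ℓ₁
  Split q u w = Upper u → d (pt w) q ≈ᵈ d p q × Opposite {p} (pt u) (pt w)

  Nested : I → I → Set
  Nested u v = Far p (pt u) (pt v) × pt u ≢ pt v

  -- With `away`, the correctness of the two comparisons in a pass: p lies between q and an opposite
  -- x, which makes x at least as far from q as p is, while an x on the side of q lies between q and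
  -- p.
  toward : ∀ {q x} → q ≢ p → Sees q x → d (pt x) q <ᵈ d p q → sideOf p (pt x) ≡ sideOf p q
  toward {q} {x} q≢p s (xq≤pq , xq≉pq) = same-side-stable λ opp →
    xq≉pq (≤ᵈ-antisym xq≤pq (≤ᵈ-trans (opposite-side-bound q≢p (Sees.≢p s) (opp ∘ sym)) (≤ᵈ-reflexive (d-sym _ _))))

  away : ∀ {q x} → q ≢ p → Sees q x → d p q <ᵈ d (pt x) q → Opposite {p} (pt x) q
  away {q} {x} q≢p s (pq≤xq , pq≉xq) same =
    pq≉xq (≤ᵈ-antisym pq≤xq (≤ᵈ-trans (≤ᵈ-reflexive (d-sym _ _))
      (toward-pivot q≢p (Sees.≢p s) (Sees.q≢ s) (Sees.far s) (sym same))))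

  -- The reason why Skipped is emptied onto the list that x does not join. Suppose y, farther out
  -- than x, shared its side. If x is closer to q than p is, all three are on one side and y lies
  -- between q and x, so it would be closer too. If x is farther, q is across p and x lies between q
  -- and y, so y would be farther too.
  skipped-opposite : ∀ {q x y} → q ≢ p → Sees q x → Sees q y → Nested y x →
    d (pt y) q ≈ᵈ d p q → ¬ (d (pt x) q ≈ᵈ d p q) → Opposite {p} (pt y) (pt x)
  skipped-opposite {q} {x} {y} q≢p sx sy (yx , y≢x) yq≈ xq≉ y~x
    with d (pt x) q <? d p q
  ... | yes xq<pq = xq≉ (≤ᵈ-antisym (proj₁ xq<pq) (begin
    d p q       ≈⟨ yq≈ ⟨
    d (pt y) q  ≈⟨ d-sym _ _ ⟩
    d q (pt y)  ≤⟨ proj₁ (nest-same q≢p (Sees.≢p sy) (Sees.q≢ sy) y≢x (Sees.far sy) yx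
                     (sym (trans y~x (toward q≢p sx xq<pq)))) ⟩
    d q (pt x)  ≈⟨ d-sym _ _ ⟩
    d (pt x) q  ∎))
    where open import Relation.Binary.Reasoning.PartialOrder (poset)
  ... | no xq≮pq = xq≉ (≤ᵈ-antisym (begin
    d (pt x) q  ≈⟨ d-sym _ _ ⟩
    d q (pt x)  ≤⟨ proj₁ (nest-opposite q≢p (Sees.≢p sy) (Sees.q≢ sx) y≢x (Sees.far sx) yx
                     (λ q~y → away q≢p sx (≮⇒≥ᵈ xq≮pq , xq≉ ∘ ≈ᵈ.sym) (trans (sym y~x) (sym q~y)))) ⟩
    d q (pt y)  ≈⟨ d-sym _ _ ⟩
    d (pt y) q  ≈⟨ yq≈ ⟩
    d p q       ∎) (≮⇒≥ᵈ xq≮pq))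
    where open import Relation.Binary.Reasoning.PartialOrder (poset)

  -- All points flushed with x are opposite to x, hence on one side. An upper half would be followed
  -- either by x, which is then equidistant, or by its opposite lower half among the flushed points;
  -- both are impossible.
  skipped-not-upper : ∀ {q} ys {x und} → Linked (Split q) (ys ++ x ∷ und) → ¬ (d (pt x) q ≈ᵈ d p q) →
    All (λ y → Opposite {p} (pt y) (pt x)) ys → All (¬_ ∘ Upper) ys
  skipped-not-upper []                                 _        _   _             = []
  skipped-not-upper (y ∷ [])      {x = x} {und = und}  (s ∷ _)  xq≉ _             = (λ up → xq≉ (proj₁ (s up))) ∷ []
  skipped-not-upper (y ∷ y′ ∷ ys)                      (s ∷ ss) xq≉ (o ∷ o′ ∷ os) =
    (λ up → proj₂ (s up) (opposite-opposite o o′)) ∷ skipped-not-upper (y′ ∷ ys) ss xq≉ (o′ ∷ os)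

  record Pass (q : Point) (zs : List I) : Set ℓ₁ where
    constructor pass
    field
      seen   : All (Sees q) zs
      nested : AllPairs Nested zs
      linked : Linked (Split q) zs

  Pass-++⁻ʳ : ∀ {q} ys {zs} → Pass q (ys ++ zs) → Pass q zs
  Pass-++⁻ʳ ys (pass seen nested linked) =
    pass (Allₚ.++⁻ʳ ys seen) (proj₂ (AllPairs-++⁻ ys nested)) (Linked-++⁻ʳ ys linked)

  module _ (leader : Entry) (q≢p : point leader ≢ p) where

    private
      q : Point
      q = point leader

    follow : I → Entry
    follow x = entry x (comp leader) (flip leader)

    record Distributed (L R : Points) (zs : List I) (result : Points × Points × Points) : Set ℓ₁ where
      constructor distributed
      field
        decided     : List Entry
        undecided   : List I
        partition   : map item decided ++ undecided ≡ zs
        result≡     : result ≡ (pushed left decided L , pushed right decided R , reverse (map pt undecided))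
        follows     : All (λ e → SameTag e leader) decided
        not-upper   : All (λ e → ¬ Upper (item e)) decided
        equidistant : All (λ y → d (pt y) q ≈ᵈ d p q) undecided

    -- Mirroring commutes with changing sides, so the test made relative to the list of q reproduces
    -- the side of x in ≺ under the flip of the leader.
    side-test : ∀ {x} → Sees q x → ¬ (d (pt x) q ≈ᵈ d p q) →
      (does (d (pt x) q <? d p q) ∧ same left (side leader)) ∨
      (does (d p q <? d (pt x) q) ∧ same right (side leader)) ≡ same left (side (follow x))
    side-test {x} s xq≉ with d (pt x) q <? d p q | d p q <? d (pt x) q
    ... | yes (≤₁ , ≉₁) | yes (≤₂ , _) = contradiction (≤ᵈ-antisym ≤₁ ≤₂) ≉₁
    ... | no ≮₁         | no ≮₂        = contradiction (≤ᵈ-antisym (≮⇒≥ᵈ ≮₂) (≮⇒≥ᵈ ≮₁)) xq≉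
    ... | yes xq<       | no _         rewrite toward q≢p s xq< with side leader
    ...   | left  = refl
    ...   | right = refl
    side-test {x} s xq≉ | no _ | yes xq>
      rewrite opposite⇒flipSide (away q≢p s xq>) | orient-flipSide (flip leader) (sideOf p q) with side leader
    ...   | left  = refl
    ...   | right = refl

    private
      follow-opposite : ∀ {x y} → Opposite {p} (pt y) (pt x) → side (follow y) ≡ flipSide (side (follow x))
      follow-opposite {x} opp = trans (cong (orient (flip leader)) (opposite⇒flipSide opp)) (orient-flipSide (flip leader) _)

      pushed-follow-same : ∀ s ys {L} → All (λ y → side (follow y) ≡ s) ys →
                           pushed s (map follow ys) L ≡ reverse (map pt ys) ++ L
      pushed-follow-same s []       []         = refl
      pushed-follow-same s (y ∷ ys) {L} (eq ∷ eqs) rewrite eq | unfold-reverse (pt y) (map pt ys) with s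
      ... | left  = trans (pushed-follow-same left  ys eqs) (sym (∷ʳ-++ (reverse (map pt ys)) (pt y) L))
      ... | right = trans (pushed-follow-same right ys eqs) (sym (∷ʳ-++ (reverse (map pt ys)) (pt y) L))

      pushed-follow-other : ∀ s ys {L} → All (λ y → side (follow y) ≡ flipSide s) ys →
                            pushed s (map follow ys) L ≡ L
      pushed-follow-other s     []       []         = refl
      pushed-follow-other left  (y ∷ ys) (eq ∷ eqs) rewrite eq = pushed-follow-other left ys eqs
      pushed-follow-other right (y ∷ ys) (eq ∷ eqs) rewrite eq = pushed-follow-other right ys eqs

      map-item-follow : ∀ ys → map item (map follow ys) ≡ ys
      map-item-follow []       = refl
      map-item-follow (y ∷ ys) = cong (y ∷_) (map-item-follow ys)

      module Flush {ys : List I} {x : I} {und : List I} (ok : Pass q (ys ++ x ∷ und))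
                   (eqd : All (λ y → d (pt y) q ≈ᵈ d p q) ys) (xq≉ : ¬ (d (pt x) q ≈ᵈ d p q)) where
        open Pass ok

        sees-x : Sees q x
        sees-x = All.lookup seen (∈-++⁺ʳ ys (here refl))

        opposite : All (λ y → Opposite {p} (pt y) (pt x)) ys
        opposite = All.tabulate λ y∈ → skipped-opposite q≢p sees-x (All.lookup seen (∈-++⁺ˡ y∈))
          (AllPairs-lookup-++ ys nested y∈ (here refl)) (All.lookup eqd y∈) xq≉

        rest-ok : Pass q und
        rest-ok = Pass-++⁻ʳ (ys ∷ʳ x) (subst (Pass q) (sym (∷ʳ-++ ys x und)) ok)

        -- The skipped points are recorded before x, as in the queue. They go to a different list
        -- than x, so this order agrees with both L and R and leaves the decided points a prefix of
        -- the queue.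
        batch : List Entry → List Entry
        batch E = map follow ys ++ follow x ∷ E

        batch-all : ∀ {ℓ} {P : Entry → Set ℓ} {E} → All (P ∘ follow) ys → P (follow x) → All P E → All P (batch E)
        batch-all Pys Px PE = Allₚ.++⁺ (Allₚ.map⁺ Pys) (Px ∷ PE)

        batch-partition : ∀ {E zs} → map item E ++ zs ≡ und → map item (batch E) ++ zs ≡ ys ++ x ∷ und
        batch-partition {E} {zs} refl = begin
          map item (map follow ys ++ follow x ∷ E) ++ zs  ≡⟨ cong (_++ zs) (map-++ item (map follow ys) _) ⟩
          (map item (map follow ys) ++ x ∷ map item E) ++ zs
            ≡⟨ cong (λ ys → (ys ++ x ∷ map item E) ++ zs) (map-item-follow ys) ⟩
          (ys ++ x ∷ map item E) ++ zs                     ≡⟨ ++-assoc ys _ zs ⟩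
          ys ++ x ∷ map item E ++ zs                       ∎
          where open ≡-Reasoning

        pushed-toward : ∀ {s E L} → side (follow x) ≡ s → pushed s (batch E) L ≡ pushed s E (pt x ∷ L)
        pushed-toward {s} {E} {L} eq = trans (pushed-++ s (map follow ys))
          (trans (cong (λ M → pushed s E (cons s (side (follow x)) (pt x) M))
                   (pushed-follow-other s ys (All.map (λ opp → trans (follow-opposite opp) (cong flipSide eq)) opposite)))
                 (cong (pushed s E) (cons-same eq)))
          where
          cons-same : ∀ {s t x} {L : Points} → t ≡ s → cons s t x L ≡ x ∷ L
          cons-same {left}  refl = refl
          cons-same {right} refl = refl

        pushed-away : ∀ {s E R} → side (follow x) ≡ flipSide s →
                      pushed s (batch E) R ≡ pushed s E (reverse (map pt ys) ++ R)
        pushed-away {s} {E} {R} eq = trans (pushed-++ s (map follow ys))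
          (trans (cong (pushed s E) (cons-flipSide eq))
                 (cong (pushed s E) (pushed-follow-same s ys
                   (All.map (λ opp → trans (follow-opposite opp) (trans (cong flipSide eq) (flipSide-involutive s))) opposite))))
          where
          cons-flipSide : ∀ {s t x} {L : Points} → t ≡ flipSide s → cons s t x L ≡ L
          cons-flipSide {left}  refl = refl
          cons-flipSide {right} refl = refl
          flipSide-involutive : ∀ s → flipSide (flipSide s) ≡ s
          flipSide-involutive left  = refl
          flipSide-involutive right = refl

        flush : ∀ {L R L₁ R₁ result} → (∀ E → pushed left (batch E) L ≡ pushed left E L₁) →
                (∀ E → pushed right (batch E) R ≡ pushed right E R₁) →
                Distributed L₁ R₁ und result → Distributed L R (ys ++ x ∷ und) result
        flush eqL eqR (distributed E zs partition result≡ follows not-upper equidistant) = distributed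
          (batch E) zs (batch-partition partition)
          (trans result≡ (cong₂ _,_ (sym (eqL E)) (cong₂ _,_ (sym (eqR E)) refl)))
          (batch-all (All.tabulate λ _ → refl , refl) (refl , refl) follows)
          (batch-all (skipped-not-upper ys linked xq≉ opposite) (xq≉ ∘ Sees.upper sees-x) not-upper)
          equidistant

        flush-cost : ∀ {t} → t ≤ 2 * length und + 0 →
                     1 + (suc (length (reverse (map pt ys))) + t) ≤ 2 * suc (length und) + length ys
        flush-cost t≤ rewrite length-reverse (map pt ys) | length-map pt ys =
          ≤-trans (+-monoʳ-≤ (2 + length ys) t≤) (≤-reflexive (e (length ys) (length und)))
          where
          e : ∀ y u → 2 + y + (2 * u + 0) ≡ 2 * suc u + y
          e = solve-∀

    -- A skipped point pays one step when met and one when copied out of Skipped, a deciding point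
    -- one for the test and one for starting the copy. The term `length ys` is the second payment of
    -- those currently skipped.
    distribute-spec : ∀ L R ys und → Pass q (ys ++ und) → All (λ y → d (pt y) q ≈ᵈ d p q) ys →
      Yields (distribute p q (same left (side leader)) (same right (side leader)) L R
                         (reverse (map pt ys)) (map pt und)) λ result t →
        Distributed L R (ys ++ und) result × t ≤ 2 * length und + length ys
    distribute-spec L R ys [] ok eqd =
      yields-return (distributed [] ys (sym (++-identityʳ ys)) refl [] [] eqd , z≤n)
    distribute-spec L R ys (x ∷ und) ok eqd = yields-tick {s = 1} (yields-if-dec (d (pt x) q ≈? d p q)
      (λ xq≈ → subst
        (λ Sk → Yields (distribute p q inˡ inʳ L R Sk (map pt und)) λ result t →
          Distributed L R (ys ++ x ∷ und) result × 1 + t ≤ 2 * suc (length und) + length ys)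
        (trans (cong reverse (map-++ pt ys (x ∷ []))) (reverse-++ (map pt ys) (pt x ∷ [])))
        (yields-weaken
          (λ (dist , t≤) → subst (λ zs → Distributed L R zs _) (∷ʳ-++ ys x und) dist , skip-cost t≤)
          (distribute-spec L R (ys ∷ʳ x) und (subst (Pass q) (sym (∷ʳ-++ ys x und)) ok) (Allₚ.∷ʳ⁺ eqd xq≈))))
      (λ xq≉ → let open Flush {ys} ok eqd xq≉ in yields-if _
        (λ b≡true → let eq = same-true (trans (sym (side-test sees-x xq≉)) b≡true) in
          yields-bind {f = λ R′ → distribute p q inˡ inʳ (pt x ∷ L) R′ [] (map pt und)} (yields-++ (reverse (map pt ys)) R) λ where
            (refl , refl) → yields-weaken
              (λ (dist , t≤) → flush (λ E → pushed-toward {E = E} eq) (λ E → pushed-away {E = E} eq) dist , flush-cost t≤)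
              (distribute-spec _ _ [] und rest-ok []))
        (λ b≡false → let eq = same-false (trans (sym (side-test sees-x xq≉)) b≡false) in
          yields-bind {f = λ L′ → distribute p q inˡ inʳ L′ (pt x ∷ R) [] (map pt und)} (yields-++ (reverse (map pt ys)) L) λ where
            (refl , refl) → yields-weaken
              (λ (dist , t≤) → flush (λ E → pushed-away {E = E} eq) (λ E → pushed-toward {E = E} eq) dist , flush-cost t≤)
              (distribute-spec _ _ [] und rest-ok []))))
      where
      inˡ = same left (side leader)
      inʳ = same right (side leader)
      same-true : ∀ {s} → same left s ≡ true → s ≡ left
      same-true {left} _ = refl
      same-false : ∀ {s} → same left s ≡ false → s ≡ right
      same-false {right} _ = refl
      skip-cost : ∀ {t} → t ≤ 2 * length und + length (ys ∷ʳ x) → 1 + t ≤ 2 * suc (length und) + length ys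
      skip-cost t≤ rewrite length-++ ys {x ∷ []} = ≤-trans (s≤s t≤) (≤-reflexive (e (length ys) (length und)))
        where
        e : ∀ y u → suc (2 * u + (y + 1)) ≡ 2 * suc u + y
        e = solve-∀

  data Queue : List I → Set ℓ₁ where
    []  : Queue []
    _∷_ : ∀ {x zs} → pt x ≢ p × Pass (pt x) zs → Queue zs → Queue (x ∷ zs)

  Distinct : I → I → Set
  Distinct x y = pt x ≢ pt y

  Queue-distinct : ∀ {zs} → Queue zs → AllPairs Distinct zs
  Queue-distinct []                   = []
  Queue-distinct ((_ , ok) ∷ queue) = All.map Sees.q≢ (Pass.seen ok) ∷ Queue-distinct queue

  pick : Points → Points → Side → Points
  pick L R left  = L
  pick L R right = R

  Absent : Points → Points → Point → Set
  Absent L R x = ∀ s → x ∉ pick L R s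

  record Placed (L R : Points) (e : Entry) : Set where
    constructor placed
    field
      inside  : ∀ s → side e ≡ s → point e ∈ pick L R s
      outside : ∀ s → side e ≢ s → point e ∉ pick L R s

  module _ {L R : Points} {E : List Entry} where

    private
      L₁ = pushed left E L
      R₁ = pushed right E R

      pick-pushed : ∀ s → pick L₁ R₁ s ≡ pushed s E (pick L R s)
      pick-pushed left  = refl
      pick-pushed right = refl

    length-pushed : length L₁ + length R₁ ≡ length L + length R + length E
    length-pushed = go E L R
      where
      go : ∀ E L R → length (pushed left E L) + length (pushed right E R) ≡ length L + length R + length E
      go []      L R = sym (+-identityʳ _)
      go (e ∷ E) L R with side e
      ... | left  = trans (go E _ R) (sym (+-suc _ (length E)))
      ... | right = trans (go E L _) (trans (cong (_+ length E) (+-suc (length L) (length R))) (sym (+-suc _ (length E))))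

    private
      ∈-cons⁺ : ∀ s t {x y : Point} {L} → x ∈ L → x ∈ cons s t y L
      ∈-cons⁺ s t x∈L with same s t
      ... | true  = there x∈L
      ... | false = x∈L

      ∈-cons-same : ∀ {s t} {x : Point} {L} → t ≡ s → x ∈ cons s t x L
      ∈-cons-same {left}  refl = here refl
      ∈-cons-same {right} refl = here refl

      ∈-cons⁻ : ∀ s t {x y : Point} {L} → x ∈ cons s t y L → x ∈ L ⊎ (t ≡ s × y ≡ x)
      ∈-cons⁻ left  left  (here refl) = inj₂ (refl , refl)
      ∈-cons⁻ left  left  (there x∈)  = inj₁ x∈
      ∈-cons⁻ left  right x∈          = inj₁ x∈
      ∈-cons⁻ right left  x∈          = inj₁ x∈
      ∈-cons⁻ right right (here refl) = inj₂ (refl , refl)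
      ∈-cons⁻ right right (there x∈)  = inj₁ x∈

      ∈-pushed⁺ : ∀ s E {L x} → x ∈ L → x ∈ pushed s E L
      ∈-pushed⁺ s []      x∈L = x∈L
      ∈-pushed⁺ s (e ∷ E) x∈L = ∈-pushed⁺ s E (∈-cons⁺ s (side e) x∈L)

      ∈-pushed-entry : ∀ s E {L e} → e ∈ E → side e ≡ s → point e ∈ pushed s E L
      ∈-pushed-entry s (e ∷ E) (here refl) eq = ∈-pushed⁺ s E (∈-cons-same eq)
      ∈-pushed-entry s (_ ∷ E) (there e∈E) eq = ∈-pushed-entry s E e∈E eq

      ∈-pushed⁻ : ∀ s E {L x} → x ∈ pushed s E L → x ∈ L ⊎ (∃[ e ] (e ∈ E × side e ≡ s × point e ≡ x))
      ∈-pushed⁻ s []      x∈ = inj₁ x∈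
      ∈-pushed⁻ s (e ∷ E) x∈ with ∈-pushed⁻ s E x∈
      ... | inj₂ (f , f∈E , found) = inj₂ (f , there f∈E , found)
      ... | inj₁ x∈cons with ∈-cons⁻ s (side e) x∈cons
      ...   | inj₁ x∈L   = inj₁ x∈L
      ...   | inj₂ found = inj₂ (e , here refl , found)

      distinct⇒≡ : ∀ {E} → AllPairs Distinct (map item E) → ∀ {e f} → e ∈ E → f ∈ E → point e ≡ point f → e ≡ f
      distinct⇒≡ _         (here refl) (here refl) _  = refl
      distinct⇒≡ (≢es ∷ _) (here refl) (there f∈)  eq = contradiction eq (All.lookup (Allₚ.map⁻ ≢es) f∈)
      distinct⇒≡ (≢es ∷ _) (there e∈)  (here refl) eq = contradiction (sym eq) (All.lookup (Allₚ.map⁻ ≢es) e∈)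
      distinct⇒≡ (_ ∷ ds)  (there e∈)  (there f∈)  eq = distinct⇒≡ ds e∈ f∈ eq

    placed-keep : ∀ {e} → All (λ x → pt x ≢ point e) (map item E) → Placed L R e → Placed L₁ R₁ e
    placed-keep {e} ≢e (placed inside outside) = placed
      (λ s eq → subst (point e ∈_) (sym (pick-pushed s)) (∈-pushed⁺ s E (inside s eq)))
      (λ s neq e∈ → [ outside s neq , (λ (f , f∈E , _ , eq) → All.lookup (Allₚ.map⁻ ≢e) f∈E eq) ]′
                      (∈-pushed⁻ s E (subst (point e ∈_) (pick-pushed s) e∈)))

    placed-new : AllPairs Distinct (map item E) → All (Absent L R ∘ pt) (map item E) → All (Placed L₁ R₁) E
    placed-new distinct absent = All.tabulate λ {e} e∈E → placed
      (λ s eq → subst (point e ∈_) (sym (pick-pushed s)) (∈-pushed-entry s E e∈E eq))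
      (λ s neq e∈ → [ All.lookup (Allₚ.map⁻ absent) e∈E s
                    , (λ (f , f∈E , side≡s , eq) → neq (subst (λ e → side e ≡ s) (distinct⇒≡ distinct f∈E e∈E eq) side≡s)) ]′
                      (∈-pushed⁻ s E (subst (point e ∈_) (pick-pushed s) e∈)))

    absent-keep : ∀ {x} → All (λ y → pt y ≢ x) (map item E) → Absent L R x → Absent L₁ R₁ x
    absent-keep {x} ≢x absent s x∈ = [ absent s , (λ (f , f∈E , _ , eq) → All.lookup (Allₚ.map⁻ ≢x) f∈E eq) ]′
      (∈-pushed⁻ s E (subst (x ∈_) (pick-pushed s) x∈))

  -- d x u = d p u: u does not constrain the side of x.

  Loose : Entry → I → Set ℓ₁
  Loose u x = d (pt x) (point u) ≈ᵈ d p (point u)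

  -- For u recorded before v. A new component is opened only by an arbitrary choice, at a moment
  -- when no processed point constrains the remaining ones; `Loose` preserves this fact.
  TagRel : Entry → Entry → Set ℓ₁
  TagRel u v = SameTag u v ⊎ (comp u < comp v × Loose u (item v))

  -- The points of Done have been processed, those of Todo only placed.

  record State (Done Todo : List Entry) (und : List I) (L R : Points) (c : ℕ) (f : Bool) : Set ℓ₁ where
    constructor state
    field
      queue   : Queue (map item Todo ++ und)
      tags    : AllPairs TagRel (Done ++ Todo)
      done    : All (λ u → ((comp u ≡ c × flip u ≡ f) ⊎ comp u < c) × All (Loose u) und) Done
      todo    : All (λ e → comp e ≡ c × flip e ≡ f) Todo
      located : All (Placed L R) Todo
      absent  : All (Absent L R ∘ pt) und

-- Bipartition: the whole run and the shape of its output

module BipartitionRun {V : DistanceScale a ℓ₁ ℓ₂} {n : ℕ} (X : Dissimilarity V n) (choices : Choices n)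
                      {_≺_ : Rel (Fin n) 0ℓ} (≺-compatible : CompatibleOrder X _≺_) (p : Fin n)
                      {I : Set} (pt : I → Fin n) (Upper : I → Set) (sideAt : Fin n → Side) where
  open Distances V
  open Dissimilarity X
  open Algorithm X choices
  open Geometry X ≺-compatible
  open Bipartition X choices ≺-compatible p pt Upper
  open DecMembership (_≟_ {n}) using (_∈?_)

  UpperRight : Entry → Set
  UpperRight e = Upper (item e) → side e ≡ right

  record Decided (Done Todo : List Entry) (und : List I) (L R : Points) (q : Point) (qs : Points) : Set ℓ₁ where
    constructor decided
    field
      leader      : Entry
      todo′       : List Entry
      early       : List Entry
      und′        : List I
      {comp′}     : ℕ
      {flip′}     : Bool
      point≡      : point leader ≡ q
      partition   : map item early ++ und′ ≡ und
      result≡     : decide (sideAt q) q L R (map pt und) ≡ (pushed left early L , pushed right early R , map pt und′)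
      early≡      : Todo ++ early ≡ leader ∷ todo′
      queue≡      : qs ≡ map point todo′ ++ map pt und′
      state′      : State Done (leader ∷ todo′) und′ (pushed left early L) (pushed right early R) comp′ flip′
      upper-right : All UpperRight early

  private
    flipFor : Side → Side → Bool
    flipFor left  left  = false
    flipFor left  right = true
    flipFor right left  = true
    flipFor right right = false

    orient-flipFor : ∀ s t → orient (flipFor s t) t ≡ s
    orient-flipFor left  left  = refl
    orient-flipFor left  right = refl
    orient-flipFor right left  = refl
    orient-flipFor right right = refl

    decide-∉ : ∀ s {q L R U} → q ∉ U → decide s q L R U ≡ (L , R , U)
    decide-∉ s {q} {U = U} q∉U with does (q ∈? U) | dec-false (q ∈? U) q∉U
    ... | _ | refl = refl

    filter-≢ : ∀ {q : Point} {U} → All (_≢ q) U → filter (λ x → ¬? (x ≟ q)) (q ∷ U) ≡ U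
    filter-≢ {q} ≢q =
      trans (filter-reject (λ x → ¬? (x ≟ q)) (λ q≢q → q≢q refl)) (filter-all (λ x → ¬? (x ≟ q)) ≢q)

    decide-∈ : ∀ s {q L R U} → All (_≢ q) U → decide s q L R (q ∷ U) ≡ (cons left s q L , cons right s q R , U)
    decide-∈ s {q} {L} {R} {U} ≢q with does (q ∈? (q ∷ U)) | dec-true (q ∈? (q ∷ U)) (here refl) | s
    ... | _ | refl | left  = cong (λ U → q ∷ L , R , U) (filter-≢ ≢q)
    ... | _ | refl | right = cong (λ U → L , q ∷ R , U) (filter-≢ ≢q)

  -- The decided points form a prefix of what remains to be processed, since a decision flushes
  -- everything skipped before it. Hence q is undecided only if no placed point is waiting. All
  -- decided points are then processed and loose, and q starts a fresh component whose flip is set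
  -- to match the choice.
  decide-spec : ∀ {Done Todo und L R c f q qs} → q ∷ qs ≡ map point Todo ++ map pt und →
    All (λ x → Upper x → sideAt (pt x) ≡ right) und →
    State Done Todo und L R c f → Decided Done Todo und L R q qs
  decide-spec {Todo = e ∷ Todo} {und} {L} {R} refl upper st = decided e Todo [] und refl refl
    (decide-∉ (sideAt (point e)) λ q∈ → let x , x∈ , q≡ = ∈-map⁻ pt q∈ in
      Sees.q≢ (All.lookup (Allₚ.++⁻ʳ (map item Todo) (Pass.seen (head-pass (State.queue st)))) x∈) q≡)
    (++-identityʳ _) refl st []
    where
    head-pass : ∀ {x zs} → Queue (x ∷ zs) → Pass (pt x) zs
    head-pass ((_ , ok) ∷ _) = ok
  decide-spec {Done} {[]} {x ∷ und} {L} {R} {c} {f} refl (upper ∷ _)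
              (state queue tags done todo located (absent ∷ absents)) = decided e [] (e ∷ []) und refl refl result refl refl
    (state queue (AllPairsₚ.++⁺ (subst (AllPairs TagRel) (++-identityʳ Done) tags) ([] ∷ []) (All.map older done))
      (All.map (λ {u} (tag , loose) → inj₂ (≤c {u} tag) , All.tail loose) done)
      ((refl , refl) ∷ [])
      (placed-new ([] ∷ []) (absent ∷ []))
      (All.zipWith (λ (x≢ , absent) → absent-keep {E = e ∷ []} (x≢ ∷ []) absent)
        (AllPairs.head (Queue-distinct queue) , absents)))
    ((λ up → trans side≡ (upper up)) ∷ [])
    where
    s = sideAt (pt x)
    e = entry x (suc c) (flipFor s (sideOf p (pt x)))
    side≡ : side e ≡ s
    side≡ = orient-flipFor s _
    ≤c : ∀ {u} → (comp u ≡ c × flip u ≡ f) ⊎ comp u < c → comp u < suc c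
    ≤c (inj₁ (refl , _)) = ≤-refl
    ≤c (inj₂ <c)         = m<n⇒m<1+n <c
    older : ∀ {u} → ((comp u ≡ c × flip u ≡ f) ⊎ comp u < c) × All (Loose u) (x ∷ und) → All (TagRel u) (e ∷ [])
    older {u} (tag , loose ∷ _) = inj₂ (≤c {u} tag , loose) ∷ []
    result : decide s (pt x) L R (pt x ∷ map pt und) ≡ (pushed left (e ∷ []) L , pushed right (e ∷ []) R , map pt und)
    result rewrite side≡ = decide-∈ s (Allₚ.map⁺ (All.map (λ x≢y y≡x → x≢y (sym y≡x)) (AllPairs.head (Queue-distinct queue))))

  record Arranged (Done Todo : List Entry) (und : List I) (L R : Points) (result : Points × Points) : Set ℓ₁ where
    constructor arranged
    field
      entries     : List Entry
      partition   : map item entries ≡ und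
      result≡     : result ≡ (pushed left entries L , pushed right entries R)
      tags        : AllPairs TagRel (Done ++ Todo ++ entries)
      upper-right : All UpperRight entries

  private
    same-placed : ∀ {L R e} s → Placed L R e → does (point e ∈? pick L R s) ≡ same s (side e)
    same-placed {L} {R} {e} left  (placed inside outside) with side e
    ... | left  = dec-true  (point e ∈? L) (inside left refl)
    ... | right = dec-false (point e ∈? L) (outside left λ ())
    same-placed {L} {R} {e} right (placed inside outside) with side e
    ... | left  = dec-false (point e ∈? R) (outside right λ ())
    ... | right = dec-true  (point e ∈? R) (inside right refl)

    -- A processed point in the component of the leader shares its tags with the followers; one in
    -- an older component was loose to them while they were still undecided.
    advance : ∀ {Done leader Todo und E zs L R c f} → State Done (leader ∷ Todo) und L R c f →
      map item E ++ zs ≡ und → All (λ e → SameTag e leader) E →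
      All (λ y → d (pt y) (point leader) ≈ᵈ d p (point leader)) zs →
      State (Done ∷ʳ leader) (Todo ++ E) zs (pushed left E L) (pushed right E R) c f
    advance {Done} {leader} {Todo} {E = E} {zs} {L} {R} {c} {f}
            (state (_ ∷ queue) tags done ((refl , refl) ∷ todo) (_ ∷ located) absent)
            refl follows eqd = state
      (subst Queue (sym regroup) queue)
      (subst (AllPairs TagRel) (sym retag) (AllPairsₚ.++⁺ tags same-tags
        (Allₚ.++⁺ (All.map past done) ((follow-all (refl , refl)) ∷ All.map follow-all todo))))
      (Allₚ.∷ʳ⁺ (All.map (λ (tag , loose) → tag , Allₚ.++⁻ʳ (map item E) loose) done) (inj₁ (refl , refl) , eqd))
      (Allₚ.++⁺ todo follows)
      (Allₚ.++⁺ (All.zipWith (λ (≢E , loc) → placed-keep ≢E loc) (old-new , located))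
                (placed-new E-distinct (Allₚ.++⁻ˡ (map item E) absent)))
      (All.zipWith (λ (≢E , abs) → absent-keep ≢E abs) (new-old , Allₚ.++⁻ʳ (map item E) absent))
      where
      regroup : map item (Todo ++ E) ++ zs ≡ map item Todo ++ map item E ++ zs
      regroup = trans (cong (_++ zs) (map-++ item Todo E)) (++-assoc (map item Todo) (map item E) zs)
      retag : (Done ∷ʳ leader) ++ Todo ++ E ≡ (Done ++ leader ∷ Todo) ++ E
      retag = trans (∷ʳ-++ Done leader (Todo ++ E)) (sym (++-assoc Done (leader ∷ Todo) E))
      same-tags : AllPairs TagRel E
      same-tags = go follows
        where
        go : ∀ {E} → All (λ e → SameTag e leader) E → AllPairs TagRel E
        go []                   = []
        go ((eq , eq′) ∷ tags) =
          All.map (λ (eq″ , eq‴) → inj₁ (trans eq (sym eq″) , trans eq′ (sym eq‴))) tags ∷ go tags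
      follow-all : ∀ {u} → SameTag u leader → All (TagRel u) E
      follow-all (eq , eq′) = All.map (λ (eq″ , eq‴) → inj₁ (trans eq (sym eq″) , trans eq′ (sym eq‴))) follows
      past : ∀ {u} → (SameTag u leader ⊎ comp u < comp leader) × All (Loose u) (map item E ++ zs) → All (TagRel u) E
      past     (inj₁ tag , _)     = follow-all tag
      past {u} (inj₂ <c , loose) = All.zipWith (λ ((eq , _) , loose) → inj₂ (subst (comp u <_) (sym eq) <c , loose))
        (follows , Allₚ.map⁻ (Allₚ.++⁻ˡ (map item E) loose))
      distinct : AllPairs Distinct (map item Todo ++ map item E ++ zs)
      distinct = Queue-distinct queue
      E-distinct : AllPairs Distinct (map item E)
      E-distinct = proj₁ (AllPairs-++⁻ (map item E) (proj₂ (AllPairs-++⁻ (map item Todo) distinct)))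
      old-new : All (λ e → All (λ x → pt x ≢ point e) (map item E)) Todo
      old-new = Allₚ.map⁻ (All.tabulate λ y∈ → All.tabulate λ x∈ eq →
        AllPairs-lookup-++ (map item Todo) distinct y∈ (∈-++⁺ˡ x∈) (sym eq))
      new-old : All (λ x → All (λ y → pt y ≢ pt x) (map item E)) zs
      new-old = All.tabulate λ x∈ → All.tabulate λ y∈ →
        AllPairs-lookup-++ (map item E) (proj₂ (AllPairs-++⁻ (map item Todo) distinct)) y∈ x∈

    assemble : ∀ {Done Todo und L R leader todo′ early und′ E zs result} →
      map item early ++ und′ ≡ und → Todo ++ early ≡ leader ∷ todo′ → All UpperRight early →
      map item E ++ zs ≡ und′ → All (λ e → ¬ Upper (item e)) E →
      Arranged (Done ∷ʳ leader) (todo′ ++ E) zs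
        (pushed left E (pushed left early L)) (pushed right E (pushed right early R)) result →
      Arranged Done Todo und L R result
    assemble {Done} {Todo} {L = L} {R} {leader} {todo′} {early} {E = E} refl early≡ ur refl nu
             (arranged F refl result≡ tags ur′) = arranged
      (early ++ E ++ F)
      (trans (map-++ item early (E ++ F)) (cong (map item early ++_) (map-++ item E F)))
      (trans result≡ (cong₂ _,_ (sym (push left)) (sym (push right))))
      (subst (AllPairs TagRel) regroup tags)
      (Allₚ.++⁺ ur (Allₚ.++⁺ (All.map (λ ¬up up → contradiction up ¬up) nu) ur′))
      where
      push : ∀ s {L} → pushed s (early ++ E ++ F) L ≡ pushed s F (pushed s E (pushed s early L))
      push s = trans (pushed-++ s early) (pushed-++ s E)
      open ≡-Reasoning
      regroup : (Done ∷ʳ leader) ++ (todo′ ++ E) ++ F ≡ Done ++ Todo ++ early ++ E ++ F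
      regroup = begin
        (Done ∷ʳ leader) ++ (todo′ ++ E) ++ F   ≡⟨ ∷ʳ-++ Done leader _ ⟩
        Done ++ leader ∷ (todo′ ++ E) ++ F      ≡⟨ cong (λ M → Done ++ leader ∷ M) (++-assoc todo′ E F) ⟩
        Done ++ (leader ∷ todo′) ++ E ++ F      ≡⟨ cong (λ M → Done ++ M ++ E ++ F) early≡ ⟨
        Done ++ (Todo ++ early) ++ E ++ F       ≡⟨ cong (Done ++_) (++-assoc Todo early _) ⟩
        Done ++ Todo ++ early ++ E ++ F         ∎

    -- One pass takes N + 1 for removing q from Undecided, N for finding its list, 2·N for
    -- distributing and N + 1 for the final reversal.
    pass-cost : ∀ N {u l t z k r} → u ≤ N → l ≤ N → t ≤ 2 * N → z ≤ N → r ≤ k * (5 * N + 2) →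
                suc u + (l + (t + (suc z + r))) ≤ suc k * (5 * N + 2)
    pass-cost N {k = k} u≤ l≤ t≤ z≤ r≤ =
      ≤-trans (+-mono-≤ (s≤s u≤) (+-mono-≤ l≤ (+-mono-≤ t≤ (+-mono-≤ (s≤s z≤) r≤)))) (≤-reflexive (e N (k * (5 * N + 2))))
      where
      e : ∀ N x → suc N + (N + (2 * N + (suc N + x))) ≡ 5 * N + 2 + x
      e = solve-∀

    points : ∀ E → map pt (map item E) ≡ map point E
    points []      = refl
    points (e ∷ E) = cong (point e ∷_) (points E)

    requeue : ∀ {qs todo und} E {zs} → qs ≡ map point todo ++ map pt und → map item E ++ zs ≡ und →
              qs ≡ map point (todo ++ E) ++ map pt zs
    requeue {todo = todo} E {zs} refl refl = begin
      map point todo ++ map pt (map item E ++ zs)              ≡⟨ cong (map point todo ++_) (map-++ pt (map item E) zs) ⟩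
      map point todo ++ map pt (map item E) ++ map pt zs       ≡⟨ cong (λ M → map point todo ++ M ++ map pt zs) (points E) ⟩
      map point todo ++ map point E ++ map pt zs               ≡⟨ ++-assoc (map point todo) (map point E) (map pt zs) ⟨
      (map point todo ++ map point E) ++ map pt zs             ≡⟨ cong (_++ map pt zs) (map-++ point todo E) ⟨
      map point (todo ++ E) ++ map pt zs                       ∎
      where open ≡-Reasoning

    size-pushed : ∀ {L R und N} E {zs} → map item E ++ zs ≡ und → length L + length R + length und ≡ N →
                  length (pushed left E L) + length (pushed right E R) + length zs ≡ N
    size-pushed {L} {R} E {zs} refl refl = begin
      length (pushed left E L) + length (pushed right E R) + length zs
        ≡⟨ cong (_+ length zs) (length-pushed {L} {R} {E}) ⟩
      length L + length R + length E + length zs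
        ≡⟨ +-assoc (length L + length R) (length E) (length zs) ⟩
      length L + length R + (length E + length zs)
        ≡⟨ cong (λ k → length L + length R + (k + length zs)) (length-map item E) ⟨
      length L + length R + (length (map item E) + length zs)
        ≡⟨ cong (length L + length R +_) (length-++ (map item E)) ⟨
      length L + length R + length (map item E ++ zs) ∎
      where open ≡-Reasoning

    und≤ : ∀ {k N} (xs : List I) → k + length xs ≡ N → length (map pt xs) ≤ N
    und≤ {k} xs refl rewrite length-map pt xs = m≤n+m (length xs) k

    head-queue : ∀ {x} zs {ys} → Queue (x ∷ zs ++ ys) → pt x ≢ p × Pass (pt x) ys
    head-queue zs ((x≢p , ok) ∷ _) = x≢p , Pass-++⁻ʳ zs ok

  bipartition-spec : ∀ qs {Done Todo und L R c f N} → qs ≡ map point Todo ++ map pt und →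
    All (λ x → Upper x → sideAt (pt x) ≡ right) und → State Done Todo und L R c f →
    length L + length R + length und ≡ N →
    Yields (bipartition p sideAt L R (map pt und) qs) λ result t →
      Arranged Done Todo und L R result × t ≤ length qs * (5 * N + 2)
  bipartition-spec [] {Todo = []} {[]} refl upper st size =
    yields-return (arranged [] refl refl (State.tags st) [] , z≤n)
  bipartition-spec (q ∷ qs) {Done} {Todo} {und} {L} {R} {c} {f} {N} eq upper st size with decide-spec eq upper st
  ... | decided leader todo′ early und′ refl part result≡ early≡ queue≡ state′ ur
    with decide (sideAt (point leader)) (point leader) L R (map pt und) | result≡
  ...   | _ | refl = yields-tick {s = suc (length (map pt und))} (yields-tick {s = length L₁ + length R₁}
    (yields-bind
      (subst₂ (λ b b′ → Yields (distribute p (point leader) b b′ L₁ R₁ [] (map pt und′)) λ result t →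
                          Distributed leader (proj₁ leader-queue) L₁ R₁ und′ result × t ≤ 2 * length und′ + 0)
        (sym (same-placed left (All.head (State.located state′))))
        (sym (same-placed right (All.head (State.located state′))))
        (distribute-spec leader (proj₁ leader-queue) L₁ R₁ [] und′ (proj₂ leader-queue) []))
      λ { {s = s} (distributed E zs part′ refl follows nu eqd , t≤) → yields-bind
          {f = λ U → bipartition p sideAt (pushed left E L₁) (pushed right E R₁) U qs}
          (yields-reverse (reverse (map pt zs))) λ where
            (refl , refl) → subst (λ U → Yields (bipartition p sideAt (pushed left E L₁) (pushed right E R₁) U qs) λ result t →
                Arranged Done Todo und L R result ×
                suc (length (map pt und)) + (length L₁ + length R₁ + (s + (suc (length (reverse (map pt zs))) + t)))
                  ≤ suc (length qs) * (5 * N + 2))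
              (sym (reverse-involutive (map pt zs)))
              (yields-weaken (λ (arr , r≤) → assemble part early≡ ur part′ nu arr ,
                  pass-cost N {k = length qs} (und≤ und size) (m+n≤o⇒m≤o (length L₁ + length R₁) (≤-reflexive size₁))
                    (≤-trans t≤ (≤-trans (≤-reflexive (+-identityʳ _))
                      (*-monoʳ-≤ 2 (m+n≤o⇒n≤o (length L₁ + length R₁) (≤-reflexive size₁)))))
                    (≤-trans (≤-reflexive (length-reverse (map pt zs))) (und≤ zs (size-pushed {L₁} {R₁} E part′ size₁))) r≤)
                (bipartition-spec qs {Done ∷ʳ leader} {todo′ ++ E} {zs} {N = N} (requeue E queue≡ part′)
                  (Allₚ.++⁻ʳ (map item E) (subst (All _) (sym part′)
                    (Allₚ.++⁻ʳ (map item early) (subst (All _) (sym part) upper))))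
                  (advance state′ part′ follows eqd) (size-pushed {L₁} {R₁} E part′ size₁))) }))
    where
    L₁ = pushed left early L
    R₁ = pushed right early R
    leader-queue : point leader ≢ p × Pass (point leader) und′
    leader-queue = head-queue (map item todo′) (State.queue state′)
    size₁ : length L₁ + length R₁ + length und′ ≡ N
    size₁ = size-pushed {L} {R} early part size

  place : Side → Entry → List Entry → List Entry
  place left  e A = e ∷ A
  place right e A = A ∷ʳ e

  -- In an arrangement the farther of two entries is the outer one.

  Outer : Rel Entry ℓ → Rel Entry ℓ
  Outer Q e f = (Q e f × side e ≡ left) ⊎ (Q f e × side f ≡ right)

  module Arrangement (e₀ : Entry) where

    -- The output built from the inside: around the pivot entry `e₀`, every decision wraps all later
    -- ones on its own side.
    arrangement : List Entry → List Entry
    arrangement []      = e₀ ∷ []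
    arrangement (e ∷ E) = place (side e) e (arrangement E)

    arrangement-↭ : ∀ E → arrangement E ↭ e₀ ∷ E
    arrangement-↭ []      = ↭-refl
    arrangement-↭ (e ∷ E) with side e
    ... | left  = ↭-trans (prep e (arrangement-↭ E)) (_↭_.swap e e₀ ↭-refl)
    ... | right = ↭-trans (↭-sym (Perm.∷↭∷ʳ e (arrangement E)))
                    (↭-trans (prep e (arrangement-↭ E)) (_↭_.swap e e₀ ↭-refl))

    arrangement-outer : ∀ {Q : Rel Entry ℓ} {E} → AllPairs Q E → All (λ e → Q e e₀) E →
                        AllPairs (Outer Q) (arrangement E)
    arrangement-outer []                     []             = [] ∷ []
    arrangement-outer {E = e ∷ E} (Qe ∷ QE) (Qee₀ ∷ QEe₀)
      with Perm.All-resp-↭ (↭-sym (arrangement-↭ E)) (Qee₀ ∷ Qe) | side e in eq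
    ... | Qe-all | left  = All.map (λ Qef → inj₁ (Qef , eq)) Qe-all ∷ arrangement-outer QE QEe₀
    ... | Qe-all | right = AllPairsₚ.++⁺ (arrangement-outer QE QEe₀) ([] ∷ [])
                             (All.map (λ Qef → inj₂ (Qef , eq) ∷ []) Qe-all)

    arrangement-points : point e₀ ≡ p → ∀ E {L R} →
      reverse (pushed left E L) ++ p ∷ pushed right E R ≡ reverse L ++ map point (arrangement E) ++ R
    arrangement-points eq []      {L} {R} = cong (λ x → reverse L ++ x ∷ R) (sym eq)
    arrangement-points eq (e ∷ E) {L} {R} with side e
    ... | left  = trans (arrangement-points eq E {point e ∷ L} {R})
      (trans (cong (_++ map point (arrangement E) ++ R) (unfold-reverse (point e) L)) (∷ʳ-++ (reverse L) (point e) _))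
    ... | right = trans (arrangement-points eq E {L} {point e ∷ R})
      (cong (reverse L ++_) (trans (sym (∷ʳ-++ (map point (arrangement E)) (point e) R))
                                   (cong (_++ R) (sym (map-++ point (arrangement E) (e ∷ []))))))

  -- The pivot entry stays open here: its component number is to exceed those of all entries and can
  -- be chosen only once they are known.
  record Sorted (G : List I) (O : Points) : Set ℓ₁ where
    constructor sorted
    field
      entries     : List Entry
      partition   : map item entries ≡ G
      points≡     : ∀ e₀ → point e₀ ≡ p → O ≡ map point (Arrangement.arrangement e₀ entries)
      tags        : AllPairs TagRel entries
      upper-right : All UpperRight entries

  sortByBipartition-spec : ∀ G → Queue G → All (λ x → Upper x → sideAt (pt x) ≡ right) G →
    Yields (sortByBipartition p sideAt (reverse (map pt G))) λ O t →
      Sorted G O × t ≤ 5 * (length G * length G) + 5 * length G + 6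
  sortByBipartition-spec G queue upper = yields-bind
    {f = λ Y′ → bipartition p sideAt [] [] Y′ Y′ >>= λ LR →
                reverseᵗ (proj₁ LR) >>= λ L′ → concatenate (L′ ∷ (p ∷ []) ∷ proj₂ LR ∷ [])}
    (yields-reverse (reverse (map pt G))) λ where
      (refl , refl) → subst (λ Y′ → Yields (bipartition p sideAt [] [] Y′ Y′ >>= λ LR →
                reverseᵗ (proj₁ LR) >>= λ L′ → concatenate (L′ ∷ (p ∷ []) ∷ proj₂ LR ∷ []))
                λ O t → Sorted G O × suc (length (reverse (map pt G))) + t ≤ 5 * (length G * length G) + 5 * length G + 6)
          (sym (reverse-involutive (map pt G)))
          (yields-bind (bipartition-spec (map pt G) {[]} {[]} {G} {[]} {[]} {0} {false} refl upper
              (state queue [] [] [] [] (All.tabulate λ _ → λ where left () ; right ())) refl)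
            λ { {s = s} (arranged E part refl tags ur , t≤) →
              yields-bind {f = λ L′ → concatenate (L′ ∷ (p ∷ []) ∷ pushed right E [] ∷ [])}
                (yields-reverse (pushed left E [])) λ where
                  (refl , refl) → yields-weaken (λ where
                      (refl , refl) → sorted E part (finish E) tags ur , cost E part t≤)
                    (concatenate-∷ʳ (reverse (pushed left E []) ∷ (p ∷ []) ∷ []) (pushed right E [])) })
    where
    finish : ∀ E e₀ → point e₀ ≡ p →
        concat (reverse (pushed left E []) ∷ (p ∷ []) ∷ []) ++ pushed right E [] ≡ map point (Arrangement.arrangement e₀ E)
    finish E e₀ p≡ = trans (++-assoc (reverse (pushed left E [])) (p ∷ []) (pushed right E []))
      (trans (Arrangement.arrangement-points e₀ p≡ E {[]} {[]}) (++-identityʳ _))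
    cost : ∀ E {s} → map item E ≡ G → s ≤ length (map pt G) * (5 * length G + 2) →
      suc (length (reverse (map pt G))) + (s + (suc (length (pushed left E [])) +
        (length (concat (reverse (pushed left E []) ∷ (p ∷ []) ∷ [])) + 2 + 1)))
        ≤ 5 * (length G * length G) + 5 * length G + 6
    cost E {s} refl s≤
      rewrite length-reverse (map pt (map item E)) | length-map pt (map item E) | length-map item E
            | length-++ (reverse (pushed left E [])) {p ∷ []} | length-reverse (pushed left E []) = begin
      suc k + (s + (suc l + (l + 1 + 2 + 1)))
        ≤⟨ +-monoʳ-≤ (suc k) (+-mono-≤ s≤ (+-mono-≤ (s≤s l≤k)
             (+-monoˡ-≤ 1 (+-monoˡ-≤ 2 (+-monoˡ-≤ 1 l≤k))))) ⟩
      suc k + (k * (5 * k + 2) + (suc k + (k + 1 + 2 + 1)))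
        ≡⟨ e k ⟩
      5 * (k * k) + 5 * k + 6 ∎
      where
      open ≤-Reasoning
      k = length E
      l = length (pushed left E [])
      l≤k : l ≤ k
      l≤k = m+n≤o⇒m≤o l (≤-reflexive (length-pushed {[]} {[]} {E}))
      e : ∀ k → suc k + (k * (5 * k + 2) + (suc k + (k + 1 + 2 + 1))) ≡ 5 * (k * k) + 5 * k + 6
      e = solve-∀

-- Compatibility of the order assembled from the blocks

record Item (n : ℕ) : Set where
  constructor mkItem
  field
    representative : Fin n
    block          : List (Fin n)
    copoint        : List (Fin n)
    -- Numbers the copoints from the inside out: 0 for the pivot, and one shared number for the two
    -- halves of a separated copoint.
    rank           : ℕ
    upper          : Bool

open Item public

module Verification {V : DistanceScale a ℓ₁ ℓ₂} {n : ℕ} (X : Dissimilarity V n) (choices : Choices n)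
                    {_≺_ : Rel (Fin n) 0ℓ} (≺-compatible : CompatibleOrder X _≺_) (p : Fin n) (sideAt : Fin n → Side) where
  open Distances V
  open Dissimilarity X
  open Algorithm X choices using (Point; Points)
  open Geometry X ≺-compatible
  open Copoints X choices ≺-compatible using (Constant)
  open Separation X choices ≺-compatible
  open Bipartition X choices ≺-compatible p (representative {n}) (λ i → upper i ≡ true)
  open BipartitionRun X choices ≺-compatible p (representative {n}) (λ i → upper i ≡ true) sideAt
  open import Relation.Binary.Reasoning.PartialOrder (poset)

  private
    pt : Item n → Point
    pt = representative

  record ItemOK (i : Item n) : Set (ℓ₁ ⊔ˡ ℓ₂) where
    constructor itemOK
    field
      pt∈        : pt i ∈ block i
      block⊆     : block i ⊆ copoint i
      isSeriated : Seriated (copoint i)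
      compact    : Compact p (block i)
      p-constant : Constant p (copoint i)
      -- The condition on the rank exempts the pivot, itself an item.
      p∉         : 1 ≤ rank i → ∀ {x} → x ∈ copoint i → x ≢ p
      straddles  : upper i ≡ true → ∃[ w ] (w ∈ copoint i × Opposite {p} (pt i) w)

    block∈ : ∀ {x} → x ∈ block i → x ∈ copoint i
    block∈ = Sub.lookup block⊆

  record Apart (i j : Item n) : Set ℓ₁ where
    constructor apart
    field
      ranks     : rank j < rank i
      far       : ∀ {x y} → x ∈ copoint i → y ∈ copoint j → Far p x y
      disjoint  : ∀ {x y} → x ∈ copoint i → y ∈ copoint j → x ≢ y
      constantˡ : ∀ {y} → y ∈ copoint j → Constant y (copoint i)
      constantʳ : ∀ {x} → x ∈ copoint i → Constant x (copoint j)

  record Halves (i j : Item n) : Set (ℓ₁ ⊔ˡ ℓ₂) where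
    constructor halves
    field
      upperˡ    : upper i ≡ true
      lowerʳ    : upper j ≡ false
      ranks     : rank i ≡ rank j
      copoints  : copoint i ≡ copoint j
      join      : block j ++ block i ≡ copoint j
      opposite  : Opposite {p} (pt j) (pt i)
      separable : ¬ (d (pt j) (pt i) ≤ᵈ d p (pt j))
      distant   : ∀ {x y} → x ∈ block j → y ∈ block i → d p x ≤ᵈ d x y

  ItemRel : Item n → Item n → Set (ℓ₁ ⊔ˡ ℓ₂)
  ItemRel i j = Apart i j ⊎ Halves i j

  EntryRel : Entry → Entry → Set (ℓ₁ ⊔ˡ ℓ₂)
  EntryRel e f = ItemRel (item e) (item f) × TagRel e f

  data Link (x : Point) (e : Entry) (y : Point) (f : Entry) : Set (ℓ₁ ⊔ˡ ℓ₂) where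
    together : e ≡ f → Before (block (item e)) x y → Link x e y f
    across   : Halves (item f) (item e) → side e ≡ left → side f ≡ right → Link x e y f
    outward  : Apart (item e) (item f) → TagRel e f → side e ≡ left → Link x e y f
    inward   : Apart (item f) (item e) → TagRel f e → side f ≡ right → Link x e y f

  record Located (x : Point) (e : Entry) : Set (ℓ₁ ⊔ˡ ℓ₂) where
    constructor located
    field
      member : x ∈ block (item e)
      ok     : ItemOK (item e)
      upperʳ : UpperRight e

    copoint∈ : x ∈ copoint (item e)
    copoint∈ = ItemOK.block∈ ok member

  open Located using (member; ok; copoint∈)

  same-flip-sides : ∀ {e f} → flip e ≡ flip f → Opposite {p} (point e) (point f) → side e ≡ flipSide (side f)
  same-flip-sides {e} refl opp = trans (cong (orient (flip e)) (opposite⇒flipSide opp)) (orient-flipSide (flip e) _)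

  -- Two halves of a copoint are in one component, as a distance beyond δ is not loose. So they keep
  -- the opposite sides they have in ≺, and the upper half being on the right forces the lower one
  -- to the left.
  outer-link : ∀ {x e y f} → Located x e → Located y f → Outer EntryRel e f → Link x e y f
  outer-link _ _ (inj₁ ((inj₁ e▷f , tags) , eq)) = outward e▷f tags eq
  outer-link _ _ (inj₂ ((inj₁ f▷e , tags) , eq)) = inward f▷e tags eq
  outer-link (located _ _ ur) _ (inj₁ ((inj₂ hs , _) , eq)) = contradiction (trans (sym eq) (ur (Halves.upperˡ hs))) λ ()
  outer-link {e = e} {f = f} (located _ okₑ _) (located _ okf _) (inj₂ ((inj₂ hs , tags) , eq)) =
    across hs (trans (same-flip-sides {e} {f} same-flip (Halves.opposite hs)) (cong flipSide eq)) eq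
    where
    open Halves hs
    p-equal : d p (point f) ≈ᵈ d p (point e)
    p-equal = ItemOK.p-constant okₑ
      (subst (point f ∈_) copoints (ItemOK.block∈ okf (ItemOK.pt∈ okf))) (ItemOK.block∈ okₑ (ItemOK.pt∈ okₑ))
    same-flip : flip e ≡ flip f
    same-flip = [ sym ∘ proj₂ , (λ (_ , loose) → contradiction (≤ᵈ-reflexive (≈ᵈ.trans loose p-equal)) separable) ]′ tags

  record Nestedᵉ (u v w : Entry) : Set (ℓ₁ ⊔ˡ ℓ₂) where
    constructor nestedᵉ
    field
      okᵤ  : ItemOK (item u)
      okᵥ  : ItemOK (item v)
      okʷ  : ItemOK (item w)
      uv   : Apart (item u) (item v)
      vw   : Apart (item v) (item w)
      uw   : Apart (item u) (item w)
      tags : TagRel u v × TagRel v w × TagRel u w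

  module Nest {u v w : Entry} (nested : Nestedᵉ u v w) where
    open Nestedᵉ nested

    private
      rep∈ : ∀ {i} → ItemOK i → pt i ∈ copoint i
      rep∈ ok = ItemOK.block∈ ok (ItemOK.pt∈ ok)

      u≢p : point u ≢ p
      u≢p = ItemOK.p∉ okᵤ (≤-trans (s≤s z≤n) (Apart.ranks uv)) (rep∈ okᵤ)
      v≢p : point v ≢ p
      v≢p = ItemOK.p∉ okᵥ (≤-trans (s≤s z≤n) (Apart.ranks vw)) (rep∈ okᵥ)

      far : ∀ {i j} → ItemOK i → ItemOK j → Apart i j → Far p (pt i) (pt j)
      far oki okj ij = Apart.far ij (rep∈ oki) (rep∈ okj)
      disjoint : ∀ {i j} → ItemOK i → ItemOK j → Apart i j → pt i ≢ pt j
      disjoint oki okj ij = Apart.disjoint ij (rep∈ oki) (rep∈ okj)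

      nest-reps : (sideOf p (point u) ≡ sideOf p (point v) → Mid (point u) (point v) (point w)) ×
                  (Opposite {p} (point u) (point v) → Mid (point u) (point w) (point v))
      nest-reps = nest-same u≢p v≢p (disjoint okᵤ okᵥ uv) (disjoint okᵥ okʷ vw) (far okᵤ okᵥ uv) (far okᵥ okʷ vw)
                , nest-opposite u≢p v≢p (disjoint okᵤ okʷ uw) (disjoint okᵥ okʷ vw) (far okᵤ okʷ uw) (far okᵥ okʷ vw)

      nest-p : (sideOf p (point u) ≡ sideOf p (point v) → Mid (point u) (point v) p) ×
               (Opposite {p} (point u) (point v) → Mid (point u) p (point v))
      nest-p = nest-same u≢p v≢p (disjoint okᵤ okᵥ uv) v≢p (far okᵤ okᵥ uv) Far-pivot
             , nest-opposite u≢p v≢p u≢p v≢p Far-pivot Far-pivot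

      same-sides⇒ : flip u ≡ flip v → side u ≡ side v → sideOf p (point u) ≡ sideOf p (point v)
      same-sides⇒ flips eq = same-side-stable λ opp → flipSide-≢ (side v) (trans (sym (same-flip-sides {u} {v} flips opp)) eq)

      opposite-sides⇒ : flip u ≡ flip v → side u ≢ side v → Opposite {p} (point u) (point v)
      opposite-sides⇒ flips neq eq = neq (trans (cong (λ f → orient f _) flips) (cong (orient (flip v)) eq))

      Reps : Set ℓ₂
      Reps = (side u ≡ side v → Mid (point u) (point v) (point w)) ×
             (side u ≢ side v → Mid (point u) (point w) (point v))

      -- Both distances from u equal d p u, so either arrangement requires only that d v w be at
      -- most this value. Whichever arrangement ≺ has provides it, even if it is not the one in the
      -- output.
      outermost : d (point v) (point u) ≈ᵈ d p (point u) → d (point w) (point u) ≈ᵈ d p (point u) → Reps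
      outermost vu≈ wu≈ = (λ _ → ≤ᵈ-reflexive uv≈uw , vw≤uw)
                        , (λ _ → ≤ᵈ-reflexive (≈ᵈ.sym uv≈uw) ,
                                 (begin d (point w) (point v) ≈⟨ d-sym _ _ ⟩ d (point v) (point w) ≤⟨ vw≤uw ⟩
                                        d (point u) (point w) ≈⟨ uv≈uw ⟨ d (point u) (point v) ∎))
        where
        uv≈uw : d (point u) (point v) ≈ᵈ d (point u) (point w)
        uv≈uw = ≈ᵈ.trans (d-sym _ _) (≈ᵈ.trans vu≈ (≈ᵈ.trans (≈ᵈ.sym wu≈) (d-sym _ _)))
        vw≤uw : d (point v) (point w) ≤ᵈ d (point u) (point w)
        vw≤uw with sideOf p (point u) ≟ˢ sideOf p (point v)
        ... | yes eq = proj₂ (proj₁ nest-reps eq)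
        ... | no neq = begin
          d (point v) (point w) ≈⟨ d-sym _ _ ⟩ d (point w) (point v) ≤⟨ proj₂ (proj₂ nest-reps neq) ⟩
          d (point u) (point v) ≈⟨ uv≈uw ⟩ d (point u) (point w) ∎

      reps : Reps
      reps with tags
      ... | inj₁ (_ , flips) , inj₁ _ , _ =
        (λ eq → proj₁ nest-reps (same-sides⇒ flips eq)) , (λ neq → proj₂ nest-reps (opposite-sides⇒ flips neq))
      ... | inj₁ (u≡v , _) , inj₂ (v<w , _) , inj₁ (u≡w , _) =
        contradiction (trans (sym u≡v) u≡w) (<⇒≢ v<w)
      ... | inj₁ (_ , flips) , inj₂ (_ , wv≈) , inj₂ (_ , wu≈) =
        (λ eq → let uv≤up , vp≤up = proj₁ nest-p (same-sides⇒ flips eq) in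
           (begin d (point u) (point v) ≤⟨ uv≤up ⟩ d (point u) p ≈⟨ up≈uw ⟩ d (point u) (point w) ∎) ,
           (begin d (point v) (point w) ≈⟨ vp≈vw ⟨ d (point v) p ≤⟨ vp≤up ⟩ d (point u) p ≈⟨ up≈uw ⟩ d (point u) (point w) ∎)) ,
        (λ neq → let up≤uv , pv≤uv = proj₂ nest-p (opposite-sides⇒ flips neq) in
           (begin d (point u) (point w) ≈⟨ up≈uw ⟨ d (point u) p ≤⟨ up≤uv ⟩ d (point u) (point v) ∎) ,
           (begin d (point w) (point v) ≈⟨ wv≈ ⟩ d p (point v) ≤⟨ pv≤uv ⟩ d (point u) (point v) ∎))
        where
        up≈uw : d (point u) p ≈ᵈ d (point u) (point w)
        up≈uw = ≈ᵈ.trans (d-sym _ _) (≈ᵈ.trans (≈ᵈ.sym wu≈) (d-sym _ _))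
        vp≈vw : d (point v) p ≈ᵈ d (point v) (point w)
        vp≈vw = ≈ᵈ.trans (d-sym _ _) (≈ᵈ.trans (≈ᵈ.sym wv≈) (d-sym _ _))
      ... | inj₂ (_ , vu≈) , _ , inj₂ (_ , wu≈) = outermost vu≈ wu≈
      ... | inj₂ (u<v , _) , inj₁ (v≡w , _) , inj₁ (u≡w , _) =
        contradiction (trans u≡w (sym v≡w)) (<⇒≢ u<v)
      ... | inj₂ (u<v , _) , inj₂ (v<w , _) , inj₁ (u≡w , _) =
        contradiction u≡w (<⇒≢ (<-trans u<v v<w))

    module _ {x y z : Point} (x∈ : x ∈ block (item u)) (y∈ : y ∈ block (item v)) (z∈ : z ∈ block (item w)) where
      private
        transfer : ∀ {i j a b} → ItemOK i → ItemOK j → Apart i j → a ∈ block i → b ∈ block j → d (pt i) (pt j) ≈ᵈ d a b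
        transfer {i} {j} {a} {b} oki okj ij a∈ b∈ = begin-equality
          d (pt i) (pt j)  ≈⟨ Apart.constantʳ ij (rep∈ oki) (rep∈ okj) (ItemOK.block∈ okj b∈) ⟩
          d (pt i) b       ≈⟨ d-sym _ _ ⟩
          d b (pt i)       ≈⟨ Apart.constantˡ ij (ItemOK.block∈ okj b∈) (rep∈ oki) (ItemOK.block∈ oki a∈) ⟩
          d b a            ≈⟨ d-sym _ _ ⟩
          d a b            ∎

        xy = transfer okᵤ okᵥ uv x∈ y∈
        yz = transfer okᵥ okʷ vw y∈ z∈
        xz = transfer okᵤ okʷ uw x∈ z∈

        ≤-resp : ∀ {a b c e f g h i} → d a b ≈ᵈ d c e → d f g ≈ᵈ d h i → d a b ≤ᵈ d f g → d c e ≤ᵈ d h i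
        ≤-resp ab≈ce fg≈hi ab≤fg = ≤ᵈ-trans (≤ᵈ-reflexive (≈ᵈ.sym ab≈ce)) (≤ᵈ-trans ab≤fg (≤ᵈ-reflexive fg≈hi))

      mid-same : side u ≡ side v → Mid x y z
      mid-same eq = let ≤₁ , ≤₂ = proj₁ reps eq in ≤-resp xy xz ≤₁ , ≤-resp yz xz ≤₂

      mid-opposite : side u ≢ side v → Mid x z y
      mid-opposite neq = let ≤₁ , ≤₂ = proj₂ reps neq in
        ≤-resp xz xy ≤₁ , ≤-resp (≈ᵈ.trans (d-sym _ _) (≈ᵈ.trans yz (d-sym _ _))) xy ≤₂

  -- One interface for two points of the same copoint, whether in one block or across the cut:
  -- `near` is vacuous across the cut and `spread` is vacuous inside a block.
  record Close (x : Point) (e : Entry) (y : Point) (f : Entry) : Set (ℓ₁ ⊔ˡ ℓ₂) where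
    constructor close
    field
      ranks    : rank (item e) ≡ rank (item f)
      copoints : copoint (item e) ≡ copoint (item f)
      before   : Before (copoint (item f)) x y
      near     : side f ≡ left ⊎ side e ≡ right → d x y ≤ᵈ d p x
      spread   : side e ≢ side f → d p x ≤ᵈ d x y ×
                 (∃[ u ] ∃[ v ] (u ∈ copoint (item f) × v ∈ copoint (item f) × Opposite {p} u v))

  data Position (x : Point) (e : Entry) (y : Point) (f : Entry) : Set (ℓ₁ ⊔ˡ ℓ₂) where
    close   : Close x e y f → Position x e y f
    outward : Apart (item e) (item f) → TagRel e f → side e ≡ left → Position x e y f
    inward  : Apart (item f) (item e) → TagRel f e → side f ≡ right → Position x e y f

  link-position : ∀ {x e y f} → Located x e → Located y f → Link x e y f → Position x e y f
  link-position (located x∈ ok _) (located y∈ _ _) (together refl xy) = close (close refl refl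
    (Sub.⊆-trans xy (ItemOK.block⊆ ok)) (λ _ → ItemOK.compact ok x∈ y∈) (λ neq → contradiction refl neq))
  link-position {x} {e} {y} {f} (located x∈ okₑ _) (located y∈ okf _) (across hs eq eq′) = close (close (sym ranks) (sym copoints)
    (subst (λ L → Before L x y) (trans join (sym copoints)) (Before-++ _ x∈ y∈))
    [ (λ eq″ → contradiction (trans (sym eq′) eq″) λ ()) , (λ eq″ → contradiction (trans (sym eq) eq″) λ ()) ]′
    (λ _ → distant x∈ y∈ , point e , point f ,
           subst (point e ∈_) (sym copoints) (ItemOK.block∈ okₑ (ItemOK.pt∈ okₑ)) , ItemOK.block∈ okf (ItemOK.pt∈ okf) , opposite))
    where open Halves hs
  link-position _ _ (outward e▷f tags eq) = outward e▷f tags eq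
  link-position _ _ (inward f▷e tags eq)  = inward f▷e tags eq

  private
    d-swap : ∀ {x y z} → d z x ≈ᵈ d z y → d x z ≈ᵈ d y z
    d-swap eq = ≈ᵈ.trans (d-sym _ _) (≈ᵈ.trans eq (d-sym _ _))

    -- Constancy makes the distances from x and from y to the nearer z equal, so only d x y ≤ d x z
    -- is at stake, and this is where the compactness of the block enters.
    nearer-mid : ∀ {i j x y z} → ItemOK i → Apart i j → x ∈ copoint i → y ∈ copoint i → z ∈ copoint j →
                 d x y ≤ᵈ d p x → Mid x y z
    nearer-mid {i} {x = x} {y} {z} ok ij x∈ y∈ z∈ xy≤ =
      nearer-bound (p∉ 1≤ x∈) (p∉ 1≤ y∈) (disjoint x∈ z∈) (disjoint y∈ z∈) (far x∈ z∈) (far y∈ z∈)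
        (d-swap (constantˡ z∈ x∈ y∈)) (p-constant x∈ y∈) xy≤ ,
      ≤ᵈ-reflexive (d-swap (constantˡ z∈ y∈ x∈))
      where
      open ItemOK ok
      open Apart ij
      1≤ : 1 ≤ rank i
      1≤ = ≤-trans (s≤s z≤n) ranks

    farther-mid : ∀ {i j x y z} → ItemOK i → Apart i j → x ∈ copoint j → y ∈ copoint j → z ∈ copoint i → Mid x y z
    farther-mid {i} {x = x} {y} {z} ok ij x∈ y∈ z∈ =
      (begin d x y ≤⟨ farther-bound (p∉ 1≤ z∈) (disjoint z∈ x∈) (disjoint z∈ y∈) (far z∈ x∈) (far z∈ y∈) (constantʳ z∈ x∈ y∈) ⟩
             d z x ≈⟨ d-sym z x ⟩ d x z ∎) ,
      ≤ᵈ-reflexive (d-swap (constantʳ z∈ y∈ x∈))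
      where
      open ItemOK ok
      open Apart ij
      1≤ : 1 ≤ rank i
      1≤ = ≤-trans (s≤s z≤n) ranks

    Mid-flip : ∀ {x y z} → d x y ≈ᵈ d x z → d y z ≤ᵈ d x y → Mid x y z
    Mid-flip xy≈xz yz≤xy = ≤ᵈ-reflexive xy≈xz , ≤ᵈ-trans yz≤xy (≤ᵈ-reflexive xy≈xz)

  -- Ranks fall towards the pivot and rise after it, so y is never farther out than both others:
  -- that would put its entry on both sides. If y is nearer than both, the position of x relative to
  -- z distinguishes the remaining cases; otherwise it is implied by the other two.
  position-mid : ∀ {x e y f z g} → Located x e → Located y f → Located z g →
    Position x e y f → Position y f z g → Position x e z g → Mid x y z
  position-mid lx ly lz (close (close _ _ xy _ _)) (close (close _ eq yz _ _)) _ =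
    Seriated.middle (ItemOK.isSeriated (ok lz)) (subst (λ L → Before L _ _) eq xy) yz
  position-mid lx ly lz (close (close _ eq _ near _)) (outward f▷g _ isLeft) _ =
    nearer-mid (ok ly) f▷g (subst (_ ∈_) eq (copoint∈ lx)) (copoint∈ ly) (copoint∈ lz) (near (inj₁ isLeft))
  position-mid lx ly lz (close (close _ eq _ _ _)) (inward g▷f _ _) _ =
    farther-mid (ok lz) g▷f (subst (_ ∈_) eq (copoint∈ lx)) (copoint∈ ly) (copoint∈ lz)
  position-mid lx ly lz (outward e▷f _ _) (close (close _ eq _ _ _)) _ =
    Mid-sym (farther-mid (ok lx) e▷f (subst (_ ∈_) (sym eq) (copoint∈ lz)) (copoint∈ ly) (copoint∈ lx))
  position-mid {x} {e} {y} {f} {z} {g} lx ly lz (inward f▷e _ isRight) (close (close _ eq yz near _)) _ =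
    Mid-flip (d-equal) (begin
      d y z ≤⟨ proj₁ (nearer-mid (ok ly) f▷e (copoint∈ ly) z∈f (copoint∈ lx) (near (inj₂ isRight))) ⟩
      d y x ≈⟨ d-sym y x ⟩ d x y ∎)
    where
    z∈f : z ∈ copoint (item f)
    z∈f = subst (z ∈_) (sym eq) (copoint∈ lz)
    d-equal : d x y ≈ᵈ d x z
    d-equal = Apart.constantˡ f▷e (copoint∈ lx) (copoint∈ ly) z∈f
  position-mid lx ly lz (outward e▷f tef isLeft) (outward f▷g tfg isLeft′) (outward e▷g teg _) =
    Nest.mid-same (nestedᵉ (ok lx) (ok ly) (ok lz) e▷f f▷g e▷g (tef , tfg , teg)) (member lx) (member ly) (member lz)
      (trans isLeft (sym isLeft′))
  position-mid _ _ _ (outward e▷f _ _) (outward f▷g _ _) (inward g▷e _ _) =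
    contradiction (<-trans (Apart.ranks g▷e) (<-trans (Apart.ranks f▷g) (Apart.ranks e▷f))) (<-irrefl refl)
  position-mid _ _ _ (outward e▷f _ _) (outward f▷g _ _) (close (close eq _ _ _ _)) =
    contradiction (sym eq) (<⇒≢ (<-trans (Apart.ranks f▷g) (Apart.ranks e▷f)))
  position-mid lx ly lz (outward e▷f tef isLeft) (inward g▷f tgf isRight) (outward e▷g teg _) =
    Nest.mid-opposite (nestedᵉ (ok lx) (ok lz) (ok ly) e▷g g▷f e▷f (teg , tgf , tef)) (member lx) (member lz) (member ly)
      (λ eq → contradiction (trans (sym isLeft) (trans eq isRight)) λ ())
  position-mid lx ly lz (outward e▷f tef isLeft) (inward g▷f tgf isRight) (inward g▷e tge _) =
    Mid-sym (Nest.mid-opposite (nestedᵉ (ok lz) (ok lx) (ok ly) g▷e e▷f g▷f (tge , tef , tgf)) (member lz) (member lx) (member ly)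
      (λ eq → contradiction (trans (sym isLeft) (trans (sym eq) isRight)) λ ()))
  -- x and z are in different halves of a copoint that encloses y. They need not be opposite in ≺,
  -- but the ends `u` and `v` are; this bounds d u y by δ, constancy transfers the bound to x and z,
  -- and distances across the cut are at least δ.
  position-mid {x} {e} {y} {f} {z} {g} lx ly lz
    (outward e▷f _ isLeft) (inward g▷f _ isRight) (close (close _ eq _ _ spread))
    with spread (λ eq → contradiction (trans (sym isLeft) (trans eq isRight)) λ ())
  ... | px≤xz , u , v , u∈ , v∈ , opp =
    (begin d x y ≈⟨ d-swap (constantˡ y∈f x∈g u∈) ⟩ d u y ≤⟨ uy≤xz ⟩ d x z ∎) ,
    (begin d y z ≈⟨ constantˡ y∈f z∈g u∈ ⟩ d y u ≈⟨ d-sym y u ⟩ d u y ≤⟨ uy≤xz ⟩ d x z ∎)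
    where
    open ItemOK (ok lz)
    open Apart g▷f
    1≤ : 1 ≤ rank (item g)
    1≤ = ≤-trans (s≤s z≤n) ranks
    y∈f = copoint∈ ly
    z∈g = copoint∈ lz
    x∈g : x ∈ copoint (item g)
    x∈g = subst (x ∈_) eq (copoint∈ lx)
    uy≤xz : d u y ≤ᵈ d x z
    uy≤xz = begin
      d u y  ≤⟨ between-opposite-bound (p∉ 1≤ u∈) (p∉ 1≤ v∈) (disjoint u∈ y∈f) (disjoint v∈ y∈f) opp
                  (far u∈ y∈f) (far v∈ y∈f) (d-swap (constantˡ y∈f u∈ v∈)) (p-constant u∈ v∈) ⟩
      d p u  ≈⟨ p-constant u∈ x∈g ⟩
      d p x  ≤⟨ px≤xz ⟩
      d x z  ∎
  position-mid _ _ _ (inward _ _ isRight) (outward _ _ isLeft) _ = contradiction (trans (sym isLeft) isRight) λ ()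
  position-mid lx ly lz (inward f▷e tfe isRight) (inward g▷f tgf isRight′) (inward g▷e tge _) =
    Mid-sym (Nest.mid-same (nestedᵉ (ok lz) (ok ly) (ok lx) g▷f f▷e g▷e (tgf , tfe , tge)) (member lz) (member ly) (member lx)
      (trans isRight′ (sym isRight)))
  position-mid _ _ _ (inward f▷e _ _) (inward g▷f _ _) (outward e▷g _ _) =
    contradiction (<-trans (Apart.ranks f▷e) (<-trans (Apart.ranks g▷f) (Apart.ranks e▷g))) (<-irrefl refl)
  position-mid _ _ _ (inward f▷e _ _) (inward g▷f _ _) (close (close eq _ _ _ _)) =
    contradiction eq (<⇒≢ (<-trans (Apart.ranks f▷e) (Apart.ranks g▷f)))

  EntryOK : Entry → Set (ℓ₁ ⊔ˡ ℓ₂)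
  EntryOK e = ItemOK (item e) × UpperRight e

  private
    Annotated : Set
    Annotated = Point × Entry

    Linked² : Annotated → Annotated → Set (ℓ₁ ⊔ˡ ℓ₂)
    Linked² (x , e) (y , f) = Located x e × Located y f × Link x e y f

    -- Each point carries its entry, so that a triple found in the output lifts to one whose
    -- pairwise links are known.
    annotate : Entry → List Annotated
    annotate e = map (_, e) (block (item e))

    annotate-linked : ∀ {A} → All EntryOK A → AllPairs (Outer EntryRel) A → AllPairs Linked² (concat (map annotate A))
    annotate-linked ok outer = AllPairsₚ.concat⁺
      (Allₚ.map⁺ (All.map (λ {e} (ok , ur) → AllPairsₚ.map⁺ (AllPairs.map
        (λ xy → located (Before-∈ˡ xy) ok ur , located (Before-∈ʳ xy) ok ur , together refl xy) (AllPairs-Before-self (block (item e))))) ok))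
      (AllPairsₚ.map⁺ (AllPairs.map (λ {e} {f} (outer , (okₑ , urₑ) , (okf , urf)) →
          Allₚ.map⁺ (All.tabulate λ x∈ → Allₚ.map⁺ (All.tabulate λ y∈ →
            located x∈ okₑ urₑ , located y∈ okf urf , outer-link (located x∈ okₑ urₑ) (located y∈ okf urf) outer)))
        (AllPairs-with-All ok outer)))

    annotate-points : ∀ A → map proj₁ (concat (map annotate A)) ≡ concat (map (block ∘ item) A)
    annotate-points []      = refl
    annotate-points (e ∷ A) = trans (map-++ proj₁ (annotate e) _) (cong₂ _++_ (go (block (item e))) (annotate-points A))
      where
      go : ∀ T → map proj₁ (map (_, e) T) ≡ T
      go []      = refl
      go (x ∷ T) = cong (x ∷_) (go T)

  concat-blocks-seriated : ∀ {A} → All EntryOK A → AllPairs (Outer EntryRel) A →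
    Unique (concat (map (block ∘ item) A)) → Seriated (concat (map (block ∘ item) A))
  concat-blocks-seriated {A} ok outer unique = seriated unique λ {x} {y} {z} xy yz →
    middle (⊆-map⁻ _ (subst (_ ⊆_) (sym (annotate-points A)) (Before-triple unique xy yz)))
    where
    middle : ∀ {x y z} → ∃[ as ] (as ⊆ concat (map annotate A) × map proj₁ as ≡ x ∷ y ∷ z ∷ []) → Mid x y z
    middle ((x , e) ∷ (y , f) ∷ (z , g) ∷ [] , sub , refl) with AllPairs-⊆ sub (annotate-linked ok outer)
    ... | ((locx , locy , xy) ∷ (_ , _ , xz) ∷ []) ∷ ((_ , locz , yz) ∷ []) ∷ [] ∷ [] = position-mid locx locy locz
      (link-position locx locy xy) (link-position locy locz yz) (link-position locx locz xz)

-- From the copoints to the queue of representatives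

Unique-resp-↭ : {xs ys : List A} → xs ↭ ys → Unique xs → Unique ys
Unique-resp-↭ {A = A} xs↭ys = SetoidPerm.Unique-resp-↭ (setoid A) (↭⇒↭ₛ xs↭ys)

removeAt-↭ : ∀ (xs : List A) i → lookup xs i ∷ removeAt xs i ↭ xs
removeAt-↭ (x ∷ xs) Fin.zero    = ↭-refl
removeAt-↭ (x ∷ xs) (Fin.suc i) = ↭-trans (_↭_.swap _ x ↭-refl) (prep x (removeAt-↭ xs i))

module Gathering {V : DistanceScale a ℓ₁ ℓ₂} {n : ℕ} (X : Dissimilarity V n) (choices : Choices n)
                 {_≺_ : Rel (Fin n) 0ℓ} (≺-compatible : CompatibleOrder X _≺_) (p : Fin n) (sideAt : Fin n → Side) where
  open Distances V
  open Dissimilarity X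
  open Algorithm X choices using (Point; Points)
  open Geometry X ≺-compatible
  open Copoints X choices ≺-compatible using (Constant; Precedes; module Precedes)
  open Separation X choices ≺-compatible
  open Bipartition X choices ≺-compatible p (representative {n}) (λ i → upper i ≡ true)
  open Verification X choices ≺-compatible p sideAt

  private
    pt : Item n → Point
    pt = representative

  Adjacent : Item n → Item n → Set (ℓ₁ ⊔ˡ ℓ₂)
  Adjacent i j = upper i ≡ true → Halves i j

  private
    rep∈ : ∀ {i} → ItemOK i → pt i ∈ copoint i
    rep∈ ok = ItemOK.block∈ ok (ItemOK.pt∈ ok)

    -- A copoint with an upper half has points on both sides of p. A farther representative is
    -- constant on it and sees p on the way to one of those points, so this constant can only be its
    -- own distance to p.
    equidistant : ∀ {i j} → ItemOK i → ItemOK j → 1 ≤ rank i → 1 ≤ rank j → Apart i j → upper j ≡ true →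
                  ∀ {w} → w ∈ copoint j → d w (pt i) ≈ᵈ d p (pt i)
    equidistant oki okj 1≤i 1≤j ij up {w} w∈ with ItemOK.straddles okj up
    ... | v , v∈ , opp = ≈ᵈ.trans (d-sym w _) (≈ᵈ.trans (constantʳ (rep∈ oki) w∈ (rep∈ okj)) 
      (opposite⇒equidistant (p∉ oki 1≤i (rep∈ oki)) (p∉ okj 1≤j (rep∈ okj)) (p∉ okj 1≤j v∈)
        (disjoint (rep∈ oki) (rep∈ okj)) (disjoint (rep∈ oki) v∈) opp (far (rep∈ oki) (rep∈ okj)) (far (rep∈ oki) v∈)
        (constantʳ (rep∈ oki) (rep∈ okj) v∈)))
      where
      open Apart ij
      open ItemOK using (p∉)

    not-lower : ∀ {i j} {W : Set ℓ} → Halves i j → upper j ≡ true → W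
    not-lower hs up = contradiction (trans (sym (Halves.lowerʳ hs)) up) λ ()

    nested : ∀ {i j} → ItemOK i → ItemOK j → 1 ≤ rank i → 1 ≤ rank j → ItemRel i j → Nested i j
    nested oki okj 1≤i 1≤j (inj₁ ij) = Apart.far ij (rep∈ oki) (rep∈ okj) , Apart.disjoint ij (rep∈ oki) (rep∈ okj)
    nested oki okj 1≤i 1≤j (inj₂ hs) =
      opposite⇒Far (ItemOK.p∉ oki 1≤i (rep∈ oki)) (ItemOK.p∉ okj 1≤j (rep∈ okj)) (Halves.opposite hs ∘ sym) ,
      λ eq → Halves.opposite hs (cong (sideOf p) (sym eq))

    sees-item : ∀ {i j} → ItemOK i → ItemOK j → 1 ≤ rank i → 1 ≤ rank j → ItemRel i j → Sees (pt i) j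
    sees-item oki okj 1≤i 1≤j ij = sees (proj₁ (nested oki okj 1≤i 1≤j ij)) (proj₂ (nested oki okj 1≤i 1≤j ij))
      (ItemOK.p∉ okj 1≤j (rep∈ okj))
      (λ up → [ (λ ij → equidistant oki okj 1≤i 1≤j ij up (rep∈ okj)) , (λ hs → not-lower hs up) ]′ ij)

    splits : ∀ {i zs} → ItemOK i → 1 ≤ rank i → All (λ j → (ItemOK j × 1 ≤ rank j) × ItemRel i j) zs →
             Linked Adjacent zs → Linked (Split (pt i)) zs
    splits oki 1≤i _ []  = []
    splits oki 1≤i _ [-] = [-]
    splits oki 1≤i (((okj , 1≤j) , ij) ∷ rels@(((okl , _) , _) ∷ _)) (adj ∷ adjs) =
      (λ up → [ (λ ij → equidistant oki okj 1≤i 1≤j ij up (subst (_ ∈_) (sym (Halves.copoints (adj up))) (rep∈ okl)))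
              , (λ hs → not-lower hs up) ]′ ij
            , Halves.opposite (adj up) ∘ sym)
      ∷ splits oki 1≤i rels adjs

  queue : ∀ {G} → All (λ i → ItemOK i × 1 ≤ rank i) G → AllPairs ItemRel G → Linked Adjacent G → Queue G
  queue []                   []              _   = []
  queue ((ok , 1≤) ∷ oks) (rels ∷ relss) adj =
    (ItemOK.p∉ ok 1≤ (rep∈ ok) , pass
      (All.zipWith (λ ((okj , 1≤j) , ij) → sees-item ok okj 1≤ 1≤j ij) (oks , rels))
      (AllPairs.map (λ (ij , (oki , 1≤i) , (okj , 1≤j)) → nested oki okj 1≤i 1≤j ij) (AllPairs-with-All oks relss))
      (splits ok 1≤ (All.zip (oks , rels)) (Linked.tail adj)))
    ∷ queue oks relss (Linked.tail adj)

  -- `Apart` for a copoint `D` still to be gathered, which has neither representative nor rank.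
  record Beyond (D : Points) (i : Item n) : Set ℓ₁ where
    constructor beyond
    field
      far       : ∀ {x y} → x ∈ D → y ∈ copoint i → Far p x y
      disjoint  : ∀ {x y} → x ∈ D → y ∈ copoint i → x ≢ y
      constantˡ : ∀ {y} → y ∈ copoint i → Constant y D
      constantʳ : ∀ {x} → x ∈ D → Constant x (copoint i)

  record Gathered (k : ℕ) (Cs : List Points) (G : List (Item n)) : Set (ℓ₁ ⊔ˡ ℓ₂) where
    constructor gathered
    field
      ok       : All (λ i → ItemOK i × 1 ≤ rank i) G
      ranks    : All (λ i → rank i < k) G
      related  : AllPairs ItemRel G
      adjacent : Linked Adjacent G
      later    : All (λ i → All (λ D → Beyond D i) Cs) G

  -- Items are kept in the order of processing, the reverse of that of the representatives, so the
  -- half of x^* comes before the half of x_*.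
  items : ∀ {L part} → ℕ → Separated p L part → List (Item n)
  items {L} k (whole {x} _ _)                     = mkItem x L L k false ∷ []
  items {L} k (split {x} {T} {y} {U} _ _ _ _ _ _ _ _) = mkItem y U L k true ∷ mkItem x T L k false ∷ []

  gather : ∀ {Cs parts} → ℕ → Pointwise (Represents p) Cs parts → List (Item n) → List (Item n)
  gather k []                          G = G
  gather k ((_ , _ , _ , sep) ∷ reps) G = gather (suc k) reps (items k sep ++ G)

  map-pt-items : ∀ {L part} k (sep : Separated p L part) → map pt (items k sep) ≡ reverse (map proj₁ part)
  map-pt-items k (whole _ _)             = refl
  map-pt-items k (split _ _ _ _ _ _ _ _) = refl

  blocks-items-↭ : ∀ {L part} k (sep : Separated p L part) → concat (map block (items k sep)) ↭ L
  blocks-items-↭ {L} k (whole _ _) = ↭-reflexive (++-identityʳ L)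
  blocks-items-↭ k (split {T = T} {U = U} _ _ refl _ _ _ _ _) =
    ↭-trans (Perm.++-comm U (T ++ [])) (↭-reflexive (cong (_++ U) (++-identityʳ T)))

  map-pt-gather : ∀ {Cs parts} k (reps : Pointwise (Represents p) Cs parts) G →
    map pt (gather k reps G) ≡ reverse (map proj₁ (concat parts)) ++ map pt G
  map-pt-gather k []                                                   G = refl
  map-pt-gather {parts = part ∷ parts} k ((_ , _ , _ , sep) ∷ reps) G = begin
    map pt (gather (suc k) reps (items k sep ++ G))
      ≡⟨ map-pt-gather (suc k) reps _ ⟩
    reverse (map proj₁ (concat parts)) ++ map pt (items k sep ++ G)
      ≡⟨ cong (reverse (map proj₁ (concat parts)) ++_) (map-++ pt (items k sep) G) ⟩
    reverse (map proj₁ (concat parts)) ++ map pt (items k sep) ++ map pt G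
      ≡⟨ cong (λ M → reverse (map proj₁ (concat parts)) ++ M ++ map pt G) (map-pt-items k sep) ⟩
    reverse (map proj₁ (concat parts)) ++ reverse (map proj₁ part) ++ map pt G
      ≡⟨ ++-assoc (reverse (map proj₁ (concat parts))) (reverse (map proj₁ part)) (map pt G) ⟨
    (reverse (map proj₁ (concat parts)) ++ reverse (map proj₁ part)) ++ map pt G
      ≡⟨ cong (_++ map pt G) (reverse-++ (map proj₁ part) _) ⟨
    reverse (map proj₁ part ++ map proj₁ (concat parts)) ++ map pt G
      ≡⟨ cong (λ M → reverse M ++ map pt G) (map-++ proj₁ part (concat parts)) ⟨
    reverse (map proj₁ (part ++ concat parts)) ++ map pt G ∎
    where open ≡-Reasoning

  blocks-gather-↭ : ∀ {Cs parts} k (reps : Pointwise (Represents p) Cs parts) G →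
    concat (map block (gather k reps G)) ↭ concat Cs ++ concat (map block G)
  blocks-gather-↭ k [] G = ↭-refl
  blocks-gather-↭ {Cs = C ∷ Cs} k ((L , L↭C , _ , sep) ∷ reps) G = begin
    concat (map block (gather (suc k) reps (items k sep ++ G)))
      ↭⟨ blocks-gather-↭ (suc k) reps _ ⟩
    concat Cs ++ concat (map block (items k sep ++ G))
      ≡⟨ cong (concat Cs ++_) (concat-map-++ block (items k sep) G) ⟩
    concat Cs ++ concat (map block (items k sep)) ++ concat (map block G)
      ↭⟨ Perm.++⁺ˡ (concat Cs) (Perm.++⁺ʳ _ (↭-trans (blocks-items-↭ k sep) L↭C)) ⟩
    concat Cs ++ C ++ concat (map block G)
      ↭⟨ Perm.shifts (concat Cs) C ⟩
    C ++ concat Cs ++ concat (map block G)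
      ≡⟨ ++-assoc C (concat Cs) _ ⟨
    (C ++ concat Cs) ++ concat (map block G) ∎
    where open PermutationReasoning

  -- Traces an upper item back to the two-part result it comes from, the form in which
  -- `OrientsSeparated` constrains the choice of its side.
  FromParts : List (List (Block n)) → Item n → Set
  FromParts parts i = (pt i , block i) ∈ concat parts ×
    (upper i ≡ true → ∃[ x ] ∃[ T ] ((x , T) ∷ (pt i , block i) ∷ []) ∈ parts)

  gather-from : ∀ {Cs parts all} k (reps : Pointwise (Represents p) Cs parts) → (∀ {part} → part ∈ parts → part ∈ all) →
    ∀ {G} → All (FromParts all) G → All (FromParts all) (gather k reps G)
  gather-from k [] sub from = from
  gather-from {all = all} k ((_ , _ , _ , sep) ∷ reps) sub from =
    gather-from (suc k) reps (sub ∘ there) (Allₚ.++⁺ (items-from sep (sub (here refl))) from)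
    where
    items-from : ∀ {L part} (sep : Separated p L part) → part ∈ all → All (FromParts all) (items k sep)
    items-from (whole _ _)             part∈ = (∈-concat⁺′ (here refl) part∈ , λ ()) ∷ []
    items-from (split _ _ _ _ _ _ _ _) part∈ =
      (∈-concat⁺′ (there (here refl)) part∈ , λ _ → _ , _ , part∈) ∷ (∈-concat⁺′ (here refl) part∈ , λ ()) ∷ []

  length-parts≤ : ∀ {Cs parts} → Pointwise (Represents p) Cs parts →
    length parts ≡ length Cs × length (concat parts) ≤ 2 * length Cs
  length-parts≤ [] = refl , z≤n
  length-parts≤ {C ∷ Cs} {part ∷ parts} ((_ , _ , _ , sep) ∷ reps) with length-parts≤ reps
  ... | eq , len≤ = cong suc eq , ≤-trans (≤-reflexive (length-++ part))
    (≤-trans (+-mono-≤ (length≤2 sep) len≤) (≤-reflexive (sym (*-suc 2 (length Cs)))))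
    where
    length≤2 : ∀ {L part} → Separated p L part → length part ≤ 2
    length≤2 (whole _ _)             = s≤s z≤n
    length≤2 (split _ _ _ _ _ _ _ _) = ≤-refl

  private
    module Step {k : ℕ} {C : Points} {Cs : List Points} {G : List (Item n)} {L : Points} (1≤k : 1 ≤ k)
                (gath : Gathered k (C ∷ Cs) G) (L↭C : L ↭ C) (L-seriated : Seriated L)
                (precedes-all : All (Precedes p C) Cs) (apart-all : ∀ {x y} → x ∈ C → y ∈ concat Cs → x ≢ y)
                (p∉C : ∀ {x} → x ∈ C → x ≢ p) (p-constant-C : Constant p C) where
      open Gathered gath

      L⊆C : ∀ {x} → x ∈ L → x ∈ C
      L⊆C = Perm.∈-resp-↭ L↭C

      L-ok : ∀ {i} → copoint i ≡ L → pt i ∈ block i → block i ⊆ L → Compact p (block i) →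
             (upper i ≡ true → ∃[ w ] (w ∈ L × Opposite {p} (pt i) w)) → ItemOK i
      L-ok refl pt∈ block⊆ compact straddles =
        itemOK pt∈ block⊆ L-seriated compact (λ x∈ y∈ → p-constant-C (L⊆C x∈) (L⊆C y∈)) (λ _ x∈ → p∉C (L⊆C x∈)) straddles

      L-apart : ∀ {i} → copoint i ≡ L → rank i ≡ k → All (Apart i) G
      L-apart {i} refl refl = All.zipWith (λ (lat , rank<) → from-beyond (All.head lat) rank<) (later , ranks)
        where
        from-beyond : ∀ {v} → Beyond C v → rank v < k → Apart i v
        from-beyond (beyond far disjoint constantˡ constantʳ) rank< = apart rank<
          (λ x∈ y∈ → far (L⊆C x∈) y∈) (λ x∈ y∈ → disjoint (L⊆C x∈) y∈)
          (λ y∈ u∈ v∈ → constantˡ y∈ (L⊆C u∈) (L⊆C v∈)) (λ x∈ → constantʳ (L⊆C x∈))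

      L-later : ∀ {i} → copoint i ≡ L → All (λ D → Beyond D i) Cs
      L-later refl = All.tabulate λ D∈ → let open Precedes (All.lookup precedes-all D∈) in beyond
        (λ x∈ y∈ → far (L⊆C y∈) x∈) (λ x∈ y∈ x≡y → apart-all (L⊆C y∈) (∈-concat⁺′ x∈ D∈) (sym x≡y))
        (λ y∈ → constantʳ (L⊆C y∈)) (λ x∈ u∈ v∈ → constantˡ x∈ (L⊆C u∈) (L⊆C v∈))

      skip-adjacent : ∀ {i G} → upper i ≡ false → Linked Adjacent G → Linked Adjacent (i ∷ G)
      skip-adjacent eq []           = [-]
      skip-adjacent eq adj@[-]      = (λ up → contradiction (trans (sym eq) up) λ ()) ∷ adj
      skip-adjacent eq adj@(_ ∷ _)  = (λ up → contradiction (trans (sym eq) up) λ ()) ∷ adj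

      step : ∀ {part} (sep : Separated p L part) → Gathered (suc k) Cs (items k sep ++ G)
      step (whole {x} x∈ compact) = gathered
        ((L-ok refl x∈ Sub.⊆-refl compact (λ ()) , 1≤k) ∷ ok)
        (≤-refl ∷ All.map m<n⇒m<1+n ranks)
        (All.map inj₁ (L-apart {mkItem x L L k false} refl refl) ∷ related)
        (skip-adjacent refl adjacent)
        (L-later refl ∷ All.map All.tail later)
      step (split {x} {T} {y} {U} x∈ y∈ T++U compactᵀ compactᵁ distant opp separable) = gathered
        ((L-ok refl y∈ (subst (U ⊆_) T++U (Subₚ.++⁺ˡ T Sub.⊆-refl)) compactᵁ
            (λ _ → x , subst (x ∈_) T++U (∈-++⁺ˡ x∈) , opp ∘ sym) , 1≤k)
          ∷ (L-ok refl x∈ (subst (T ⊆_) T++U (Subₚ.++⁺ʳ U Sub.⊆-refl)) compactᵀ (λ ()) , 1≤k) ∷ ok)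
        (≤-refl ∷ ≤-refl ∷ All.map m<n⇒m<1+n ranks)
        ((inj₂ hs ∷ All.map inj₁ (L-apart {mkItem y U L k true} refl refl))
          ∷ All.map inj₁ (L-apart {mkItem x T L k false} refl refl) ∷ related)
        ((λ _ → hs) ∷ skip-adjacent refl adjacent)
        (L-later refl ∷ L-later refl ∷ All.map All.tail later)
        where
        hs : Halves (mkItem y U L k true) (mkItem x T L k false)
        hs = halves refl refl refl refl T++U opp separable distant

  gather-gathered : ∀ {Cs parts} k (reps : Pointwise (Represents p) Cs parts) → 1 ≤ k → ∀ {G} → Gathered k Cs G →
    AllPairs (Precedes p) Cs → Unique (concat Cs) → All (λ C → (∀ {x} → x ∈ C → x ≢ p) × Constant p C) Cs →
    ∃[ k′ ] Gathered k′ [] (gather k reps G)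
  gather-gathered k [] 1≤k gath _ _ _ = k , gath
  gather-gathered {C ∷ Cs} k ((L , L↭C , ser , sep) ∷ reps) 1≤k gath (prec ∷ precs) unique ((p∉C , const) ∷ facts) =
    gather-gathered (suc k) reps (s≤s z≤n)
      (Step.step 1≤k gath L↭C ser prec (AllPairs-lookup-++ C unique) p∉C const sep)
      precs (proj₂ (AllPairs-++⁻ C unique)) facts

  open BipartitionRun X choices ≺-compatible p (representative {n}) (λ i → upper i ≡ true) sideAt

  -- As an innermost item the pivot takes part in triples like any other point.
  pivotItem : Item n
  pivotItem = mkItem p (p ∷ []) (p ∷ []) 0 false

  private
    pivot-ok : ItemOK pivotItem
    pivot-ok = itemOK (here refl) Sub.⊆-refl (seriated ([] ∷ []) λ where (_ Sub.∷ʳ ()) ; (refl Sub.∷ ()))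
      (λ where (here refl) (here refl) → ≤ᵈ-reflexive ≈ᵈ.refl)
      (λ where (here refl) (here refl) → ≈ᵈ.refl)
      (λ ()) (λ ())

    pivot-apart : ∀ {i} → ItemOK i → 1 ≤ rank i → Apart i pivotItem
    pivot-apart ok 1≤ = apart 1≤
      (λ where _ (here refl) → Far-pivot) (λ where x∈ (here refl) → ItemOK.p∉ ok 1≤ x∈)
      (λ where (here refl) u∈ v∈ → ItemOK.p-constant ok u∈ v∈)
      (λ where _ (here refl) (here refl) → ≈ᵈ.refl)

    comps-bounded : ∀ E → ∃[ c ] All (λ e → comp e < c) E
    comps-bounded []      = 0 , []
    comps-bounded (e ∷ E) with comps-bounded E
    ... | c , E< = suc (comp e) + c , m≤m+n (suc (comp e)) c ∷ All.map (λ e<c → ≤-trans e<c (m≤n+m c _)) E<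

  record Ordered (G : List (Item n)) (O : Points) : Set (ℓ₁ ⊔ˡ ℓ₂) where
    constructor ordered
    field
      order    : List Entry
      permutes : map item order ↭ pivotItem ∷ G
      points≡  : O ≡ map point order
      entries  : All EntryOK order
      outer    : AllPairs (Outer EntryRel) order

  sorted⇒ordered : ∀ {k G O} → Gathered k [] G → Sorted G O → Ordered G O
  sorted⇒ordered gath (sorted E refl points≡ tags ur) with comps-bounded E
  ... | c , E<c = ordered (arrangement E) (Perm.map⁺ item (arrangement-↭ E)) (points≡ e₀ refl)
    (Perm.All-resp-↭ (↭-sym (arrangement-↭ E))
      ((pivot-ok , λ ()) ∷ All.zip (All.map proj₁ (Allₚ.map⁻ (Gathered.ok gath)) , ur)))
    (arrangement-outer (AllPairs.zip (AllPairsₚ.map⁻ (Gathered.related gath) , tags))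
      -- Looseness towards the pivot reads d p u ≈ d p u, so the pivot can form a component of its
      -- own, newer than all others.
      (All.zipWith (λ ((ok , 1≤) , e<c) → inj₁ (pivot-apart ok 1≤) , inj₂ (e<c , ≈ᵈ.refl)) (Allₚ.map⁻ (Gathered.ok gath) , E<c)))
    where
    e₀ : Entry
    e₀ = entry pivotItem c false
    open Arrangement e₀

-- One call: arranging the copoints around the pivot

module Finding {V : DistanceScale a ℓ₁ ℓ₂} {n : ℕ} (X : Dissimilarity V n)
               (choices : Choices n) (orients : OrientsSeparated choices)
               {_≺_ : Rel (Fin n) 0ℓ} (≺-compatible : CompatibleOrder X _≺_) where
  open Algorithm X choices
  open Geometry X ≺-compatible
  open Copoints X choices ≺-compatible
  open Separation X choices ≺-compatible

  blockOf-spec : ∀ {bs y T} → AllPairs (λ b c → proj₁ b ≢ proj₁ c) bs → (y , T) ∈ bs →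
    Yields (blockOf bs y) λ T′ t → T′ ≡ T × t ≤ length bs
  blockOf-spec {bs = (x , T) ∷ bs} {y} (x≢ ∷ distinct) (here refl) = yields-tick {s = 1} (yields-if-dec (x ≟ x)
    (λ _ → yields-return (refl , s≤s z≤n)) (λ x≢x → contradiction refl x≢x))
  blockOf-spec {bs = (x , _) ∷ bs} {y} (x≢ ∷ distinct) (there y∈) = yields-tick {s = 1} (yields-if-dec (x ≟ y)
    (λ x≡y → contradiction x≡y (All.lookup x≢ y∈))
    (λ _ → yields-weaken (λ (eq , t≤) → eq , s≤s t≤) (blockOf-spec distinct y∈)))

  blocksOf-spec : ∀ {bs} {f : A → Point} {g : A → Points} → AllPairs (λ b c → proj₁ b ≢ proj₁ c) bs →
    ∀ {ys} → All (λ y → (f y , g y) ∈ bs) ys →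
    Yields (blocksOf bs (map f ys)) λ Ts t → Ts ≡ map g ys × t ≤ length ys * length bs
  blocksOf-spec distinct []         = yields-return (refl , z≤n)
  blocksOf-spec {bs = bs} {f} {g} distinct (y∈ ∷ ys∈) = yields-bind-≡ (blockOf-spec distinct y∈) λ t≤ →
    yields-bind-≡ (blocksOf-spec {f = f} {g} distinct ys∈) λ {s′} t′≤ → yields-return
      (refl , +-mono-≤ t≤ (≤-trans (≤-reflexive (+-identityʳ s′)) t′≤))

  module _ (p : Point) {Cs : List Points} {parts : List (List (Block n))} (reps : Pointwise (Represents p) Cs parts)
           (ordered-Cs : AllPairs (Precedes p) Cs) (unique : Unique (p ∷ concat Cs))
           (constant : All (Constant p) Cs) where

    private
      sideAt : Point → Side
      sideAt = Choices.side choices p parts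

    open Gathering X choices ≺-compatible p sideAt
    open Verification X choices ≺-compatible p sideAt
    open Bipartition X choices ≺-compatible p (representative {n}) (λ i → upper i ≡ true)
    open BipartitionRun X choices ≺-compatible p (representative {n}) (λ i → upper i ≡ true) sideAt

    private
      G : List (Item n)
      G = gather 1 reps []

      bs : List (Block n)
      bs = (p , p ∷ []) ∷ concat parts

      p∉ : ∀ {C} → C ∈ Cs → ∀ {x} → x ∈ C → x ≢ p
      p∉ C∈ x∈ x≡p = All.lookup (AllPairs.head unique) (∈-concat⁺′ x∈ C∈) (sym x≡p)

      G-gathered : ∃[ k ] Gathered k [] G
      G-gathered = gather-gathered 1 reps ≤-refl (gathered [] [] [] [] []) ordered-Cs (AllPairs.tail unique)
        (All.zip (All.tabulate (λ C∈ {x} → p∉ C∈ {x}) , constant))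

      G-from : All (FromParts parts) G
      G-from = gather-from 1 reps id []

      G-queue : Queue G
      G-queue = queue (Gathered.ok (proj₂ G-gathered)) (Gathered.related (proj₂ G-gathered)) (Gathered.adjacent (proj₂ G-gathered))

      keys : reverse (map representative G) ≡ map proj₁ (concat parts)
      keys = trans (cong reverse (trans (map-pt-gather 1 reps []) (++-identityʳ _))) (reverse-involutive _)

      length-G : length G ≡ length (concat parts)
      length-G = trans (sym (length-map representative G))
        (trans (sym (length-reverse (map representative G))) (trans (cong length keys) (length-map proj₁ (concat parts))))

      keys-distinct : AllPairs (λ b c → proj₁ b ≢ proj₁ c) bs
      keys-distinct = Allₚ.map⁻ (subst (All (p ≢_)) keys
          (Perm.All-resp-↭ (↭-sym (Perm.↭-reverse _)) (Allₚ.map⁺ (All.map (λ (ok , 1≤) p≡ →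
            ItemOK.p∉ ok 1≤ (ItemOK.block∈ ok (ItemOK.pt∈ ok)) (sym p≡)) (Gathered.ok (proj₂ G-gathered))))))
        ∷ AllPairsₚ.map⁻ (subst (AllPairs _≢_) keys
            (AllPairs.map (λ y≢x x≡y → y≢x (sym x≡y)) (AllPairs-reverse (AllPairsₚ.map⁺ (Queue-distinct G-queue)))))

    -- Besides the bipartition, the blocks of the k + 1 representatives (pivot included) are found
    -- by linear search, whence the square of `suc k`; the points themselves are copied once.
    arrange-spec : Yields
      (sortByBipartition p sideAt (map proj₁ (concat parts)) >>= λ order → blocksOf bs order >>= λ Ts → concatenate Ts)
      λ L t → L ↭ p ∷ concat Cs × Seriated L ×
        (let k = length (concat parts) in
         t ≤ (5 * (k * k) + 5 * k + 6) + (suc k * suc k + (suc (length (concat Cs)) + suc k + 1)))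
    arrange-spec = yields-bind
      (subst (λ Y → Yields (sortByBipartition p sideAt Y) λ O t →
                Sorted G O × t ≤ 5 * (length (concat parts) * length (concat parts)) + 5 * length (concat parts) + 6) keys
        (subst (λ k → Yields (sortByBipartition p sideAt (reverse (map representative G))) λ O t →
                  Sorted G O × t ≤ 5 * (k * k) + 5 * k + 6) length-G
          (sortByBipartition-spec G G-queue (All.map (λ (_ , from) up → orients p parts (proj₂ (proj₂ (from up)))) G-from))))
      λ (srt , t≤) → finish (sorted⇒ordered (proj₂ G-gathered) srt) t≤
      where
      finish : ∀ {O s} → Ordered G O → s ≤ 5 * (length (concat parts) * length (concat parts)) + 5 * length (concat parts) + 6 →
        Yields (blocksOf bs O >>= λ Ts → concatenate Ts) λ L t → L ↭ p ∷ concat Cs × Seriated L ×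
          (let k = length (concat parts) in
           s + t ≤ (5 * (k * k) + 5 * k + 6) + (suc k * suc k + (suc (length (concat Cs)) + suc k + 1)))
      finish (ordered order perm refl entries outer) s≤ = yields-bind
        (blocksOf-spec {f = point} {block ∘ item} keys-distinct
          (Allₚ.map⁻ (Perm.All-resp-↭ (↭-sym perm) (here refl ∷ All.map (there ∘ proj₁) G-from))))
        λ where
          (refl , t≤) → yields-weaken (λ where
              (refl , t′≤) → blocks-↭ ,
                concat-blocks-seriated entries outer (Unique-resp-↭ (↭-sym blocks-↭) unique) ,
                +-mono-≤ s≤ (+-mono-≤
                  (≤-trans t≤ (≤-reflexive (cong (_* suc (length (concat parts))) length-order)))
                  (≤-trans t′≤ (+-monoˡ-≤ 1 (≤-reflexive (cong₂ _+_ (Perm.↭-length blocks-↭)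
                    (trans (length-map (block ∘ item) order) length-order)))))))
            (yields-concatenate (map (block ∘ item) order))
        where
        length-order : length order ≡ suc (length (concat parts))
        length-order = trans (sym (length-map item order)) (trans (Perm.↭-length perm) (cong suc length-G))
        blocks-↭ : concat (map (block ∘ item) order) ↭ p ∷ concat Cs
        blocks-↭ = ↭-trans (↭-reflexive (cong concat (map-∘ order)))
          (↭-trans (concat-↭ (Perm.map⁺ block perm))
            (prep p (↭-trans (blocks-gather-↭ 1 reps []) (↭-reflexive (++-identityʳ _)))))

-- Total time and correctness of findCompatibleOrder

private
  -- The origin of 41 = 17 + 24. Bipartition and search for the blocks contribute 6·k′², and k′ ≤
  -- 2·k turns this into 24·k² ≤ 24·m·k. Of the 41·σ spent in the recursive calls, 17·σ is the
  -- potential left over by the refinement; the other 24·σ joins 24·m·k, and the count of separated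
  -- pairs bounds both by 24·(m² + m).
  find-cost : ∀ {t₁ t₂ t₃ t₄} m k k′ σ → t₁ + 17 * σ ≤ 14 * 1 * m + 17 * (m * m) + 4 →
    t₂ ≤ 41 * σ + k + 3 * m → t₃ ≤ k′ + k + 1 →
    t₄ ≤ (5 * (k′ * k′) + 5 * k′ + 6) + (suc k′ * suc k′ + (suc m + suc k′ + 1)) →
    k ≤ m → k′ ≤ 2 * k → m * k + σ ≤ m * m + m →
    suc (suc m) + (t₁ + (t₂ + (t₃ + t₄))) ≤ 41 * (suc m * suc m) + 1
  find-cost {t₁} {t₂} {t₃} {t₄} m k k′ σ t₁≤ t₂≤ t₃≤ t₄≤ k≤m k′≤ sep = +-cancelʳ-≤ (41 * σ) _ _ (begin
    suc (suc m) + (t₁ + (t₂ + (t₃ + t₄))) + 41 * σ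
      ≡⟨ e₁ m σ t₁ (t₂ + (t₃ + t₄)) ⟩
    suc (suc m) + ((t₁ + 17 * σ) + (t₂ + (t₃ + t₄))) + 24 * σ
      ≤⟨ +-monoˡ-≤ (24 * σ) (+-monoʳ-≤ (suc (suc m)) (+-mono-≤ t₁≤ (+-mono-≤ t₂≤ (+-mono-≤ t₃≤ t₄≤)))) ⟩
    suc (suc m) + ((14 * 1 * m + 17 * (m * m) + 4) + ((41 * σ + k + 3 * m) + ((k′ + k + 1) +
      ((5 * (k′ * k′) + 5 * k′ + 6) + (suc k′ * suc k′ + (suc m + suc k′ + 1)))))) + 24 * σ
      ≡⟨ e₂ m k k′ σ ⟩
    6 * (k′ * k′) + (9 * k′ + (17 * (m * m) + 19 * m + 2 * k + 17 + 41 * σ + 24 * σ))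
      ≤⟨ +-mono-≤ (*-monoʳ-≤ 6 (*-mono-≤ k′≤ k′≤)) (+-monoˡ-≤ _ (*-monoʳ-≤ 9 k′≤)) ⟩
    6 * (2 * k * (2 * k)) + (9 * (2 * k) + (17 * (m * m) + 19 * m + 2 * k + 17 + 41 * σ + 24 * σ))
      ≡⟨ e₃ m k σ ⟩
    24 * (k * k) + 20 * k + (17 * (m * m) + 19 * m + 17 + 41 * σ + 24 * σ)
      ≤⟨ +-monoˡ-≤ _ (+-mono-≤ (*-monoʳ-≤ 24 (*-monoˡ-≤ k k≤m)) (*-monoʳ-≤ 20 k≤m)) ⟩
    24 * (m * k) + 20 * m + (17 * (m * m) + 19 * m + 17 + 41 * σ + 24 * σ)
      ≡⟨ e₄ m k σ ⟩
    24 * (m * k + σ) + (17 * (m * m) + 39 * m + 17 + 41 * σ)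
      ≤⟨ +-monoˡ-≤ _ (*-monoʳ-≤ 24 sep) ⟩
    24 * (m * m + m) + (17 * (m * m) + 39 * m + 17 + 41 * σ)
      ≤⟨ m≤m+n _ (19 * m + 25) ⟩
    24 * (m * m + m) + (17 * (m * m) + 39 * m + 17 + 41 * σ) + (19 * m + 25)
      ≡⟨ e₅ m σ ⟩
    41 * (suc m * suc m) + 1 + 41 * σ ∎)
    where
    open ≤-Reasoning
    e₁ : ∀ m σ t r → suc (suc m) + (t + r) + 41 * σ ≡ suc (suc m) + ((t + 17 * σ) + r) + 24 * σ
    e₁ = solve-∀
    e₂ : ∀ m k k′ σ → suc (suc m) + ((14 * 1 * m + 17 * (m * m) + 4) + ((41 * σ + k + 3 * m) + ((k′ + k + 1) +
           ((5 * (k′ * k′) + 5 * k′ + 6) + (suc k′ * suc k′ + (suc m + suc k′ + 1)))))) + 24 * σ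
         ≡ 6 * (k′ * k′) + (9 * k′ + (17 * (m * m) + 19 * m + 2 * k + 17 + 41 * σ + 24 * σ))
    e₂ = solve-∀
    e₃ : ∀ m k σ → 6 * (2 * k * (2 * k)) + (9 * (2 * k) + (17 * (m * m) + 19 * m + 2 * k + 17 + 41 * σ + 24 * σ))
         ≡ 24 * (k * k) + 20 * k + (17 * (m * m) + 19 * m + 17 + 41 * σ + 24 * σ)
    e₃ = solve-∀
    e₄ : ∀ m k σ → 24 * (m * k) + 20 * m + (17 * (m * m) + 19 * m + 17 + 41 * σ + 24 * σ)
         ≡ 24 * (m * k + σ) + (17 * (m * m) + 39 * m + 17 + 41 * σ)
    e₄ = solve-∀
    e₅ : ∀ m σ → 24 * (m * m + m) + (17 * (m * m) + 39 * m + 17 + 41 * σ) + (19 * m + 25)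
         ≡ 41 * (suc m * suc m) + 1 + 41 * σ
    e₅ = solve-∀

module Correctness {V : DistanceScale a ℓ₁ ℓ₂} {n : ℕ} (X : Dissimilarity V n)
                   (choices : Choices n) (orients : OrientsSeparated choices)
                   {_≺_ : Rel (Fin n) 0ℓ} (≺-compatible : CompatibleOrder X _≺_) where
  open Distances V
  open NaturalMax totalOrder using () renaming (⊔-lub to ⊔ᵈ-lub)
  open Algorithm X choices
  open Geometry X ≺-compatible
  open Copoints X choices ≺-compatible
  open Separation X choices ≺-compatible
  open Finding X choices orients ≺-compatible

  FindResult : Points → Points → ℕ → Set ℓ₂
  FindResult L L′ t = L′ ↭ L × Seriated L′ × t ≤ 41 * (length L * length L) + 1

  record CopointOK (fuel : ℕ) (p : Point) (C : Points) : Set ℓ₁ where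
    constructor copointOK
    field
      nonempty : NonEmpty C
      small    : length C ≤ fuel
      unique   : Unique C
      ≢p       : ∀ {x} → x ∈ C → x ≢ p
      constant : Constant p C

  mutual
    -- The one order ≺ on the whole space serves all recursive calls, because compatibility of
    -- triples passes to subsets; only the duplicate-free list `L` changes.
    findWithin-spec : ∀ fuel L → length L ≤ fuel → Unique L → Yields (findWithin fuel L) (FindResult L)
    findWithin-spec fuel [] _ _ = _ , _ , refl , ↭-refl , seriated [] (λ ()) , ≤-refl
    findWithin-spec (suc fuel) (x ∷ xs) (s≤s size) unique = yields-tick {s = suc (length (x ∷ xs))} (yields-bind
      (recursiveRefineWithin-spec _ p (p ∷ []) X′ [] ≤-refl (s≤s z≤n) (positioned (λ where (here refl) _ → Far-pivot) (λ ())))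
      λ {Cs} (ref , t₁≤) → found Cs ref t₁≤)
      where
      i = Choices.pivot choices x xs
      p = lookup (x ∷ xs) i
      X′ = removeAt (x ∷ xs) i
      p∷X′ : p ∷ X′ ↭ x ∷ xs
      p∷X′ = removeAt-↭ (x ∷ xs) i
      length-X′ : length X′ ≡ length xs
      length-X′ = suc-injective (Perm.↭-length p∷X′)
      found : ∀ Cs {t₁} → Refined p (λ z → z ∈ p ∷ [] ⊎ z ∈ []) X′ Cs →
        t₁ + 17 * sumSquares Cs ≤ 14 * 1 * length X′ + 17 * (length X′ * length X′) + 4 →
        Yields (representCopoints fuel p Cs >>= λ parts → concatenate parts >>= λ bs →
                sortByBipartition p (Choices.side choices p parts) (map proj₁ bs) >>= λ order →
                blocksOf ((p , p ∷ []) ∷ bs) order >>= λ Ts → concatenate Ts)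
          λ L t → L ↭ x ∷ xs × Seriated L × suc (length (x ∷ xs)) + (t₁ + t) ≤ 41 * (length (x ∷ xs) * length (x ∷ xs)) + 1
      found Cs {t₁} (refined perm nonempty ordered constant) t₁≤ =
        yields-bind (representCopoints-spec fuel p Cs (All.tabulate C-ok)) λ {parts} {t₂} (reps , t₂≤) →
        yields-bind-≡ (yields-concatenate parts) λ {t₃} t₃≤ →
          yields-weaken
            (λ {L} {t₄} (L↭ , ser , t₄≤) →
              ↭-trans L↭ (↭-trans (prep p perm) p∷X′) , ser ,
              subst (λ m → suc (suc m) + (t₁ + (t₂ + (t₃ + t₄))) ≤ 41 * (suc m * suc m) + 1) length-concat
                (find-cost {t₁} {t₂} {t₃} {t₄} (length (concat Cs)) (length Cs) (length (concat parts)) (sumSquares Cs)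
                  (subst (λ m → t₁ + 17 * sumSquares Cs ≤ 14 * 1 * m + 17 * (m * m) + 4) (sym (Perm.↭-length perm)) t₁≤)
                  t₂≤ (subst (λ k → t₃ ≤ length (concat parts) + k + 1) (proj₁ (length-parts≤ reps)) t₃≤) t₄≤
                  (length≤length-concat nonempty) (proj₂ (length-parts≤ reps)) (separated-pairs nonempty)))
            (arrange-spec p reps ordered unique-Cs (All.map (λ c {x} {y} → c (inj₁ (here refl)) {x} {y}) constant))
        where
        -- A placeholder for the sides: counting representatives precedes any such choice.
        open Gathering X choices ≺-compatible p (λ _ → left) using (length-parts≤)
        unique-Cs : Unique (p ∷ concat Cs)
        unique-Cs = Unique-resp-↭ (↭-sym (↭-trans (prep p perm) p∷X′)) unique
        length-concat : length (concat Cs) ≡ length xs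
        length-concat = trans (Perm.↭-length perm) length-X′
        C-ok : ∀ {C} → C ∈ Cs → CopointOK fuel p C
        C-ok C∈ = copointOK (All.lookup nonempty C∈)
          (≤-trans (length-member C∈) (≤-trans (≤-reflexive length-concat) size))
          (unique-member C∈ (AllPairs.tail unique-Cs))
          (λ x∈ x≡p → All.lookup (AllPairs.head unique-Cs) (∈-concat⁺′ x∈ C∈) (sym x≡p))
          (All.lookup constant C∈ (inj₁ (here refl)))
          where
          length-member : ∀ {C Cs} → C ∈ Cs → length C ≤ length (concat Cs)
          length-member {C} (here refl)          = ≤-trans (m≤m+n (length C) _) (≤-reflexive (sym (length-++ C)))
          length-member {Cs = D ∷ _} (there C∈) =
            ≤-trans (length-member C∈) (≤-trans (m≤n+m _ (length D)) (≤-reflexive (sym (length-++ D))))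
          unique-member : ∀ {C Cs} → C ∈ Cs → Unique (concat Cs) → Unique C
          unique-member {C} (here refl)          u = proj₁ (AllPairs-++⁻ C u)
          unique-member {Cs = D ∷ _} (there C∈) u = unique-member C∈ (proj₂ (AllPairs-++⁻ D u))

    representCopoints-spec : ∀ fuel p Cs → All (CopointOK fuel p) Cs →
      Yields (representCopoints fuel p Cs) λ parts t →
        Pointwise (Represents p) Cs parts × t ≤ 41 * sumSquares Cs + length Cs + 3 * length (concat Cs)
    representCopoints-spec fuel p []       []                                                     = yields-return ([] , z≤n)
    representCopoints-spec fuel p (C ∷ Cs) (copointOK nonempty small unique ≢p constant ∷ oks) =
      yields-bind (representCopoints-spec fuel p Cs oks) λ {parts} {t} (reps , t≤) →
      yields-bind (findWithin-spec fuel C small unique) λ {L} {t′} (L↭C , ser , t′≤) →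
      yields-bind (separate L↭C ser) λ {part} {t″} (sep , t″≤) →
      yields-return ((_ , L↭C , ser , sep) ∷ reps , cost t≤ t′≤ t″≤)
      where
      separate : ∀ {L} → L ↭ C → Seriated L → Yields (separateIfSeparable p L) λ part t → Separated p L part × t ≤ 3 * length C
      separate {[]}    L↭C ser = contradiction (≤-trans nonempty (≤-reflexive (sym (Perm.↭-length L↭C)))) λ ()
      separate {_ ∷ _} L↭C ser = yields-weaken (λ (sep , t≤) → sep , ≤-trans t≤ (*-monoʳ-≤ 3 (≤-reflexive (Perm.↭-length L↭C))))
        (separateIfSeparable-spec ser (λ x∈ → ≢p (Perm.∈-resp-↭ L↭C x∈))
          (λ x∈ y∈ → constant (Perm.∈-resp-↭ L↭C x∈) (Perm.∈-resp-↭ L↭C y∈)))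
      cost : ∀ {t t′ t″} → t ≤ 41 * sumSquares Cs + length Cs + 3 * length (concat Cs) →
        t′ ≤ 41 * (length C * length C) + 1 → t″ ≤ 3 * length C →
        t + (t′ + (t″ + 0)) ≤ 41 * sumSquares (C ∷ Cs) + length (C ∷ Cs) + 3 * length (concat (C ∷ Cs))
      cost t≤ t′≤ t″≤ = ≤-trans (+-mono-≤ t≤ (+-mono-≤ t′≤ (+-monoˡ-≤ 0 t″≤)))
        (≤-reflexive (trans (e (sumSquares Cs) (length Cs) (length (concat Cs)) (length C))
          (cong (λ l → 41 * sumSquares (C ∷ Cs) + length (C ∷ Cs) + 3 * l) (sym (length-++ C)))))
        where
        e : ∀ σ k m c → 41 * σ + k + 3 * m + (41 * (c * c) + 1 + (3 * c + 0)) ≡ 41 * (c * c + σ) + suc k + 3 * (c + m)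
        e = solve-∀

  seriated⇒compatible : ∀ {L} → Seriated L → (∀ x → x ∈ L) → CompatibleOrder X (Before L)
  seriated⇒compatible {L} (seriated unique middle) all = record
    { isStrictTotalOrder = record
      { isStrictPartialOrder = record
        { isEquivalence = isEquivalence
        ; irrefl        = Before-irrefl unique
        ; trans         = Before-trans unique
        ; <-resp-≈      = resp₂ (Before L)
        }
      ; compare = compare
      }
    ; compatible = λ xy yz → ⊔ᵈ-lub (proj₁ (middle xy yz)) (proj₂ (middle xy yz))
    }
    where
    irrefl : ∀ {x} → ¬ Before L x x
    irrefl = Before-irrefl unique refl
    compare : ∀ x y → Tri (Before L x y) (x ≡ y) (Before L y x)
    compare x y with Before-connex (all x) (all y)
    ... | inj₁ refl      = tri≈ irrefl refl irrefl
    ... | inj₂ (inj₁ xy) = tri< xy (λ where refl → irrefl xy) (λ yx → irrefl (Before-trans unique xy yx))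
    ... | inj₂ (inj₂ yx) = tri> (λ xy → irrefl (Before-trans unique xy yx)) (λ where refl → irrefl yx) yx

theorem7p2 : ∀ {a ℓ₁ ℓ₂} →
    ∃[ c ] ∃[ n₀ ]
    ((V : DistanceScale a ℓ₁ ℓ₂) (n : ℕ) (X : Dissimilarity V n) →
    Robinson X →
    (choices : Choices n) → OrientsSeparated choices →
    (points : List (Fin n)) → points ↭ allFin n →
    ∃[ L ] ∃[ t ]
    (Algorithm.findCompatibleOrder X choices points ≡ just (L , t) ×
    L ↭ allFin n ×
    CompatibleOrder X (Before L) ×
    (n₀ ≤ n → t ≤ c * n ^ 2)))
-- The bound obtained is 41·n² + 1, its 1 being the step spent on an empty list; from n = 1 on a
-- further n² covers it.
theorem7p2 = 42 , 1 , λ V n X (_ , ≺-compatible) choices orients points points↭ →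
  let open Correctness X choices orients ≺-compatible
      L , t , run , L↭ , ser , t≤ = findWithin-spec (length points) points ≤-refl
        (Unique-resp-↭ (↭-sym points↭) (allFin⁺ n))
      L↭all = ↭-trans L↭ points↭
  in L , t , run , L↭all ,
     seriated⇒compatible ser (λ x → Perm.∈-resp-↭ (↭-sym L↭all) (∈-allFin x)) ,
     λ 1≤n → ≤-trans t≤ (≤-trans
       (≤-reflexive (cong (λ k → 41 * (k * k) + 1) (trans (Perm.↭-length points↭) (length-tabulate {n = n} id))))
       (quadratic n 1≤n))
  where
  quadratic : ∀ n → 1 ≤ n → 41 * (n * n) + 1 ≤ 42 * n ^ 2
  quadratic n 1≤n = ≤-trans (+-monoʳ-≤ (41 * (n * n)) (*-mono-≤ 1≤n 1≤n)) (≤-reflexive (e n))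
    where
    e : ∀ n → 41 * (n * n) + n * n ≡ 42 * (n * (n * 1))
    e = solve-∀
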